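{- Let $p(x)\in\mathbb{R}[x]$ be a polynomial and let $m\ge2$ be an integer. Then the sequence $n\mapsto\lfloor p(n)\rfloor \bmod m$, $n\ge0$, is automatic if and only if it is periodic.
   Context: For an integer $k\ge2$ let $\Sigma_k=\{0,\dots,k-1\}$, let $\Sigma_k^*$ be the set of finite words over $\Sigma_k$ (including the empty word), and let $(n)_k\in\Sigma_k^*$ be the base-$k$ representation of $n\ge0$ without leading zeros ($(0)_k$ is the empty word). A $k$-automaton $(S,s_\bullet,\delta,\Omega,\tau)$ consists of a finite set of states $S$, an initial state $s_\bullet\in S$, a transition map $\delta\colon S\times\Sigma_k\to S$ (extended to $\tilde\delta\colon S\times\Sigma_k^*\to S$ by reading a word letter by letter from left to right), an output set $\Omega$ and an output map $\tau\colon S\to\Omega$. A sequence $(a_n)_{n\ge0}$ with values in a finite set $\Omega$ is $k$-automatic if there is a $k$-automaton with $a_n=\tau(\tilde\delta(s_\bullet,(n)_k))$ for all $n$; it is automatic if it is $k$-automatic for some $k\ge2$. -}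

module Defs where

open import Data.Nat.Base as ℕ using (ℕ; NonZero)
import Data.Nat.Properties as ℕ
open import Data.Integer.Base as ℤ using (ℤ)
open import Data.Integer.DivMod using (_%ℕ_; n%ℕd<d)
open import Data.Rational.Base as ℚ using (ℚ; 0ℚ; 1ℚ; ½; Positive; positive)
import Data.Rational.Properties as ℚ
open import Data.Rational.Solver using (module +-*-Solver)
open import Data.Fin.Base using (Fin; toℕ; fromℕ<)
open import Data.List.Base using (List; []; _∷_; foldl; reverse; dropWhile)
open import Data.Digit using (toDigits)
open import Data.Product.Base using (Σ-syntax; ∃-syntax; _×_; _,_; proj₁)
open import Relation.Nullary using (¬_)
open import Relation.Nullary.Decidable using (fromWitness)
open import Relation.Binary.PropositionalEquality using (_≡_; refl; sym; trans; cong; subst; cong₂)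

------------------------------------------------------------------------
-- Real numbers as Cauchy sequences of rationals

IsCauchy : (ℕ → ℚ) → Set
IsCauchy x = ∀ ε → 0ℚ ℚ.< ε →
  ∃[ N ] ∀ m n → N ℕ.≤ m → N ℕ.≤ n → ℚ.∣ x m ℚ.- x n ∣ ℚ.< ε

-- Two sequences represent the same real number when their difference tends
-- to zero.  Everything below respects this relation.
record ℝ : Set where
  constructor mkℝ
  field
    seq    : ℕ → ℚ
    cauchy : IsCauchy seq

open ℝ public

private

  module _ where
    open +-*-Solver

    difference-+ : ∀ a b c d → (a ℚ.+ b) ℚ.- (c ℚ.+ d) ≡ (a ℚ.- c) ℚ.+ (b ℚ.- d)
    difference-+ = solve 4 (λ a b c d →
      (a :+ b) :- (c :+ d) := (a :- c) :+ (b :- d)) refl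

    difference-* : ∀ a b c d →
      a ℚ.* b ℚ.- c ℚ.* d ≡ a ℚ.* (b ℚ.- d) ℚ.+ d ℚ.* (a ℚ.- c)
    difference-* = solve 4 (λ a b c d →
      a :* b :- c :* d := a :* (b :- d) :+ d :* (a :- c)) refl

    split : ∀ a b → a ≡ (a ℚ.- b) ℚ.+ b
    split = solve 2 (λ a b → a := (a :- b) :+ b) refl

  0<½ε : ∀ {ε} → 0ℚ ℚ.< ε → 0ℚ ℚ.< ½ ℚ.* ε
  0<½ε {ε} 0<ε = subst (ℚ._< ½ ℚ.* ε) (ℚ.*-zeroʳ ½) (ℚ.*-monoʳ-<-pos ½ 0<ε)

  halves : ∀ ε → ½ ℚ.* ε ℚ.+ ½ ℚ.* ε ≡ ε
  halves ε = trans (sym (ℚ.*-distribʳ-+ ε ½ ½)) (ℚ.*-identityˡ ε)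

  const-cauchy : ∀ q → IsCauchy (λ _ → q)
  const-cauchy q ε 0<ε =
    0 , λ _ _ _ _ → subst (ℚ._< ε) (cong ℚ.∣_∣ (sym (ℚ.+-inverseʳ q))) 0<ε

  +-cauchy : ∀ {x y} → IsCauchy x → IsCauchy y → IsCauchy (λ n → x n ℚ.+ y n)
  +-cauchy {x} {y} cx cy ε 0<ε with cx (½ ℚ.* ε) (0<½ε 0<ε) | cy (½ ℚ.* ε) (0<½ε 0<ε)
  ... | M , hx | N , hy = M ℕ.⊔ N , λ m n p q → begin-strict
    ℚ.∣ (x m ℚ.+ y m) ℚ.- (x n ℚ.+ y n) ∣
      ≡⟨ cong ℚ.∣_∣ (difference-+ (x m) (y m) (x n) (y n)) ⟩
    ℚ.∣ (x m ℚ.- x n) ℚ.+ (y m ℚ.- y n) ∣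
      ≤⟨ ℚ.∣p+q∣≤∣p∣+∣q∣ (x m ℚ.- x n) (y m ℚ.- y n) ⟩
    ℚ.∣ x m ℚ.- x n ∣ ℚ.+ ℚ.∣ y m ℚ.- y n ∣
      <⟨ ℚ.+-mono-< (hx m n (ℕ.m⊔n≤o⇒m≤o M N p) (ℕ.m⊔n≤o⇒m≤o M N q))
                    (hy m n (ℕ.m⊔n≤o⇒n≤o M N p) (ℕ.m⊔n≤o⇒n≤o M N q)) ⟩
    ½ ℚ.* ε ℚ.+ ½ ℚ.* ε
      ≡⟨ halves ε ⟩
    ε ∎
    where open ℚ.≤-Reasoning

  bounded : ∀ {x} → IsCauchy x →
    ∃[ B ] ∃[ N ] 0ℚ ℚ.< B × (∀ n → N ℕ.≤ n → ℚ.∣ x n ∣ ℚ.≤ B)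
  bounded {x} cx with cx 1ℚ (ℚ.positive⁻¹ 1ℚ)
  ... | N , h = 1ℚ ℚ.+ ℚ.∣ x N ∣ , N
      , ℚ.+-mono-<-≤ (ℚ.positive⁻¹ 1ℚ) (ℚ.0≤∣p∣ (x N))
      , λ n p → begin
    ℚ.∣ x n ∣                          ≡⟨ cong ℚ.∣_∣ (split (x n) (x N)) ⟩
    ℚ.∣ (x n ℚ.- x N) ℚ.+ x N ∣        ≤⟨ ℚ.∣p+q∣≤∣p∣+∣q∣ (x n ℚ.- x N) (x N) ⟩
    ℚ.∣ x n ℚ.- x N ∣ ℚ.+ ℚ.∣ x N ∣    ≤⟨ ℚ.+-monoˡ-≤ ℚ.∣ x N ∣ (ℚ.<⇒≤ (h n N p ℕ.≤-refl)) ⟩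
    1ℚ ℚ.+ ℚ.∣ x N ∣                   ∎
    where open ℚ.≤-Reasoning

  divide : ∀ {ε B} → 0ℚ ℚ.< ε → 0ℚ ℚ.< B → ∃[ δ ] 0ℚ ℚ.< δ × B ℚ.* δ ≡ ε
  divide {ε} {B} 0<ε 0<B = r ℚ.* ε
    , subst (ℚ._< r ℚ.* ε) (ℚ.*-zeroʳ r) (ℚ.*-monoʳ-<-pos r 0<ε)
    , trans (sym (ℚ.*-assoc B r ε))
            (trans (cong (ℚ._* ε) (ℚ.*-inverseʳ B)) (ℚ.*-identityˡ ε))
    where
    instance
      B-pos : Positive B
      B-pos = positive 0<B
      B-nonZero : ℚ.NonZero B
      B-nonZero = ℚ.pos⇒nonZero B
    r : ℚ
    r = ℚ.1/ B
    instance
      r-pos : Positive r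
      r-pos = ℚ.1/pos⇒pos B

  ∣∣*∣∣-< : ∀ {p q B δ} → 0ℚ ℚ.< B → ℚ.∣ p ∣ ℚ.≤ B → ℚ.∣ q ∣ ℚ.< δ →
            ℚ.∣ p ℚ.* q ∣ ℚ.< B ℚ.* δ
  ∣∣*∣∣-< {p} {q} {B} {δ} 0<B p≤B q<δ = begin-strict
    ℚ.∣ p ℚ.* q ∣           ≡⟨ ℚ.∣p*q∣≡∣p∣*∣q∣ p q ⟩
    ℚ.∣ p ∣ ℚ.* ℚ.∣ q ∣     ≤⟨ ℚ.*-monoʳ-≤-nonNeg ℚ.∣ q ∣ {{ℚ.∣-∣-nonNeg q}} p≤B ⟩
    B ℚ.* ℚ.∣ q ∣           <⟨ ℚ.*-monoʳ-<-pos B {{positive 0<B}} q<δ ⟩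
    B ℚ.* δ                 ∎
    where open ℚ.≤-Reasoning

  product-estimate : ∀ {a b c d B C δ η ε} → 0ℚ ℚ.< B → 0ℚ ℚ.< C →
    B ℚ.* η ≡ ½ ℚ.* ε → C ℚ.* δ ≡ ½ ℚ.* ε →
    ℚ.∣ a ∣ ℚ.≤ B → ℚ.∣ d ∣ ℚ.≤ C →
    ℚ.∣ b ℚ.- d ∣ ℚ.< η → ℚ.∣ a ℚ.- c ∣ ℚ.< δ →
    ℚ.∣ a ℚ.* b ℚ.- c ℚ.* d ∣ ℚ.< ε
  product-estimate {a} {b} {c} {d} {B} {C} {δ} {η} {ε} 0<B 0<C Bη≡ Cδ≡ a≤B d≤C b-d<η a-c<δ =
    begin-strict
    ℚ.∣ a ℚ.* b ℚ.- c ℚ.* d ∣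
      ≡⟨ cong ℚ.∣_∣ (difference-* a b c d) ⟩
    ℚ.∣ a ℚ.* (b ℚ.- d) ℚ.+ d ℚ.* (a ℚ.- c) ∣
      ≤⟨ ℚ.∣p+q∣≤∣p∣+∣q∣ (a ℚ.* (b ℚ.- d)) (d ℚ.* (a ℚ.- c)) ⟩
    ℚ.∣ a ℚ.* (b ℚ.- d) ∣ ℚ.+ ℚ.∣ d ℚ.* (a ℚ.- c) ∣
      <⟨ ℚ.+-mono-< (∣∣*∣∣-< {a} {b ℚ.- d} 0<B a≤B b-d<η)
                    (∣∣*∣∣-< {d} {a ℚ.- c} 0<C d≤C a-c<δ) ⟩
    B ℚ.* η ℚ.+ C ℚ.* δ
      ≡⟨ cong₂ ℚ._+_ Bη≡ Cδ≡ ⟩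
    ½ ℚ.* ε ℚ.+ ½ ℚ.* ε
      ≡⟨ halves ε ⟩
    ε ∎
    where open ℚ.≤-Reasoning

  *-cauchy : ∀ {x y} → IsCauchy x → IsCauchy y → IsCauchy (λ n → x n ℚ.* y n)
  *-cauchy {x} {y} cx cy ε 0<ε =
    let B , M₁ , 0<B , bx = bounded {x} cx
        C , N₁ , 0<C , by = bounded {y} cy
        δ , 0<δ , Cδ≡ = divide (0<½ε 0<ε) 0<C
        η , 0<η , Bη≡ = divide (0<½ε 0<ε) 0<B
        M₂ , hx = cx δ 0<δ
        N₂ , hy = cy η 0<η
    in (M₁ ℕ.⊔ N₁) ℕ.⊔ (M₂ ℕ.⊔ N₂) , λ m n p q →
    let p₁ = ℕ.m⊔n≤o⇒m≤o (M₁ ℕ.⊔ N₁) (M₂ ℕ.⊔ N₂) p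
        p₂ = ℕ.m⊔n≤o⇒n≤o (M₁ ℕ.⊔ N₁) (M₂ ℕ.⊔ N₂) p
        q₁ = ℕ.m⊔n≤o⇒m≤o (M₁ ℕ.⊔ N₁) (M₂ ℕ.⊔ N₂) q
        q₂ = ℕ.m⊔n≤o⇒n≤o (M₁ ℕ.⊔ N₁) (M₂ ℕ.⊔ N₂) q
    in product-estimate {x m} {y m} {x n} {y n} 0<B 0<C Bη≡ Cδ≡
         (bx m (ℕ.m⊔n≤o⇒m≤o M₁ N₁ p₁))
         (by n (ℕ.m⊔n≤o⇒n≤o M₁ N₁ q₁))
         (hy m n (ℕ.m⊔n≤o⇒n≤o M₂ N₂ p₂) (ℕ.m⊔n≤o⇒n≤o M₂ N₂ q₂))
         (hx m n (ℕ.m⊔n≤o⇒m≤o M₂ N₂ p₂) (ℕ.m⊔n≤o⇒m≤o M₂ N₂ q₂))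

infixl 6 _+ᴿ_
infixl 7 _*ᴿ_
infix  4 _<ᴿ_ _≤ᴿ_

_+ᴿ_ : ℝ → ℝ → ℝ
x +ᴿ y = mkℝ (λ n → seq x n ℚ.+ seq y n) (+-cauchy {seq x} {seq y} (cauchy x) (cauchy y))

_*ᴿ_ : ℝ → ℝ → ℝ
x *ᴿ y = mkℝ (λ n → seq x n ℚ.* seq y n) (*-cauchy {seq x} {seq y} (cauchy x) (cauchy y))

fromℚ : ℚ → ℝ
fromℚ q = mkℝ (λ _ → q) (const-cauchy q)

fromℤ : ℤ → ℝ
fromℤ z = fromℚ (z ℚ./ 1)

fromℕ : ℕ → ℝ
fromℕ n = fromℤ (ℤ.+ n)

_<ᴿ_ : ℝ → ℝ → Set
x <ᴿ y = ∃[ ε ] 0ℚ ℚ.< ε × (∃[ N ] ∀ n → N ℕ.≤ n → seq x n ℚ.+ ε ℚ.≤ seq y n)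

_≤ᴿ_ : ℝ → ℝ → Set
x ≤ᴿ y = ¬ (y <ᴿ x)

-- z = ⌊x⌋.  A relation rather than a function ℝ → ℤ, because the floor is not
-- constructively computable; the relation determines z uniquely.
IsFloor : ℝ → ℤ → Set
IsFloor x z = fromℤ z ≤ᴿ x × x <ᴿ fromℤ (z ℤ.+ ℤ.1ℤ)

------------------------------------------------------------------------
-- Real polynomials

-- The list c₀ ∷ c₁ ∷ … ∷ c_d ∷ [] stands for c₀ + c₁ x + … + c_d x^d.
Polynomial : Set
Polynomial = List ℝ

eval : Polynomial → ℝ → ℝ
eval []       x = fromℚ 0ℚ
eval (c ∷ cs) x = c +ᴿ x *ᴿ eval cs x

------------------------------------------------------------------------
-- Automata and sequences

record Automaton (k : ℕ) (Ω : Set) : Set where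
  field
    numStates : ℕ

  State : Set
  State = Fin numStates

  field
    start  : State
    step   : State → Fin k → State
    output : State → Ω

  run : State → List (Fin k) → State
  run = foldl step

-- `toDigits` is least significant digit first and yields a single digit 0
-- for 0; here the most significant digit comes first and 0 is the empty word.
representation : (k : ℕ) → 2 ℕ.≤ k → ℕ → List (Fin k)
representation k 2≤k n =
  dropWhile (λ d → toℕ d ℕ.≟ 0)
            (reverse (proj₁ (toDigits k {base≥2 = fromWitness 2≤k} n)))

IsAutomaticIn : {Ω : Set} (k : ℕ) → 2 ℕ.≤ k → (ℕ → Ω) → Set
IsAutomaticIn {Ω} k 2≤k a =
  Σ[ 𝒜 ∈ Automaton k Ω ] let open Automaton 𝒜 in
  ∀ n → a n ≡ output (run start (representation k 2≤k n))

IsAutomatic : {Ω : Set} → (ℕ → Ω) → Set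
IsAutomatic a = ∃[ k ] Σ[ 2≤k ∈ 2 ℕ.≤ k ] IsAutomaticIn k 2≤k a

IsPeriodic : {Ω : Set} → (ℕ → Ω) → Set
IsPeriodic a = ∃[ T ] 1 ℕ.≤ T × (∀ n → a (n ℕ.+ T) ≡ a n)

residue : ℤ → (m : ℕ) .{{_ : NonZero m}} → Fin m
residue z m = fromℕ< (n%ℕd<d z m)

-- Let F = ⌊p⌋.  Two different words of equal length that act in the same way on the states of
-- an automaton for F mod m give K, u and h > 0 with F (K x + u) ≡ F (K x + u + h) mod m for all x.
--
-- Fix x and let A and B be p along the progressions of step K starting at K x + u and at
-- K x + u + h.  By polynomial recurrence there is an n for which the non-constant coefficients of
-- A (n y) and B (n y), as polynomials in y, are close to multiples of m; subtracting these
-- multiples leaves the floors modulo m unchanged and makes both polynomials move in small steps.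
-- If they stay bounded for all y then they are constant, which makes the increments of p rational.
-- Otherwise one of them travels far.  The floors are congruent modulo m ≥ 2, so A and B cross
-- integers at the same times, and since their differences change sign only a bounded number of
-- times, there is a stretch with more crossings than the degree on which each of them crosses
-- in one direction only.  Then A ∓ B is close to one and the same integer at these crossings,
-- which are well separated, and by interpolation also at the start.  As the closeness is
-- arbitrary, p (K x + u) ∓ p (K x + u + h) is an integer.  This holds for all x, with a sign
-- depending on x, so the increments of p are rational and F mod m is periodic.
--
-- The argument for automatic ⇒ periodic is classical.  It is carried out under a double
-- negation, which can be removed because the automaton determines a number that is a period
-- as soon as there is any period at all.

module Submission where

open import Defs
open import Data.Nat.Base using (ℕ; NonZero; _≤_; zero; suc; z≤n; s≤s)
import Data.Nat.Base as ℕ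
import Data.Nat.Properties as ℕ
import Data.Nat.DivMod as ℕ
open import Data.Fin.Base using (Fin; toℕ; fromℕ<)
import Data.Fin.Base as Fin
import Data.Fin.Properties as Fin
open import Data.List.Base using (List; []; _∷_; length; foldl; foldr; reverse; dropWhile)
open import Data.List.Properties using (reverse-foldl)
open import Data.Digit using (fromDigits; toDigits)
open import Data.Integer.Base using (ℤ)
import Data.Integer.Base as ℤ
import Data.Integer.Properties as ℤ
import Data.Integer.DivMod as ℤ
open import Data.Rational.Base using (ℚ; 0ℚ; 1ℚ; _+_; _*_; _-_; -_; ∣_∣; toℚᵘ; 1/_; mkℚ; ↥_; ↧_)
  renaming (_≤_ to _≤ℚ_; _<_ to _<ℚ_)
import Data.Rational.Base as ℚ
import Data.Rational.Properties as ℚ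
import Data.Rational.Unnormalised.Base as ℚᵘ
import Data.Rational.Unnormalised.Properties as ℚᵘ
open import Data.Rational.Solver using (module +-*-Solver)
open +-*-Solver using (solve; _:+_; _:*_; _:-_; :-_; _:=_; con)
open import Data.Product.Base using (Σ-syntax; ∃-syntax; _×_; _,_; proj₁; proj₂)
open import Data.Sum.Base using (_⊎_; inj₁; inj₂)
open import Function.Base using (flip)
open import Function.Bundles using (_⇔_; mk⇔)
open import Data.Empty using (⊥; ⊥-elim)
open import Relation.Nullary.Decidable using (_×-dec_; decidable-stable; fromWitness)
open import Relation.Nullary using (¬_; Dec; yes; no)
open import Data.Nat.Solver using () renaming (module +-*-Solver to ℕSolver)
open ℕSolver using () renaming (solve to ℕsolve; _:+_ to _:++_; _:*_ to _:+*_; _:=_ to _:≡_; con to ℕcon)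
open import Data.Integer.Solver using () renaming (module +-*-Solver to ℤSolver)
open ℤSolver using () renaming (solve to ℤsolve; _:+_ to _⊕_; _:*_ to _⊗_; _:-_ to _⊝_; :-_ to ⊖_; _:=_ to _⊜_; con to ℤcon)
open import Relation.Binary.Definitions using (Tri; tri<; tri≈; tri>)
import Relation.Binary.PropositionalEquality
open import Relation.Binary.PropositionalEquality
  using (_≡_; _≢_; refl; sym; trans; cong; cong₂; subst; subst₂)

-- Rational arithmetic

-- The quantitative core is a matter of scale. If a polynomial of bounded degree stays within C on
-- [0, Y), its steps there are at most a constant times C / Y (a discrete Markov inequality,
-- `step-bound`). So if Y is the first time that the drift becomes large, the step size η satisfies
-- Y · 2η ≤ r with r independent of Y. Integer crossings are at least 1 / (2η) apart and at most Y
-- away from 0, so extrapolation from them to 0 multiplies their error 2η by a constant that depends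
-- on r alone. Slow drift up to Y₀ forces Y ≥ Y₀, and η tends to 0 as Y₀ grows. The other obstacle
-- is that the coefficients are Cauchy sequences. All estimates are made for rational polynomials,
-- the N-th approximations, and hold for large N. The floor of a limit need not be the floor of its
-- approximations, as an integer limit may be approached from below; a small upward shift repairs
-- this at finitely many points. Recurrence times must be bounded before the approximation is
-- chosen, and reals are compared only with slack.

opaque

  ⟦_⟧ : ℤ → ℚ
  ⟦ z ⟧ = z ℚ./ 1

  ⟦⟧-def : ∀ z → z ℚ./ 1 ≡ ⟦ z ⟧
  ⟦⟧-def z = refl

  ⟦1⟧ : ⟦ ℤ.1ℤ ⟧ ≡ 1ℚ
  ⟦1⟧ = refl

  ⟦0⟧ : ⟦ ℤ.0ℤ ⟧ ≡ 0ℚ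
  ⟦0⟧ = refl

  private

    toℚᵘ-⟦⟧ : ∀ z → toℚᵘ ⟦ z ⟧ ℚᵘ.≃ ℚᵘ.mkℚᵘ z 0
    toℚᵘ-⟦⟧ z = ℚ.toℚᵘ-fromℚᵘ (ℚᵘ.mkℚᵘ z 0)

ι : ℕ → ℚ
ι n = ⟦ ℤ.+ n ⟧

⟦⟧-+ : ∀ a b → ⟦ a ℤ.+ b ⟧ ≡ ⟦ a ⟧ + ⟦ b ⟧
⟦⟧-+ a b = ℚ.toℚᵘ-injective (ℚᵘ.≃-trans (toℚᵘ-⟦⟧ (a ℤ.+ b))
  (ℚᵘ.≃-sym (ℚᵘ.≃-trans (ℚ.toℚᵘ-homo-+ ⟦ a ⟧ ⟦ b ⟧)
    (ℚᵘ.≃-trans (ℚᵘ.+-cong (toℚᵘ-⟦⟧ a) (toℚᵘ-⟦⟧ b))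
      (ℚᵘ.*≡* (cong (ℤ._* ℤ.+ 1) (cong₂ ℤ._+_ (ℤ.*-identityʳ a) (ℤ.*-identityʳ b))))))))

⟦⟧-* : ∀ a b → ⟦ a ℤ.* b ⟧ ≡ ⟦ a ⟧ * ⟦ b ⟧
⟦⟧-* a b = ℚ.toℚᵘ-injective (ℚᵘ.≃-trans (toℚᵘ-⟦⟧ (a ℤ.* b))
  (ℚᵘ.≃-sym (ℚᵘ.≃-trans (ℚ.toℚᵘ-homo-* ⟦ a ⟧ ⟦ b ⟧)
    (ℚᵘ.≃-trans (ℚᵘ.*-cong (toℚᵘ-⟦⟧ a) (toℚᵘ-⟦⟧ b)) (ℚᵘ.*≡* refl)))))

⟦⟧-neg : ∀ a → ⟦ ℤ.- a ⟧ ≡ - ⟦ a ⟧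
⟦⟧-neg a = ℚ.toℚᵘ-injective (ℚᵘ.≃-trans (toℚᵘ-⟦⟧ (ℤ.- a))
  (ℚᵘ.≃-sym (ℚᵘ.≃-trans (ℚ.toℚᵘ-homo‿- ⟦ a ⟧) (ℚᵘ.-‿cong (toℚᵘ-⟦⟧ a)))))

⟦⟧-- : ∀ a b → ⟦ a ℤ.- b ⟧ ≡ ⟦ a ⟧ - ⟦ b ⟧
⟦⟧-- a b = trans (⟦⟧-+ a (ℤ.- b)) (cong (⟦ a ⟧ +_) (⟦⟧-neg b))

⟦⟧-mono-≤ : ∀ {a b} → a ℤ.≤ b → ⟦ a ⟧ ≤ℚ ⟦ b ⟧
⟦⟧-mono-≤ {a} {b} a≤b = ℚ.toℚᵘ-cancel-≤
  (ℚᵘ.≤-respˡ-≃ (ℚᵘ.≃-sym (toℚᵘ-⟦⟧ a)) (ℚᵘ.≤-respʳ-≃ (ℚᵘ.≃-sym (toℚᵘ-⟦⟧ b))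
    (ℚᵘ.*≤* (ℤ.*-monoʳ-≤-nonNeg (ℤ.+ 1) a≤b))))

⟦⟧-cancel-< : ∀ {a b} → ⟦ a ⟧ <ℚ ⟦ b ⟧ → a ℤ.< b
⟦⟧-cancel-< {a} {b} h = ℤ.≰⇒> λ b≤a → ℚ.<⇒≢ (ℚ.<-≤-trans h (⟦⟧-mono-≤ b≤a)) refl

⟦⟧-mono-< : ∀ {a b} → a ℤ.< b → ⟦ a ⟧ <ℚ ⟦ b ⟧
⟦⟧-mono-< {a} {b} a<b = ℚ.toℚᵘ-cancel-<
  (ℚᵘ.<-respˡ-≃ (ℚᵘ.≃-sym (toℚᵘ-⟦⟧ a)) (ℚᵘ.<-respʳ-≃ (ℚᵘ.≃-sym (toℚᵘ-⟦⟧ b))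
    (ℚᵘ.*<* (ℤ.*-monoʳ-<-pos (ℤ.+ 1) a<b))))

⟦⟧-cancel-≤ : ∀ {a b} → ⟦ a ⟧ ≤ℚ ⟦ b ⟧ → a ℤ.≤ b
⟦⟧-cancel-≤ {a} {b} h = ℤ.≮⇒≥ λ b<a → ℚ.<⇒≢ (ℚ.<-≤-trans (⟦⟧-mono-< b<a) h) refl

⟦⟧-injective : ∀ {a b} → ⟦ a ⟧ ≡ ⟦ b ⟧ → a ≡ b
⟦⟧-injective h = ℤ.≤-antisym (⟦⟧-cancel-≤ (ℚ.≤-reflexive h)) (⟦⟧-cancel-≤ (ℚ.≤-reflexive (sym h)))

ι-+ : ∀ a b → ι (a ℕ.+ b) ≡ ι a + ι b
ι-+ a b = ⟦⟧-+ (ℤ.+ a) (ℤ.+ b)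

ι-* : ∀ a b → ι (a ℕ.* b) ≡ ι a * ι b
ι-* a b = trans (cong ⟦_⟧ (ℤ.pos-* a b)) (⟦⟧-* (ℤ.+ a) (ℤ.+ b))

ι-suc : ∀ a → ι (suc a) ≡ 1ℚ + ι a
ι-suc a = trans (ι-+ 1 a) (cong (_+ ι a) ⟦1⟧)

ι-mono-≤ : ∀ {a b} → a ≤ b → ι a ≤ℚ ι b
ι-mono-≤ h = ⟦⟧-mono-≤ (ℤ.+≤+ h)

ι-mono-< : ∀ {a b} → a ℕ.< b → ι a <ℚ ι b
ι-mono-< h = ⟦⟧-mono-< (ℤ.+<+ h)

0≤ι : ∀ n → 0ℚ ≤ℚ ι n
0≤ι n = subst (_≤ℚ ι n) ⟦0⟧ (ι-mono-≤ {0} z≤n)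

0<ι : ∀ {n} → 1 ≤ n → 0ℚ <ℚ ι n
0<ι {n} h = subst (_<ℚ ι n) ⟦0⟧ (ι-mono-< h)

private

  l+[a-l]≡a : ∀ l a → l + (a - l) ≡ a
  l+[a-l]≡a = solve 2 (λ l a → l :+ (a :- l) := a) refl

  r+[a-l]≡b : ∀ {a b l r} → b - a ≡ r - l → r + (a - l) ≡ b
  r+[a-l]≡b {a} {b} {l} {r} eq = trans (solve 3 (λ r a l → r :+ (a :- l) := a :+ (r :- l)) refl r a l)
    (trans (cong (λ x → a + x) (sym eq)) (l+[a-l]≡a a b))

-- Reduces a linear inequality to a ring identity: the known inequalities are summed into one
-- `l ≤ r`, and the solver checks that both inequalities have the same difference.
≤-by : ∀ {a b l r} → l ≤ℚ r → b - a ≡ r - l → a ≤ℚ b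
≤-by {a} {b} {l} {r} h eq = subst₂ _≤ℚ_ (l+[a-l]≡a l a) (r+[a-l]≡b {a} {b} {l} {r} eq) (ℚ.+-monoˡ-≤ (a - l) h)

<-by : ∀ {a b l r} → l <ℚ r → b - a ≡ r - l → a <ℚ b
<-by {a} {b} {l} {r} h eq = subst₂ _<ℚ_ (l+[a-l]≡a l a) (r+[a-l]≡b {a} {b} {l} {r} eq) (ℚ.+-monoˡ-< (a - l) h)

p≤∣p∣ : ∀ p → p ≤ℚ ∣ p ∣
p≤∣p∣ p with ℚ.≤-total 0ℚ p
... | inj₁ 0≤p = ℚ.≤-reflexive (sym (ℚ.0≤p⇒∣p∣≡p 0≤p))
... | inj₂ p≤0 = ℚ.≤-trans p≤0 (ℚ.0≤∣p∣ p)

-p≤∣p∣ : ∀ p → - p ≤ℚ ∣ p ∣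
-p≤∣p∣ p = ℚ.≤-trans (p≤∣p∣ (- p)) (ℚ.≤-reflexive (ℚ.∣-p∣≡∣p∣ p))

∣∣≤ : ∀ {p c} → p ≤ℚ c → - p ≤ℚ c → ∣ p ∣ ≤ℚ c
∣∣≤ {p} h k with ℚ.∣p∣≡p∨∣p∣≡-p p
... | inj₁ e = ℚ.≤-trans (ℚ.≤-reflexive e) h
... | inj₂ e = ℚ.≤-trans (ℚ.≤-reflexive e) k

∣-∣-comm : ∀ p q → ∣ p - q ∣ ≡ ∣ q - p ∣
∣-∣-comm p q = trans (cong ∣_∣ (solve 2 (λ p q → p :- q := :- (q :- p)) refl p q)) (ℚ.∣-p∣≡∣p∣ (q - p))

∣∣-triangle : ∀ {p q r b c} → p - r ≡ (p - q) + (q - r) → ∣ p - q ∣ ≤ℚ b → ∣ q - r ∣ ≤ℚ c → ∣ p - r ∣ ≤ℚ b + c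
∣∣-triangle {p} {q} {r} e h k = ℚ.≤-trans (ℚ.≤-reflexive (cong ∣_∣ e))
  (ℚ.≤-trans (ℚ.∣p+q∣≤∣p∣+∣q∣ (p - q) (q - r)) (ℚ.+-mono-≤ h k))

∣-∣-trans : ∀ {p r b c} q → ∣ p - q ∣ ≤ℚ b → ∣ q - r ∣ ≤ℚ c → ∣ p - r ∣ ≤ℚ b + c
∣-∣-trans {p} {r} q = ∣∣-triangle {p} {q} {r} (solve 3 (λ p q r → p :- r := (p :- q) :+ (q :- r)) refl p q r)

∣+∣≤ : ∀ {p q b c} → ∣ p ∣ ≤ℚ b → ∣ q ∣ ≤ℚ c → ∣ p + q ∣ ≤ℚ b + c
∣+∣≤ {p} {q} h k = ℚ.≤-trans (ℚ.∣p+q∣≤∣p∣+∣q∣ p q) (ℚ.+-mono-≤ h k)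

∣-∣≤ : ∀ {p q b c} → ∣ p ∣ ≤ℚ b → ∣ q ∣ ≤ℚ c → ∣ p - q ∣ ≤ℚ b + c
∣-∣≤ {p} {q} h k = ℚ.≤-trans (ℚ.∣p-q∣≤∣p∣+∣q∣ p q) (ℚ.+-mono-≤ h k)

*-mono-≤ : ∀ {p q b c} → 0ℚ ≤ℚ p → 0ℚ ≤ℚ c → p ≤ℚ b → q ≤ℚ c → p * q ≤ℚ b * c
*-mono-≤ {p} {q} {b} {c} 0≤p 0≤c h k =
  ℚ.≤-trans (ℚ.*-monoˡ-≤-nonNeg p {{ℚ.nonNegative 0≤p}} k)
            (ℚ.*-monoʳ-≤-nonNeg c {{ℚ.nonNegative 0≤c}} h)

*-monoˡ : ∀ {r p q} → 0ℚ ≤ℚ r → p ≤ℚ q → r * p ≤ℚ r * q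
*-monoˡ {r} 0≤r = ℚ.*-monoˡ-≤-nonNeg r {{ℚ.nonNegative 0≤r}}

*-monoʳ : ∀ {r p q} → 0ℚ ≤ℚ r → p ≤ℚ q → p * r ≤ℚ q * r
*-monoʳ {r} 0≤r = ℚ.*-monoʳ-≤-nonNeg r {{ℚ.nonNegative 0≤r}}

∣*∣≤ : ∀ {p q b c} → ∣ p ∣ ≤ℚ b → ∣ q ∣ ≤ℚ c → ∣ p * q ∣ ≤ℚ b * c
∣*∣≤ {p} {q} {b} {c} h k = ℚ.≤-trans (ℚ.≤-reflexive (ℚ.∣p*q∣≡∣p∣*∣q∣ p q))
  (*-mono-≤ (ℚ.0≤∣p∣ p) (ℚ.≤-trans (ℚ.0≤∣p∣ q) k) h k)

0≤* : ∀ {p q} → 0ℚ ≤ℚ p → 0ℚ ≤ℚ q → 0ℚ ≤ℚ p * q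
0≤* {p} {q} h k = ℚ.≤-trans (ℚ.≤-reflexive (sym (ℚ.*-zeroʳ p))) (*-monoˡ h k)

0≤+ : ∀ {p q} → 0ℚ ≤ℚ p → 0ℚ ≤ℚ q → 0ℚ ≤ℚ p + q
0≤+ h k = ℚ.+-mono-≤ {0ℚ} h k

0<* : ∀ {p q} → 0ℚ <ℚ p → 0ℚ <ℚ q → 0ℚ <ℚ p * q
0<* {p} {q} h k = ℚ.≤-<-trans (ℚ.≤-reflexive (sym (ℚ.*-zeroʳ p))) (ℚ.*-monoʳ-<-pos p {{ℚ.positive h}} k)

reciprocal : ∀ {p} → 0ℚ <ℚ p → ∃[ r ] 0ℚ <ℚ r × p * r ≡ 1ℚ
reciprocal {p} 0<p = (1/ p) {{nz}} , ℚ.positive⁻¹ _ {{ℚ.1/pos⇒pos p {{ℚ.positive 0<p}}}} , ℚ.*-inverseʳ p {{nz}}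
  where nz = ℚ.pos⇒nonZero p {{ℚ.positive 0<p}}

⌊_⌋ : ℚ → ℤ
⌊ p ⌋ = ↥ p ℤ./ ↧ p

private

  fraction : ∀ p → p * ⟦ ↧ p ⟧ ≡ ⟦ ↥ p ⟧
  fraction p = ℚ.toℚᵘ-injective (ℚᵘ.≃-trans (ℚ.toℚᵘ-homo-* p ⟦ ↧ p ⟧)
    (ℚᵘ.≃-trans (ℚᵘ.*-congˡ {toℚᵘ p} (toℚᵘ-⟦⟧ (↧ p))) (ℚᵘ.≃-trans (lemma p) (ℚᵘ.≃-sym (toℚᵘ-⟦⟧ (↥ p))))))
    where
    lemma : ∀ p → toℚᵘ p ℚᵘ.* ℚᵘ.mkℚᵘ (↧ p) 0 ℚᵘ.≃ ℚᵘ.mkℚᵘ (↥ p) 0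
    lemma p@(mkℚ n d-1 _) = ℚᵘ.*≡* (trans (ℤ.*-identityʳ (n ℤ.* ↧ p)) (cong (n ℤ.*_) (cong (λ k → ℤ.+ suc k) (sym (ℕ.*-identityʳ d-1)))))

denominator : ∀ p → ∃[ d ] 1 ≤ d × ∃[ z ] p * ι d ≡ ⟦ z ⟧
denominator p@(mkℚ n d-1 _) = suc d-1 , s≤s z≤n , ↥ p , fraction p

⌊p⌋≤p : ∀ p → ⟦ ⌊ p ⌋ ⟧ ≤ℚ p
⌊p⌋≤p p = ℚ.*-cancelʳ-≤-pos ⟦ ↧ p ⟧ {{ℚ.positive (0<ι (s≤s z≤n))}}
  (ℚ.≤-trans (ℚ.≤-reflexive (sym (⟦⟧-* ⌊ p ⌋ (↧ p))))
    (ℚ.≤-trans (⟦⟧-mono-≤ (ℤ.[n/d]*d≤n (↥ p) (↧ p))) (ℚ.≤-reflexive (sym (fraction p)))))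

p<⌊p⌋+1 : ∀ p → p <ℚ ⟦ ⌊ p ⌋ ⟧ + 1ℚ
p<⌊p⌋+1 p = ℚ.*-cancelʳ-<-nonNeg ⟦ ↧ p ⟧ {{ℚ.nonNegative (0≤ι _)}}
  (ℚ.≤-<-trans (ℚ.≤-reflexive (fraction p)) (ℚ.<-≤-trans (⟦⟧-mono-< (lemma p)) (ℚ.≤-reflexive (trans (⟦⟧-* (⌊ p ⌋ ℤ.+ ℤ.1ℤ) (↧ p))
    (cong (_* ⟦ ↧ p ⟧) (trans (⟦⟧-+ ⌊ p ⌋ ℤ.1ℤ) (cong (⟦ ⌊ p ⌋ ⟧ +_) ⟦1⟧)))))))
  where
  lemma : ∀ p → ↥ p ℤ.< (⌊ p ⌋ ℤ.+ ℤ.1ℤ) ℤ.* ↧ p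
  lemma p@(mkℚ n d-1 _) = ℤ.≤-<-trans
    (ℤ.≤-reflexive (ℤ.a≡a%n+[a/n]*n n (↧ p)))
    (ℤ.<-≤-trans (ℤ.+-monoˡ-< (⌊ p ⌋ ℤ.* ↧ p) (ℤ.+<+ (ℤ.n%d<d n (↧ p))))
      (ℤ.≤-reflexive (trans (ℤ.+-comm (↧ p) (⌊ p ⌋ ℤ.* ↧ p)) (sym (trans (ℤ.*-distribʳ-+ (↧ p) ⌊ p ⌋ ℤ.1ℤ) (cong (λ x → ⌊ p ⌋ ℤ.* ↧ p ℤ.+ x) (ℤ.*-identityˡ (↧ p))))))))

archimedean : ∀ p → ∃[ n ] 1 ≤ n × p ≤ℚ ι n
archimedean p = suc ℤ.∣ ⌊ p ⌋ ∣ , s≤s z≤n , ℚ.≤-trans (ℚ.<⇒≤ (p<⌊p⌋+1 p))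
  (ℚ.≤-trans (ℚ.+-monoˡ-≤ 1ℚ (⟦⟧-mono-≤ {⌊ p ⌋} (i≤∣i∣ ⌊ p ⌋)))
    (ℚ.≤-reflexive (trans (ℚ.+-comm (ι ℤ.∣ ⌊ p ⌋ ∣) 1ℚ) (sym (ι-suc _)))))
  where
  i≤∣i∣ : ∀ i → i ℤ.≤ ℤ.+ ℤ.∣ i ∣
  i≤∣i∣ (ℤ.+ n) = ℤ.≤-refl
  i≤∣i∣ ℤ.-[1+ n ] = ℤ.-≤+

small : ∀ {ε} p → 0ℚ <ℚ ε → 0ℚ ≤ℚ p → ∃[ n ] 1 ≤ n × p ≤ℚ ι n * ε
small {ε} p 0<ε 0≤p =
  let r , 0<r , εr≡1 = reciprocal 0<ε
      n , 1≤n , h = archimedean (p * r)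
  in n , 1≤n , ℚ.≤-trans (ℚ.≤-reflexive (trans (sym (trans (cong (p *_) εr≡1) (ℚ.*-identityʳ p)))
                  (solve 3 (λ p ε r → p :* (ε :* r) := (p :* r) :* ε) refl p ε r)))
       (*-monoʳ (ℚ.<⇒≤ 0<ε) h)

-- Polynomials with real coefficients

-- F N is the N-th rational approximation of a polynomial with n real coefficients.
data Poly : ℕ → (ℕ → ℚ → ℚ) → Set where
  nil  : ∀ {F} → (∀ N x → F N x ≡ 0ℚ) → Poly 0 F
  cons : ∀ {n F G} (c : ℝ) → Poly n G → (∀ N x → F N x ≡ seq c N + x * G N x) → Poly (suc n) F

opaque

  Poly-ext : ∀ {n F G} → (∀ N x → G N x ≡ F N x) → Poly n F → Poly n G
  Poly-ext e (nil f)      = nil λ N x → trans (e N x) (f N x)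
  Poly-ext e (cons c H f) = cons c H λ N x → trans (e N x) (f N x)

  Poly-suc : ∀ {n F} → Poly n F → Poly (suc n) F
  Poly-suc (nil f) = cons (fromℚ 0ℚ) (nil {F = λ _ _ → 0ℚ} λ _ _ → refl)
    λ N x → trans (f N x) (sym (trans (ℚ.+-identityˡ (x * 0ℚ)) (ℚ.*-zeroʳ x)))
  Poly-suc (cons c H f) = cons c (Poly-suc H) f

  Poly-+ : ∀ {n F G} → Poly n F → Poly n G → Poly n (λ N x → F N x + G N x)
  Poly-+ (nil f) (nil g) = nil λ N x → cong₂ _+_ (f N x) (g N x)
  Poly-+ (cons {G = F} c pF f) (cons {G = G} d pG g) = cons (c +ᴿ d) (Poly-+ pF pG)
    λ N x → trans (cong₂ _+_ (f N x) (g N x))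
      (solve 5 (λ c d F G x → (c :+ x :* F) :+ (d :+ x :* G) := (c :+ d) :+ x :* (F :+ G)) refl
        (seq c N) (seq d N) (F N x) (G N x) x)

  Poly-scale : ∀ {n F} b → Poly n F → Poly n (λ N x → b * F N x)
  Poly-scale b (nil f) = nil λ N x → trans (cong (b *_) (f N x)) (ℚ.*-zeroʳ b)
  Poly-scale b (cons {G = F} c pF f) = cons (fromℚ b *ᴿ c) (Poly-scale b pF)
    λ N x → trans (cong (b *_) (f N x))
      (solve 4 (λ b c F x → b :* (c :+ x :* F) := b :* c :+ x :* (b :* F)) refl b (seq c N) (F N x) x)

  Poly-- : ∀ {n F G} → Poly n F → Poly n G → Poly n (λ N x → F N x - G N x)
  Poly-- {n} {F} {G} f g = Poly-ext
    (λ N x → cong (F N x +_) (trans (cong -_ (sym (ℚ.*-identityˡ (G N x)))) (ℚ.neg-distribˡ-* 1ℚ (G N x))))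
    (Poly-+ f (Poly-scale (- 1ℚ) g))

  Poly-const : ∀ {n} c → Poly (suc n) (λ N _ → seq c N)
  Poly-const {zero} c = cons c (nil {F = λ _ _ → 0ℚ} λ _ _ → refl)
    λ N x → sym (trans (cong (seq c N +_) (ℚ.*-zeroʳ x)) (ℚ.+-identityʳ (seq c N)))
  Poly-const {suc n} c = Poly-suc (Poly-const c)

  Poly-x* : ∀ {n F} → Poly n F → Poly (suc n) (λ N x → x * F N x)
  Poly-x* {n} {F} f = cons (fromℚ 0ℚ) f λ N x → sym (ℚ.+-identityˡ (x * F N x))

  Poly-affine : ∀ {n F} a b → Poly n F → Poly n (λ N x → F N (a + b * x))
  Poly-affine a b (nil f) = nil λ N x → f N (a + b * x)
  Poly-affine a b (cons {n} {F} {G} c pG f) = Poly-ext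
    (λ N x → trans (f N (a + b * x))
      (solve 5 (λ a b c x G → c :+ (a :+ b :* x) :* G := (c :+ a :* G) :+ x :* (b :* G)) refl
        a b (seq c N) x (G N (a + b * x))))
    (Poly-+
      (Poly-+ (Poly-const c) (Poly-suc (Poly-scale a pG′)))
      (Poly-x* (Poly-scale b pG′)))
    where
    pG′ : Poly n (λ N x → G N (a + b * x))
    pG′ = Poly-affine a b pG

  Poly-shift : ∀ {n F} a → Poly n F → Poly n (λ N x → F N (x + a))
  Poly-shift {F = F} a f = Poly-ext
    (λ N x → cong (F N) (trans (ℚ.+-comm x a) (cong (a +_) (sym (ℚ.*-identityˡ x)))))
    (Poly-affine a 1ℚ f)

  -- The leading terms cancel: with F = c + x G the difference is x (G (x + a) - G x) + a G (x + a),
  -- whose first summand has by induction no more coefficients than G.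
  Poly-difference : ∀ {n F} a → Poly (suc n) F → Poly n (λ N x → F N (x + a) - F N x)
  Poly-difference {F = F} a (cons c (nil {G} g) f) = nil λ N x →
    trans (cong₂ _-_ (constant N (x + a)) (constant N x)) (ℚ.+-inverseʳ (seq c N))
    where
    constant : ∀ N x → F N x ≡ seq c N
    constant N x = trans (f N x) (trans (cong (λ s → seq c N + x * s) (g N x))
      (trans (cong (seq c N +_) (ℚ.*-zeroʳ x)) (ℚ.+-identityʳ (seq c N))))
  Poly-difference a (cons c pG@(cons {F = G} _ _ _) f) = Poly-ext
    (λ N x → trans (cong₂ _-_ (f N (x + a)) (f N x))
      (solve 5 (λ a c x F G → (c :+ (x :+ a) :* F) :- (c :+ x :* G) := x :* (F :- G) :+ a :* F) refl
        a (seq c N) x (G N (x + a)) (G N x)))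
    (Poly-+
      (Poly-x* (Poly-difference a pG))
      (Poly-scale a (Poly-shift a pG)))

  -- Taylor expansion about `a` in place of long division: its constant coefficient is F a, and what
  -- remains, shifted back, is the quotient.
  Poly-divide : ∀ {n F} → Poly (suc n) F → ∀ a →
    ∃[ G ] Poly n G × (∀ N x → F N x ≡ F N a + (x - a) * G N x)
  Poly-divide {n} {F} f a with Poly-shift a f
  ... | cons {G = G} c pG g = (λ N x → G N (x + - a)) , Poly-shift (- a) pG , λ N x →
    trans (cong (F N) (solve 2 (λ x a → x := x :- a :+ a) refl x a))
      (trans (g N (x - a)) (cong (λ s → s + (x - a) * G N (x - a)) (sym (value N))))
    where
    value : ∀ N → F N a ≡ seq c N
    value N = trans (cong (F N) (sym (ℚ.+-identityˡ a)))
      (trans (g N 0ℚ) (trans (cong (seq c N +_) (ℚ.*-zeroˡ (G N 0ℚ))) (ℚ.+-identityʳ (seq c N))))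

  Poly-fix : ∀ {n F} M → Poly n F → Poly n (λ _ → F M)
  Poly-fix M (nil f)      = nil λ N x → f M x
  Poly-fix M (cons c H f) = cons (fromℚ (seq c M)) (Poly-fix M H) λ N x → f M x

-- Interpolation

ι-dist-≥ : ∀ {a b k} → a ℕ.+ k ≤ b → ι k ≤ℚ ∣ ι b - ι a ∣
ι-dist-≥ {a} {b} {k} h = ℚ.≤-trans
  (≤-by (ι-mono-≤ h) (trans (solve 3 (λ a b k → b :- a :- k := b :- (a :+ k)) refl (ι a) (ι b) (ι k))
    (cong (λ s → ι b - s) (sym (ι-+ a k)))))
  (p≤∣p∣ (ι b - ι a))

ι-dist-≥′ : ∀ {a b k} → a ℕ.+ k ≤ b → ι k ≤ℚ ∣ ι a - ι b ∣
ι-dist-≥′ {a} {b} h = ℚ.≤-trans (ι-dist-≥ h) (ℚ.≤-reflexive (∣-∣-comm (ι b) (ι a)))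

private

  p-q≤p : ∀ p {q} → 0ℚ ≤ℚ q → p - q ≤ℚ p
  p-q≤p p {q} 0≤q = ≤-by 0≤q (solve 2 (λ p q → p :- (p :- q) := q :- con 0ℚ) refl p q)

ι-dist-≤ : ∀ {a b k} → a ≤ k → b ≤ k → ∣ ι a - ι b ∣ ≤ℚ ι k
ι-dist-≤ {a} {b} h k = ∣∣≤ (ℚ.≤-trans (p-q≤p (ι a) (0≤ι b)) (ι-mono-≤ h))
  (ℚ.≤-trans (ℚ.≤-reflexive (solve 2 (λ a b → :- (a :- b) := b :- a) refl (ι a) (ι b)))
    (ℚ.≤-trans (p-q≤p (ι b) (0≤ι a)) (ι-mono-≤ k)))

-- Newton's divided differences: taking off one node turns the error ε at the other nodes into 2 λ₁
-- ε for the quotient, which is then multiplied by a distance H. Since H λ₁ ≤ r, each node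
-- contributes a factor 2 r, and the constant does not see the scale.
interpolationConstant : ℕ → ℚ → ℚ
interpolationConstant zero    r = 0ℚ
interpolationConstant (suc n) r = 1ℚ + (r + r) * interpolationConstant n r

interpolationConstant-≥0 : ∀ n {r} → 0ℚ ≤ℚ r → 0ℚ ≤ℚ interpolationConstant n r
interpolationConstant-≥0 zero    0≤r = ℚ.≤-refl
interpolationConstant-≥0 (suc n) 0≤r =
  0≤+ (ℚ.<⇒≤ (ℚ.positive⁻¹ 1ℚ)) (0≤* (0≤+ 0≤r 0≤r) (interpolationConstant-≥0 n 0≤r))

private

  quotient-bound : ∀ {u v w a x λ₁ δ} → u ≡ v + (x - a) * w → 0ℚ ≤ℚ λ₁ → 1ℚ ≤ℚ λ₁ * ∣ x - a ∣ →
                   ∣ u - v ∣ ≤ℚ δ → ∣ w ∣ ≤ℚ λ₁ * δ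
  quotient-bound {u} {v} {w} {a} {x} {λ₁} {δ} e 0≤λ sep h = begin
    ∣ w ∣                          ≡⟨ ℚ.*-identityˡ ∣ w ∣ ⟨
    1ℚ * ∣ w ∣                     ≤⟨ *-monoʳ (ℚ.0≤∣p∣ w) sep ⟩
    (λ₁ * ∣ x - a ∣) * ∣ w ∣       ≡⟨ ℚ.*-assoc λ₁ ∣ x - a ∣ ∣ w ∣ ⟩
    λ₁ * (∣ x - a ∣ * ∣ w ∣)       ≡⟨ cong (λ₁ *_) (ℚ.∣p*q∣≡∣p∣*∣q∣ (x - a) w) ⟨
    λ₁ * ∣ (x - a) * w ∣           ≡⟨ cong (λ s → λ₁ * ∣ s ∣) (trans (solve 2 (λ v t → t := (v :+ t) :- v) refl v ((x - a) * w)) (cong (_- v) (sym e))) ⟩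
    λ₁ * ∣ u - v ∣                 ≤⟨ *-monoˡ 0≤λ h ⟩
    λ₁ * δ                         ∎
    where open ℚ.≤-Reasoning

-- Induction on the quotient of F - F (a 0) by x - a 0, which has one coefficient and one node
-- fewer. `λ₁` plays the part of the inverse of the least distance between nodes.
interpolation : ∀ {n F} → Poly n F → ∀ N (a : ℕ → ℚ) {λ₁ H r ε x} →
  0ℚ ≤ℚ λ₁ → 0ℚ ≤ℚ r → 0ℚ ≤ℚ ε → H * λ₁ ≤ℚ r →
  (∀ i j → i ℕ.< j → j ℕ.< n → 1ℚ ≤ℚ λ₁ * ∣ a j - a i ∣) →
  (∀ i → i ℕ.< n → ∣ x - a i ∣ ≤ℚ H) →
  (∀ i → i ℕ.< n → ∣ F N (a i) ∣ ≤ℚ ε) →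
  ∣ F N x ∣ ≤ℚ interpolationConstant n r * ε
interpolation (nil f) N a {ε = ε} {x} _ _ _ _ _ _ _ =
  ℚ.≤-reflexive (trans (cong ∣_∣ (f N x)) (sym (ℚ.*-zeroˡ ε)))
interpolation {suc n} {F} f@(cons _ _ _) N a {λ₁} {H} {r} {ε} {x} 0≤λ 0≤r 0≤ε Hλ≤r sep near small
  with Poly-divide f (a 0)
... | G , pG , divides = begin
    ∣ F N x ∣                                            ≡⟨ cong ∣_∣ (divides N x) ⟩
    ∣ F N (a 0) + (x - a 0) * G N x ∣                    ≤⟨ ∣+∣≤ {F N (a 0)} {(x - a 0) * G N x} (small 0 (s≤s z≤n)) (∣*∣≤ {x - a 0} {G N x} (near 0 (s≤s z≤n)) IH) ⟩
    ε + H * (K * (λ₁ * (ε + ε)))                         ≡⟨ solve 4 (λ ε H K l → ε :+ H :* (K :* (l :* (ε :+ ε))) := ε :+ (H :* l) :* (K :* (ε :+ ε))) refl ε H K λ₁ ⟩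
    ε + (H * λ₁) * (K * (ε + ε))                         ≤⟨ ℚ.+-monoʳ-≤ ε (*-monoʳ (0≤* (interpolationConstant-≥0 n 0≤r) (0≤+ 0≤ε 0≤ε)) Hλ≤r) ⟩
    ε + r * (K * (ε + ε))                                ≡⟨ solve 3 (λ ε r K → ε :+ r :* (K :* (ε :+ ε)) := (con 1ℚ :+ (r :+ r) :* K) :* ε) refl ε r K ⟩
    (1ℚ + (r + r) * K) * ε                               ∎
  where
  open ℚ.≤-Reasoning
  K = interpolationConstant n r
  IH : ∣ G N x ∣ ≤ℚ K * (λ₁ * (ε + ε))
  IH = interpolation pG N (λ i → a (suc i)) {λ₁} {H} {r} {λ₁ * (ε + ε)} {x} 0≤λ 0≤r (0≤* 0≤λ (0≤+ 0≤ε 0≤ε)) Hλ≤r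
    (λ i j i<j j<n → sep (suc i) (suc j) (s≤s i<j) (s≤s j<n))
    (λ i i<n → near (suc i) (s≤s i<n))
    (λ i i<n → quotient-bound {F N (a (suc i))} {F N (a 0)} {G N (a (suc i))} {a 0} {a (suc i)} (divides N (a (suc i))) 0≤λ (sep 0 (suc i) (s≤s z≤n) (s≤s i<n))
       (∣-∣≤ {F N (a (suc i))} {F N (a 0)} (small (suc i) (s≤s i<n)) (small 0 (s≤s z≤n))))

-- The nodes are taken on the side of y on which there is more room.
step-bound : ∀ {n F} → Poly (suc n) F → ∀ N E Y {λ₁ r C} →
  0ℚ ≤ℚ λ₁ → 0ℚ ≤ℚ r → 0ℚ ≤ℚ C → ι E * λ₁ ≡ 1ℚ → ι Y * λ₁ ≤ℚ r → 2 ℕ.* n ℕ.* E ℕ.< Y →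
  (∀ y → y ℕ.< Y → ∣ F N (ι y) ∣ ≤ℚ C) →
  ∀ y → y ℕ.< Y → ∣ F N (ι (suc y)) - F N (ι y) ∣ ≤ℚ interpolationConstant n r * (λ₁ * (C + C))
step-bound {n} {F} f N E Y {λ₁} {r} {C} 0≤λ 0≤r 0≤C Eλ≡1 Yλ≤r 2nE<Y bound y y<Y
  with Poly-divide f (ι y)
... | G , pG , divides = ℚ.≤-trans (ℚ.≤-reflexive (cong ∣_∣ quotient)) main
  where
  quotient : F N (ι (suc y)) - F N (ι y) ≡ G N (ι (suc y))
  quotient = trans (cong (_- F N (ι y)) (divides N (ι (suc y))))
    (trans (cong (λ s → F N (ι y) + (s - ι y) * G N (ι (suc y)) - F N (ι y)) (ι-suc y))
      (solve 3 (λ f y g → f :+ (con 1ℚ :+ y :- y) :* g :- f := g) refl (F N (ι y)) (ι y) (G N (ι (suc y)))))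
  far : ∀ {x} → ι E ≤ℚ x → 1ℚ ≤ℚ λ₁ * x
  far h = ℚ.≤-trans (ℚ.≤-reflexive (trans (sym Eλ≡1) (ℚ.*-comm (ι E) λ₁))) (*-monoˡ 0≤λ h)
  from-nodes : (c : ℕ → ℕ) → (∀ i j → i ℕ.< j → c i ℕ.+ E ≤ c j) →
    (∀ i → i ℕ.< n → c i ℕ.< Y × ι E ≤ℚ ∣ ι (c i) - ι y ∣) →
    ∣ G N (ι (suc y)) ∣ ≤ℚ interpolationConstant n r * (λ₁ * (C + C))
  from-nodes c gap ok = interpolation pG N (λ i → ι (c i)) {λ₁} {ι Y} {r} {λ₁ * (C + C)} {ι (suc y)} 0≤λ 0≤r (0≤* 0≤λ (0≤+ 0≤C 0≤C)) Yλ≤r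
    (λ i j i<j _ → far (ι-dist-≥ (gap i j i<j)))
    (λ i i<n → ι-dist-≤ y<Y (ℕ.<⇒≤ (proj₁ (ok i i<n))))
    (λ i i<n → quotient-bound {F N (ι (c i))} {F N (ι y)} {G N (ι (c i))} {ι y} {ι (c i)} (divides N (ι (c i))) 0≤λ (far (proj₂ (ok i i<n)))
      (∣-∣≤ {F N (ι (c i))} {F N (ι y)} (bound (c i) (proj₁ (ok i i<n))) (bound y y<Y)))
  gap : ∀ s i j → i ℕ.< j → (s ℕ.+ i) ℕ.* E ℕ.+ E ≤ (s ℕ.+ j) ℕ.* E
  gap s i j i<j = ℕ.≤-trans (ℕ.≤-reflexive (ℕ.+-comm ((s ℕ.+ i) ℕ.* E) E))
    (ℕ.*-monoˡ-≤ E {suc (s ℕ.+ i)} (ℕ.≤-trans (ℕ.≤-reflexive (sym (ℕ.+-suc s i))) (ℕ.+-monoʳ-≤ s i<j)))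
  main : ∣ G N (ι (suc y)) ∣ ≤ℚ interpolationConstant n r * (λ₁ * (C + C))
  main with n ℕ.* E ℕ.≤? y
  ... | yes nE≤y = from-nodes (λ i → (0 ℕ.+ i) ℕ.* E) (gap 0) λ i i<n →
          ℕ.≤-<-trans (ℕ.≤-trans (ℕ.*-monoˡ-≤ E (ℕ.<⇒≤ i<n)) nE≤y) y<Y ,
          ι-dist-≥′ (ℕ.≤-trans (gap 0 i n i<n) nE≤y)
  -- Here y < n E, so the first node (n + 1) E keeps the distance E from y, and the last one, 2 n E,
  -- is still below Y.
  ... | no nE≰y = from-nodes (λ i → (suc n ℕ.+ i) ℕ.* E) (gap (suc n)) λ i i<n →
          ℕ.≤-<-trans (ℕ.*-monoˡ-≤ E (ℕ.≤-trans (ℕ.+-monoʳ-< n i<n) (ℕ.≤-reflexive (cong (n ℕ.+_) (sym (ℕ.+-identityʳ n)))))) 2nE<Y ,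
          ι-dist-≥ (ℕ.≤-trans (ℕ.+-monoˡ-≤ E (ℕ.<⇒≤ (ℕ.≰⇒> nE≰y)))
            (ℕ.≤-trans (ℕ.≤-reflexive (ℕ.+-comm (n ℕ.* E) E)) (ℕ.*-monoˡ-≤ E {suc n} (s≤s (ℕ.m≤m+n n i)))))

-- Polynomial recurrence modulo 1

%ℕ-≡ : ∀ {a b} m .{{_ : NonZero m}} → a ℤ.%ℕ m ≡ b ℤ.%ℕ m → ∃[ z ] a ≡ b ℤ.+ z ℤ.* ℤ.+ m
%ℕ-≡ {a} {b} m e = (a ℤ./ℕ m) ℤ.- (b ℤ./ℕ m) , (begin
  a                                                              ≡⟨ ℤ.a≡a%ℕn+[a/ℕn]*n a m ⟩
  ℤ.+ (a ℤ.%ℕ m) ℤ.+ (a ℤ./ℕ m) ℤ.* ℤ.+ m                        ≡⟨ cong (λ r → ℤ.+ r ℤ.+ (a ℤ./ℕ m) ℤ.* ℤ.+ m) e ⟩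
  ℤ.+ (b ℤ.%ℕ m) ℤ.+ (a ℤ./ℕ m) ℤ.* ℤ.+ m                        ≡⟨ lemma (ℤ.+ (b ℤ.%ℕ m)) (a ℤ./ℕ m) (b ℤ./ℕ m) (ℤ.+ m) ⟩
  (ℤ.+ (b ℤ.%ℕ m) ℤ.+ (b ℤ./ℕ m) ℤ.* ℤ.+ m) ℤ.+ ((a ℤ./ℕ m) ℤ.- (b ℤ./ℕ m)) ℤ.* ℤ.+ m
    ≡⟨ cong (ℤ._+ ((a ℤ./ℕ m) ℤ.- (b ℤ./ℕ m)) ℤ.* ℤ.+ m) (ℤ.a≡a%ℕn+[a/ℕn]*n b m) ⟨
  b ℤ.+ ((a ℤ./ℕ m) ℤ.- (b ℤ./ℕ m)) ℤ.* ℤ.+ m                    ∎)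
  where
  open Relation.Binary.PropositionalEquality.≡-Reasoning
  lemma : ∀ r p q m → r ℤ.+ p ℤ.* m ≡ (r ℤ.+ q ℤ.* m) ℤ.+ (p ℤ.- q) ℤ.* m
  lemma = ℤsolve 4 (λ r p q m → r ⊕ p ⊗ m ⊜ (r ⊕ q ⊗ m) ⊕ (p ⊝ q) ⊗ m) refl

record NearInteger (r δ : ℚ) : Set where
  constructor near
  field
    integer  : ℤ
    distance : ∣ r - ⟦ integer ⟧ ∣ ≤ℚ δ

open NearInteger public

near-0 : ∀ {r δ} → 0ℚ ≤ℚ δ → r ≡ 0ℚ → NearInteger r δ
near-0 {r} {δ} 0≤δ e = near ℤ.0ℤ (subst (_≤ℚ δ) (sym (trans (cong₂ (λ x y → ∣ x - y ∣) e ⟦0⟧) refl)) 0≤δ)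

near-≤ : ∀ {r δ ε} → δ ≤ℚ ε → NearInteger r δ → NearInteger r ε
near-≤ δ≤ε (near z h) = near z (ℚ.≤-trans h δ≤ε)

near-≡ : ∀ {r s δ} → r ≡ s → NearInteger r δ → NearInteger s δ
near-≡ refl h = h

near-+ : ∀ {r s δ ε} → NearInteger r δ → NearInteger s ε → NearInteger (r + s) (δ + ε)
near-+ {r} {s} {δ} {ε} (near z h) (near w k) = near (z ℤ.+ w) (subst (λ x → ∣ x ∣ ≤ℚ δ + ε)
  (trans (solve 4 (λ r s z w → (r :- z) :+ (s :- w) := r :+ s :- (z :+ w)) refl r s ⟦ z ⟧ ⟦ w ⟧)
    (cong (λ x → r + s - x) (sym (⟦⟧-+ z w))))
  (∣+∣≤ {r - ⟦ z ⟧} {s - ⟦ w ⟧} h k))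

-- The arc that contains r when the circle ℝ / ℤ is cut into M equal arcs.
box : ∀ M .{{_ : NonZero M}} → ℚ → Fin M
box M r = fromℕ< (ℤ.n%ℕd<d ⌊ ι M * r ⌋ M)

box-≡⇒near : ∀ M .{{_ : NonZero M}} {h r s} → 1ℚ ≤ℚ ι M * h → box M r ≡ box M s → NearInteger (r - s) h
box-≡⇒near M {h} {r} {s} 1≤Mh e with %ℕ-≡ {⌊ ι M * r ⌋} {⌊ ι M * s ⌋} M
     (trans (sym (Fin.toℕ-fromℕ< (ℤ.n%ℕd<d ⌊ ι M * r ⌋ M))) (trans (cong toℕ e) (Fin.toℕ-fromℕ< (ℤ.n%ℕd<d ⌊ ι M * s ⌋ M))))
... | z , a≡b+zM = near z (ℚ.*-cancelˡ-≤-pos (ι M) {{ℚ.positive (0<ι (ℕ.>-nonZero⁻¹ M))}}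
  (ℚ.≤-trans (ℚ.≤-reflexive scaled) (ℚ.≤-trans (∣∣≤ upper lower) 1≤Mh)))
  where
  a = ⌊ ι M * r ⌋
  b = ⌊ ι M * s ⌋
  ⟦a⟧ : ⟦ a ⟧ ≡ ⟦ b ⟧ + ⟦ z ⟧ * ι M
  ⟦a⟧ = trans (cong ⟦_⟧ a≡b+zM) (trans (⟦⟧-+ b (z ℤ.* ℤ.+ M)) (cong (⟦ b ⟧ +_) (⟦⟧-* z (ℤ.+ M))))
  scaled : ι M * ∣ r - s - ⟦ z ⟧ ∣ ≡ ∣ ι M * (r - s - ⟦ z ⟧) ∣
  scaled = trans (cong (_* ∣ r - s - ⟦ z ⟧ ∣) (sym (ℚ.0≤p⇒∣p∣≡p (0≤ι M)))) (sym (ℚ.∣p*q∣≡∣p∣*∣q∣ (ι M) (r - s - ⟦ z ⟧)))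
  upper : ι M * (r - s - ⟦ z ⟧) ≤ℚ 1ℚ
  upper = ≤-by (ℚ.+-mono-≤ (ℚ.<⇒≤ (p<⌊p⌋+1 (ι M * r))) (⌊p⌋≤p (ι M * s)))
    (trans (solve 5 (λ M r s z b → con 1ℚ :- M :* (r :- s :- z) := ((b :+ z :* M) :+ con 1ℚ :+ M :* s) :- (M :* r :+ b)) refl (ι M) r s ⟦ z ⟧ ⟦ b ⟧)
      (cong (λ x → (x + 1ℚ + ι M * s) - (ι M * r + ⟦ b ⟧)) (sym ⟦a⟧)))
  lower : - (ι M * (r - s - ⟦ z ⟧)) ≤ℚ 1ℚ
  lower = ≤-by (ℚ.+-mono-≤ (ℚ.<⇒≤ (p<⌊p⌋+1 (ι M * s))) (⌊p⌋≤p (ι M * r)))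
    (trans (solve 5 (λ M r s z b → con 1ℚ :- (:- (M :* (r :- s :- z))) := (b :+ con 1ℚ :+ M :* r) :- (M :* s :+ (b :+ z :* M))) refl (ι M) r s ⟦ z ⟧ ⟦ b ⟧)
      (cong (λ x → (⟦ b ⟧ + 1ℚ + ι M * r) - (ι M * s + x)) (sym ⟦a⟧)))

-- The bound `B` comes before the polynomials. The induction needs this because later polynomials
-- depend on earlier choices, and `simultaneous` because the approximation is chosen only once `B`
-- is known.
Recurrent : ℕ → Set
Recurrent n = ∀ s {δ} → 0ℚ <ℚ δ → ∃[ B ] ∀ (f : Fin s → ℚ → ℚ) →
  (∀ i → Poly (suc n) (λ _ → f i)) → (∀ i → f i 0ℚ ≡ 0ℚ) →
  ∃[ x ] 1 ≤ x × x ≤ B × ∀ i → NearInteger (f i (ι x)) δ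

constant-Poly : ∀ {F} → Poly 1 F → ∀ N x → F N x ≡ F N 0ℚ
constant-Poly {F} (cons {G = G} c (nil g) f) N x = trans (value x) (sym (value 0ℚ))
  where
  value : ∀ x → F N x ≡ seq c N
  value x = trans (f N x) (trans (cong (λ s → seq c N + x * s) (g N x))
    (trans (cong (seq c N +_) (ℚ.*-zeroʳ x)) (ℚ.+-identityʳ (seq c N))))

recurrent-zero : Recurrent 0
recurrent-zero s 0<δ = 1 , λ f pf f0 → 1 , s≤s z≤n , ℕ.≤-refl , λ i →
  near-0 (ℚ.<⇒≤ 0<δ) (trans (constant-Poly (pf i) 0 (ι 1)) (f0 i))

-- The defect of additivity of f. As a function of x it has one coefficient fewer than f, and it
-- vanishes at 0 together with f, so recurrence in smaller degree applies to it.
cross : (ℚ → ℚ) → ℚ → ℚ → ℚ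
cross f a x = (f (x + a) - f x) - f a

cross-Poly : ∀ {n f} a → Poly (suc (suc n)) (λ _ → f) → Poly (suc n) (λ _ → cross f a)
cross-Poly {n} {f} a p = Poly-- (Poly-difference a p) (Poly-const (fromℚ (f a)))

cross-0 : ∀ {f} a → f 0ℚ ≡ 0ℚ → cross f a 0ℚ ≡ 0ℚ
cross-0 {f} a f0 = trans (cong₂ (λ s t → (f s - t) - f a) (ℚ.+-identityˡ a) f0)
  (solve 1 (λ x → (x :- con 0ℚ) :- x := con 0ℚ) refl (f a))

-- x₀ , x₁ , … are picked one after the other so that every f is nearly additive along
-- them; D j i = xᵢ + … + xⱼ₋₁ for i ≤ j.  Two partial sums of f (x₀) + f (x₁) + …
-- that agree modulo 1 up to a small error then bound D j i.
module Chain {s P : ℕ} {δ′ : ℚ} (0<δ′ : 0ℚ <ℚ δ′) (B′ : ℕ) (f : Fin s → ℚ → ℚ) (f0 : ∀ i → f i 0ℚ ≡ 0ℚ)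
  (choose : ∀ (D : ℕ → ℕ) → ∃[ x ] 1 ≤ x × x ≤ B′ × ∀ i k → k ℕ.< P → NearInteger (cross (f i) (ι (D k)) (ι x)) δ′) where

  next : (ℕ → ℕ) → ℕ
  next D = proj₁ (choose D)

  extend : (ℕ → ℕ) → ℕ → ∀ j i → Dec (i ≤ j) → ℕ
  extend D x j i (yes _) = D i ℕ.+ x
  extend D x j i (no _)  = 0

  D : ℕ → ℕ → ℕ
  D zero    i = 0
  D (suc j) i = extend (D j) (next (D j)) j i (i ℕ.≤? j)

  extend-yes : ∀ {D x j i} → i ≤ j → (d : Dec (i ≤ j)) → extend D x j i d ≡ D i ℕ.+ x
  extend-yes h (yes _) = refl
  extend-yes h (no ¬h) = ⊥-elim (¬h h)

  extend-no : ∀ {D x j i} → ¬ (i ≤ j) → (d : Dec (i ≤ j)) → extend D x j i d ≡ 0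
  extend-no ¬h (yes h) = ⊥-elim (¬h h)
  extend-no ¬h (no _)  = refl

  D-same : ∀ j → D j j ≡ 0
  D-same zero    = refl
  D-same (suc j) = extend-no ℕ.1+n≰n (suc j ℕ.≤? j)

  D-step : ∀ j i → i ≤ j → D (suc j) i ≡ D j i ℕ.+ next (D j)
  D-step j i i≤j = extend-yes i≤j (i ℕ.≤? j)

  D-bound : ∀ j i → i ≤ j → D j i ≤ j ℕ.* B′
  D-bound zero i i≤j = z≤n
  D-bound (suc j) i i≤1+j with ℕ.m≤n⇒m<n∨m≡n i≤1+j
  ... | inj₂ refl = ℕ.≤-trans (ℕ.≤-reflexive (D-same (suc j))) z≤n
  ... | inj₁ (s≤s i≤j) = ℕ.≤-trans (ℕ.≤-reflexive (trans (D-step j i i≤j) (ℕ.+-comm (D j i) (next (D j)))))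
          (ℕ.+-mono-≤ (proj₁ (proj₂ (proj₂ (choose (D j))))) (D-bound j i i≤j))

  D-positive : ∀ j i → i ℕ.< j → 1 ≤ D j i
  D-positive (suc j) i (s≤s i≤j) = ℕ.≤-trans (proj₁ (proj₂ (choose (D j))))
    (ℕ.≤-trans (ℕ.m≤n+m (next (D j)) (D j i)) (ℕ.≤-reflexive (sym (D-step j i i≤j))))

  partial : Fin s → ℕ → ℚ
  partial k zero    = 0ℚ
  partial k (suc j) = partial k j + f k (ι (next (D j)))

  -- D (j + 1) i is D j i + x, so f gains f x up to the defect `cross`, which x was chosen to make
  -- nearly an integer; each link costs δ′.
  additive : ∀ k j i → i ≤ j → j ≤ P → NearInteger (f k (ι (D j i)) - (partial k j - partial k i)) (ι j * δ′)
  additive-same : ∀ k j → NearInteger (f k (ι (D j j)) - (partial k j - partial k j)) (ι j * δ′)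
  additive-same k j = near-0 (0≤* (0≤ι j) (ℚ.<⇒≤ 0<δ′))
    (trans (cong₂ _-_ (trans (cong (λ t → f k (ι t)) (D-same j)) (trans (cong (f k) ⟦0⟧) (f0 k))) (ℚ.+-inverseʳ (partial k j))) refl)
  additive k zero zero _ _ = additive-same k 0
  additive k (suc j) i i≤1+j 1+j≤P with ℕ.m≤n⇒m<n∨m≡n i≤1+j
  ... | inj₂ refl = additive-same k (suc j)
  ... | inj₁ (s≤s i≤j) = near-≤ (ℚ.≤-reflexive bound) (near-≡ value
          (near-+ (proj₂ (proj₂ (proj₂ (choose (D j)))) k i (ℕ.≤-<-trans i≤j 1+j≤P)) (additive k j i i≤j (ℕ.<⇒≤ 1+j≤P))))
    where
    x = next (D j)
    bound : δ′ + ι j * δ′ ≡ ι (suc j) * δ′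
    bound = trans (solve 2 (λ d j → d :+ j :* d := (con 1ℚ :+ j) :* d) refl δ′ (ι j)) (cong (_* δ′) (sym (ι-suc j)))
    value : cross (f k) (ι (D j i)) (ι x) + (f k (ι (D j i)) - (partial k j - partial k i))
            ≡ f k (ι (D (suc j) i)) - (partial k (suc j) - partial k i)
    value = trans
      (solve 5 (λ s fx fd pj pi → (s :- fx :- fd) :+ (fd :- (pj :- pi)) := s :- ((pj :+ fx) :- pi)) refl
        (f k (ι x + ι (D j i))) (f k (ι x)) (f k (ι (D j i))) (partial k j) (partial k i))
      (cong (λ t → f k t - ((partial k j + f k (ι x)) - partial k i))
        (trans (sym (ι-+ x (D j i))) (cong ι (trans (ℕ.+-comm x (D j i)) (sym (D-step j i i≤j))))))

  -- The P + 1 vectors of partial sums fall into M ^ s = P boxes, so two of them agree modulo 1 up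
  -- to h. Passing from their difference to f at D j i costs at most P δ′ = h more.
  found : ∀ M .{{_ : NonZero M}} {h} → P ≡ M ℕ.^ s → 1ℚ ≤ℚ ι M * h → ι P * δ′ ≡ h →
    ∃[ x ] 1 ≤ x × x ≤ P ℕ.* B′ × ∀ i → NearInteger (f i (ι x)) (h + h)
  found M {h} P≡M^s 1≤Mh Pδ′≡h = D (toℕ j) (toℕ i) , D-positive (toℕ j) (toℕ i) i<j ,
      ℕ.≤-trans (D-bound (toℕ j) (toℕ i) (ℕ.<⇒≤ i<j)) (ℕ.*-monoˡ-≤ B′ j≤P) ,
      λ k → near-≤ bound (near-≡ (solve 2 (λ a b → (a :- b) :+ b := a) refl (f k (ι (D (toℕ j) (toℕ i)))) (partial k (toℕ j) - partial k (toℕ i)))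
        (near-+ (additive k (toℕ j) (toℕ i) (ℕ.<⇒≤ i<j) j≤P) (box-≡⇒near M {h} {partial k (toℕ j)} {partial k (toℕ i)} 1≤Mh (same-box k))))
    where
    boxes : Fin (suc P) → Fin (M ℕ.^ s)
    boxes c = Fin.funToFin (λ k → box M (partial k (toℕ c)))
    collision = Fin.pigeonhole (subst (ℕ._< suc P) P≡M^s (ℕ.n<1+n P)) boxes
    i = proj₁ collision
    j = proj₁ (proj₂ collision)
    i<j : toℕ i ℕ.< toℕ j
    i<j = proj₁ (proj₂ (proj₂ collision))
    j≤P : toℕ j ≤ P
    j≤P = ℕ.≤-pred (Fin.toℕ<n j)
    bound : ι (toℕ j) * δ′ + h ≤ℚ h + h
    bound = ℚ.+-monoˡ-≤ h (ℚ.≤-trans (*-monoʳ (ℚ.<⇒≤ 0<δ′) (ι-mono-≤ j≤P)) (ℚ.≤-reflexive Pδ′≡h))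
    same-box : ∀ k → box M (partial k (toℕ j)) ≡ box M (partial k (toℕ i))
    same-box k = trans (sym (Fin.finToFun-funToFin (λ k → box M (partial k (toℕ j))) k))
      (trans (cong (λ c → Fin.finToFun c k) (sym (proj₂ (proj₂ (proj₂ collision))))) (Fin.finToFun-funToFin (λ k → box M (partial k (toℕ i))) k))

-- The accuracy δ is split into h = δ / 2 for the boxes and h for the P links of the chain, hence δ′
-- = h / P. Recurrence in smaller degree is applied to P s functions at once: the defect of every f
-- i at each of P arguments D k, the pair (k , i) being coded by `remQuot`.
recurrent-suc : ∀ {n} → Recurrent n → Recurrent (suc n)
recurrent-suc {n} IH s {δ} 0<δ = P ℕ.* B′ , λ f pf f0 →
  let x , 1≤x , x≤B , close = Chain.found 0<δ′ B′ f f0 (choose f pf f0) M {{ℕ.>-nonZero 1≤M}} refl 1≤Mh Pδ′≡h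
  in x , 1≤x , x≤B , λ i → near-≤ (ℚ.≤-reflexive h+h≡δ) (close i)
  where
  h = ℚ.½ * δ
  0<h : 0ℚ <ℚ h
  0<h = 0<* (ℚ.positive⁻¹ ℚ.½) 0<δ
  h+h≡δ : h + h ≡ δ
  h+h≡δ = solve 1 (λ δ → con ℚ.½ :* δ :+ con ℚ.½ :* δ := δ) refl δ
  boxCount = small 1ℚ 0<h (ℚ.<⇒≤ (ℚ.positive⁻¹ 1ℚ))
  M = proj₁ boxCount
  1≤M : 1 ≤ M
  1≤M = proj₁ (proj₂ boxCount)
  1≤Mh : 1ℚ ≤ℚ ι M * h
  1≤Mh = proj₂ (proj₂ boxCount)
  P = M ℕ.^ s
  inverse = reciprocal (0<ι (ℕ.m^n>0 M {{ℕ.>-nonZero 1≤M}} s))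
  r = proj₁ inverse
  δ′ = h * r
  0<δ′ : 0ℚ <ℚ δ′
  0<δ′ = 0<* 0<h (proj₁ (proj₂ inverse))
  Pδ′≡h : ι P * δ′ ≡ h
  Pδ′≡h = trans (solve 3 (λ P h r → P :* (h :* r) := h :* (P :* r)) refl (ι P) h r)
    (trans (cong (h *_) (proj₂ (proj₂ inverse))) (ℚ.*-identityʳ h))
  B′ = proj₁ (IH (P ℕ.* s) 0<δ′)
  choose : ∀ f → (∀ i → Poly (suc (suc n)) (λ _ → f i)) → (∀ i → f i 0ℚ ≡ 0ℚ) → (D : ℕ → ℕ) →
    ∃[ x ] 1 ≤ x × x ≤ B′ × ∀ i k → k ℕ.< P → NearInteger (cross (f i) (ι (D k)) (ι x)) δ′
  choose f pf f0 D =
    let row k = proj₁ (Fin.remQuot {P} s k)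
        col k = proj₂ (Fin.remQuot {P} s k)
        x , 1≤x , x≤B′ , close = proj₂ (IH (P ℕ.* s) 0<δ′) (λ k → cross (f (col k)) (ι (D (toℕ (row k)))))
          (λ k → cross-Poly (ι (D (toℕ (row k)))) (pf (col k)))
          (λ k → cross-0 {f (col k)} (ι (D (toℕ (row k)))) (f0 (col k)))
    in x , 1≤x , x≤B′ , λ i k k<P →
       subst (λ t → NearInteger (cross (f i) (ι (D t)) (ι x)) δ′) (Fin.toℕ-fromℕ< k<P)
         (subst (λ t → NearInteger (cross (f (proj₂ t)) (ι (D (toℕ (proj₁ t)))) (ι x)) δ′)
           (Fin.remQuot-combine (fromℕ< k<P) i) (close (Fin.combine (fromℕ< k<P) i)))

recurrence : ∀ n → Recurrent n
recurrence zero    = recurrent-zero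
recurrence (suc n) = recurrent-suc (recurrence n)

-- Sign changes of polynomials

module _ {Q : ℕ → Set} (Q? : ∀ y → Dec (Q y)) where

  switch : ∀ k {a} → Q a → ¬ Q (k ℕ.+ a) → ∃[ c ] a ≤ c × c ℕ.< k ℕ.+ a × Q c × ¬ Q (suc c)
  switch zero qa ¬qb = ⊥-elim (¬qb qa)
  switch (suc k) {a} qa ¬qb with Q? (k ℕ.+ a)
  ... | yes q  = k ℕ.+ a , ℕ.m≤n+m a k , ℕ.≤-refl , q , ¬qb
  ... | no ¬q = let c , a≤c , c<b , q , ¬q′ = switch k qa ¬q in c , a≤c , ℕ.m≤n⇒m≤1+n c<b , q , ¬q′

  last-before : ∀ {a b} → a ≤ b → Q a → ¬ Q b → ∃[ c ] a ≤ c × c ℕ.< b × Q c × ¬ Q (suc c)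
  last-before {a} {b} a≤b qa ¬qb =
    let c , a≤c , c<b , q , ¬q′ = switch (b ℕ.∸ a) qa (subst (λ x → ¬ Q x) (sym (ℕ.m∸n+n≡m a≤b)) ¬qb)
    in c , a≤c , subst (c ℕ.<_) (ℕ.m∸n+n≡m a≤b) c<b , q , ¬q′

  between? : ∀ a b → Dec (∃[ y ] a ≤ y × y ℕ.< b × Q y)
  between? a b with ℕ.anyUpTo? (λ y → a ℕ.≤? y ×-dec Q? y) b
  ... | yes (y , y<b , a≤y , q) = yes (y , a≤y , y<b , q)
  ... | no h = no λ { (y , a≤y , y<b , q) → h (y , y<b , a≤y , q) }

data Direction : Set where
  up down : Direction

opposite : Direction → Direction
opposite up   = down
opposite down = up

Signed : Direction → ℚ → Set
Signed up   q = 0ℚ <ℚ q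
Signed down q = q <ℚ 0ℚ

¬Signed-0 : ∀ s → ¬ Signed s 0ℚ
¬Signed-0 up   = ℚ.<-irrefl refl
¬Signed-0 down = ℚ.<-irrefl refl

-- Alternating e n a s: the sequence e takes, from a on, n + 1 values of alternating strict signs, the first one s.
data Alternating (e : ℕ → ℚ) : ℕ → ℕ → Direction → Set where
  last : ∀ {a s} t → a ≤ t → Signed s (e t) → Alternating e 0 a s
  more : ∀ {n a s} t → a ≤ t → Signed s (e t) → Alternating e n (suc t) (opposite s) → Alternating e (suc n) a s

alternating-≤ : ∀ {e n a b s} → a ≤ b → Alternating e n b s → Alternating e n a s
alternating-≤ a≤b (last t b≤t h)      = last t (ℕ.≤-trans a≤b b≤t) h
alternating-≤ a≤b (more t b≤t h rest) = more t (ℕ.≤-trans a≤b b≤t) h rest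

alternating-≗ : ∀ {e e′ n a s} → (∀ t → e t ≡ e′ t) → Alternating e n a s → Alternating e′ n a s
alternating-≗ {s = s} eq (last t a≤t h)      = last t a≤t (subst (Signed s) (eq t) h)
alternating-≗ {s = s} eq (more t a≤t h rest) = more t a≤t (subst (Signed s) (eq t) h) (alternating-≗ eq rest)

p<q⇒0<q-p : ∀ {p q} → p <ℚ q → 0ℚ <ℚ q - p
p<q⇒0<q-p {p} {q} p<q = <-by p<q (solve 2 (λ p q → q :- p :- con 0ℚ := q :- p) refl p q)

q<p⇒q-p<0 : ∀ {p q} → q <ℚ p → q - p <ℚ 0ℚ
q<p⇒q-p<0 {p} {q} q<p = <-by q<p (solve 2 (λ p q → con 0ℚ :- (q :- p) := p :- q) refl p q)

sign-change : ∀ (e : ℕ → ℚ) s {t u} → t ℕ.< u → Signed s (e t) → Signed (opposite s) (e u) →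
  ∃[ c ] t ≤ c × c ℕ.< u × Signed (opposite s) (e (suc c) - e c)
sign-change e up t<u h k =
  let c , t≤c , c<u , q , ¬q = last-before (λ y → 0ℚ ℚ.<? e y) (ℕ.<⇒≤ t<u) h (λ 0<eu → ℚ.<-asym 0<eu k)
  in c , t≤c , c<u , q<p⇒q-p<0 (ℚ.≤-<-trans (ℚ.≮⇒≥ ¬q) q)
sign-change e down t<u h k =
  let c , t≤c , c<u , q , ¬q = last-before (λ y → e y ℚ.<? 0ℚ) (ℕ.<⇒≤ t<u) h (λ eu<0 → ℚ.<-asym eu<0 k)
  in c , t≤c , c<u , p<q⇒0<q-p (ℚ.<-≤-trans q (ℚ.≮⇒≥ ¬q))

-- Discrete Rolle: between a value of one sign and a later one of the other sign some step goes
-- towards the latter, so differencing loses only one alternation.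
rolle : ∀ {e n a s} t → a ≤ t → Signed s (e t) → Alternating e n (suc t) (opposite s) →
  Alternating (λ y → e (suc y) - e y) n a (opposite s)
rolle {e} {s = s} t a≤t h (last u t<u k) =
  let c , t≤c , c<u , j = sign-change e s t<u h k in last c (ℕ.≤-trans a≤t t≤c) j
rolle {e} {s = s} t a≤t h (more u t<u k rest) =
  let c , t≤c , c<u , j = sign-change e s t<u h k in more c (ℕ.≤-trans a≤t t≤c) j (rolle u c<u k rest)

-- Each difference removes one coefficient and one alternation; what is left would be the zero
-- polynomial with a strict sign.
no-alternation : ∀ {n E} → Poly n E → ∀ N {a s} → ¬ Alternating (λ y → E N (ι y)) n a s
no-alternation (nil e) N {s = s} (last t _ h) = ¬Signed-0 s (subst (Signed s) (e N (ι t)) h)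
no-alternation {E = E} p@(cons _ _ _) N (more t a≤t h rest) =
  no-alternation (Poly-difference 1ℚ p) N
    (alternating-≗ (λ y → cong (λ x → E N x - E N (ι y)) (trans (ι-suc y) (ℚ.+-comm 1ℚ (ι y))))
      (rolle t a≤t h rest))

module _ {e : ℕ → ℚ} {Moves : Direction → ℕ → Set} (moves? : ∀ s y → Dec (Moves s y)) {Y}
         (signed : ∀ s y → y ℕ.< Y → Moves s y → Signed s (e y)) where

  Quiet : Direction → ℕ → ℕ → Set
  Quiet s a b = ∀ y → a ≤ y → y ℕ.< b → ¬ Moves s y

  -- A block that is quiet in no direction contains moves of both kinds. From n + 1 such blocks the
  -- signs can be picked alternately, one from each, starting with either.
  quiet-or-alternating : ∀ n (b : ℕ → ℕ) → (∀ i → i ≤ n → b (suc i) ≤ Y) →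
    (∃[ i ] i ≤ n × ∃[ s ] Quiet s (b i) (b (suc i))) ⊎ (∀ s → Alternating e n (b 0) s)
  quiet-or-alternating n b b≤Y with between? (moves? up) (b 0) (b 1) | between? (moves? down) (b 0) (b 1)
  ... | no h | _ = inj₁ (0 , z≤n , up , λ y a≤y y<b k → h (y , a≤y , y<b , k))
  ... | yes _ | no h = inj₁ (0 , z≤n , down , λ y a≤y y<b k → h (y , a≤y , y<b , k))
  quiet-or-alternating zero b b≤Y | yes (y , a≤y , y<b , h) | yes (z , a≤z , z<b , k) = inj₂ λ where
    up   → last y a≤y (signed up y (ℕ.<-≤-trans y<b (b≤Y 0 z≤n)) h)
    down → last z a≤z (signed down z (ℕ.<-≤-trans z<b (b≤Y 0 z≤n)) k)
  quiet-or-alternating (suc n) b b≤Y | yes (y , a≤y , y<b , h) | yes (z , a≤z , z<b , k)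
    with quiet-or-alternating n (λ i → b (suc i)) (λ i i≤n → b≤Y (suc i) (s≤s i≤n))
  ... | inj₁ (i , i≤n , s , q) = inj₁ (suc i , s≤s i≤n , s , q)
  ... | inj₂ alt = inj₂ λ where
    up   → more y a≤y (signed up y (ℕ.<-≤-trans y<b (b≤Y 0 z≤n)) h) (alternating-≤ y<b (alt down))
    down → more z a≤z (signed down z (ℕ.<-≤-trans z<b (b≤Y 0 z≤n)) k) (alternating-≤ z<b (alt up))

opaque

  quiet-block : ∀ {n E} → Poly n E → ∀ N {Moves : Direction → ℕ → Set} (moves? : ∀ s y → Dec (Moves s y)) {Y} →
    (∀ s y → y ℕ.< Y → Moves s y → Signed s (E N (ι y))) →
    ∀ (b : ℕ → ℕ) → (∀ i → i ≤ n → b (suc i) ≤ Y) →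
    ∃[ i ] i ≤ n × ∃[ s ] (∀ y → b i ≤ y → y ℕ.< b (suc i) → ¬ Moves s y)
  quiet-block {n} p N moves? signed b b≤Y with quiet-or-alternating moves? signed n b b≤Y
  ... | inj₁ found = found
  ... | inj₂ alt   = ⊥-elim (no-alternation p N (alt up))

-- Two slowly moving polynomials with congruent floors

infixr 8 _◁_ _◀_

_◁_ : Direction → ℤ → ℤ
up   ◁ z = z
down ◁ z = ℤ.- z

_◀_ : Direction → ℚ → ℚ
up   ◀ q = q
down ◀ q = - q

Moves : (ℕ → ℤ) → Direction → ℕ → Set
Moves F d y = d ◁ F (suc y) ≡ d ◁ F y ℤ.+ ℤ.1ℤ

moves? : ∀ F d y → Dec (Moves F d y)
moves? F d y = d ◁ F (suc y) ℤ.≟ d ◁ F y ℤ.+ ℤ.1ℤ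

-- When F moves in direction d, d ◀ A lies between its two values next to d ◁ F + θ d.
θ : Direction → ℤ
θ up   = ℤ.1ℤ
θ down = ℤ.0ℤ

⟦⟧-suc : ∀ z → ⟦ z ℤ.+ ℤ.1ℤ ⟧ ≡ ⟦ z ⟧ + 1ℚ
⟦⟧-suc z = trans (⟦⟧-+ z ℤ.1ℤ) (cong (⟦ z ⟧ +_) ⟦1⟧)

Floors : (ℕ → ℚ) → (ℕ → ℤ) → ℕ → Set
Floors A F Y = ∀ y → y ≤ Y → ⟦ F y ⟧ ≤ℚ A y × A y <ℚ ⟦ F y ⟧ + 1ℚ

down-moves : ∀ {F y} → Moves F down y → F y ≡ F (suc y) ℤ.+ ℤ.1ℤ
down-moves {F} {y} e = trans (ℤsolve 1 (λ a → a ⊜ (⊖ (⊖ a ⊕ ℤcon ℤ.1ℤ)) ⊕ ℤcon ℤ.1ℤ) refl (F y))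
  (cong (ℤ._+ ℤ.1ℤ) (trans (cong ℤ.-_ (sym e)) (ℤ.neg-involutive (F (suc y)))))

module _ {A : ℕ → ℚ} {F : ℕ → ℤ} {Y} (floors : Floors A F Y) where

  private
    lo = λ y y≤Y → proj₁ (floors y y≤Y)
    hi = λ y y≤Y → proj₂ (floors y y≤Y)

  moves-between-up : ∀ y → y ℕ.< Y → Moves F up y → A y <ℚ ⟦ F y ⟧ + 1ℚ × ⟦ F y ⟧ + 1ℚ ≤ℚ A (suc y)
  moves-between-up y y<Y e = hi y (ℕ.<⇒≤ y<Y) ,
    ℚ.≤-trans (ℚ.≤-reflexive (trans (sym (⟦⟧-suc (F y))) (cong ⟦_⟧ (sym e)))) (lo (suc y) y<Y)

  moves-between-down : ∀ y → y ℕ.< Y → Moves F down y → A (suc y) <ℚ ⟦ F y ⟧ × ⟦ F y ⟧ ≤ℚ A y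
  moves-between-down y y<Y e =
    ℚ.<-≤-trans (hi (suc y) y<Y) (ℚ.≤-reflexive (trans (sym (⟦⟧-suc (F (suc y)))) (cong ⟦_⟧ (sym (down-moves {F} e))))) ,
    lo y (ℕ.<⇒≤ y<Y)

  moves-signed : ∀ d y → y ℕ.< Y → Moves F d y → Signed d (A (suc y) - A y)
  moves-signed up y y<Y e = let h , k = moves-between-up y y<Y e in p<q⇒0<q-p (ℚ.<-≤-trans h k)
  moves-signed down y y<Y e = let h , k = moves-between-down y y<Y e in q<p⇒q-p<0 (ℚ.<-≤-trans h k)

  module _ {η} (steps : ∀ y → y ℕ.< Y → ∣ A (suc y) - A y ∣ ≤ℚ η) where

    private
      rises : ∀ y → y ℕ.< Y → A (suc y) ≤ℚ A y + η
      rises y y<Y = ≤-by (ℚ.≤-trans (p≤∣p∣ (A (suc y) - A y)) (steps y y<Y))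
        (solve 3 (λ a b η → a :+ η :- b := η :- (b :- a)) refl (A y) (A (suc y)) η)
      falls : ∀ y → y ℕ.< Y → A y ≤ℚ A (suc y) + η
      falls y y<Y = ≤-by (ℚ.≤-trans (-p≤∣p∣ (A (suc y) - A y)) (steps y y<Y))
        (solve 3 (λ a b η → b :+ η :- a := η :- (:- (b :- a))) refl (A y) (A (suc y)) η)

    -- A step of length at most η across an integer starts within η of it; the integer is F y + 1 on
    -- the way up and F y on the way down.
    moves-near : ∀ d y → y ℕ.< Y → Moves F d y → ∣ d ◀ A y - ⟦ d ◁ F y ℤ.+ θ d ⟧ ∣ ≤ℚ η
    moves-near up y y<Y e = ℚ.≤-trans (ℚ.≤-reflexive (cong (λ x → ∣ A y - x ∣) (⟦⟧-suc (F y))))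
      (∣∣≤ (ℚ.≤-trans (ℚ.<⇒≤ (q<p⇒q-p<0 h)) (ℚ.≤-trans (ℚ.0≤∣p∣ _) (steps y y<Y)))
           (≤-by (ℚ.+-mono-≤ k (rises y y<Y))
             (solve 4 (λ a b η f → η :- (:- (a :- f)) := (b :+ (a :+ η)) :- (f :+ b)) refl (A y) (A (suc y)) η (⟦ F y ⟧ + 1ℚ))))
      where
      h = proj₁ (moves-between-up y y<Y e)
      k = proj₂ (moves-between-up y y<Y e)
    moves-near down y y<Y e = ℚ.≤-trans (ℚ.≤-reflexive (cong (λ x → ∣ - A y - x ∣) (trans (cong ⟦_⟧ (ℤ.+-identityʳ (ℤ.- F y))) (⟦⟧-neg (F y)))))
      (∣∣≤ (≤-by (ℚ.+-mono-≤ k (ℚ.≤-trans (ℚ.0≤∣p∣ _) (steps y y<Y))) (solve 3 (λ a η f → η :- (:- a :- (:- f)) := (a :+ η) :- (f :+ con 0ℚ)) refl (A y) η ⟦ F y ⟧))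
           (≤-by (ℚ.+-mono-≤ (ℚ.<⇒≤ h) (falls y y<Y))
             (solve 4 (λ a b η f → η :- (:- (:- a :- (:- f))) := (f :+ (b :+ η)) :- (b :+ a)) refl (A y) (A (suc y)) η ⟦ F y ⟧)))
      where
      h = proj₁ (moves-between-down y y<Y e)
      k = proj₂ (moves-between-down y y<Y e)

    module _ (η≤1 : η ≤ℚ 1ℚ) where

      private
        z<z′+2⇒z≤z′+1 : ∀ {z z′} a a′ → ⟦ z ⟧ ≤ℚ a → a ≤ℚ a′ + η → a′ <ℚ ⟦ z′ ⟧ + 1ℚ → z ℤ.≤ z′ ℤ.+ ℤ.1ℤ
        z<z′+2⇒z≤z′+1 {z} {z′} a a′ h k l = ℤ.≤-trans (ℤ.i<j⇒i≤pred[j] (⟦⟧-cancel-< (ℚ.<-≤-trans z<z′+2 (ℚ.≤-reflexive two))))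
          (ℤ.≤-reflexive (ℤ.pred-suc (z′ ℤ.+ ℤ.1ℤ)))
          where
          z<z′+2 : ⟦ z ⟧ <ℚ (⟦ z′ ⟧ + 1ℚ) + 1ℚ
          z<z′+2 = ℚ.≤-<-trans (ℚ.≤-trans h k) (ℚ.+-mono-<-≤ l η≤1)
          two : (⟦ z′ ⟧ + 1ℚ) + 1ℚ ≡ ⟦ ℤ.suc (z′ ℤ.+ ℤ.1ℤ) ⟧
          two = trans (cong (_+ 1ℚ) (sym (⟦⟧-suc z′))) (trans (sym (⟦⟧-suc (z′ ℤ.+ ℤ.1ℤ))) (cong ⟦_⟧ (ℤ.+-comm (z′ ℤ.+ ℤ.1ℤ) ℤ.1ℤ)))

      stays-or-moves : ∀ d y → y ℕ.< Y → F (suc y) ≡ F y ⊎ Moves F d y ⊎ Moves F (opposite d) y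
      stays-or-moves d y y<Y with F (suc y) ℤ.≟ F y
      ... | yes e = inj₁ e
      ... | no ¬e = inj₂ (moved d (ℤ.<-cmp (F (suc y)) (F y)))
        where
        F′≤ : F (suc y) ℤ.≤ F y ℤ.+ ℤ.1ℤ
        F′≤ = z<z′+2⇒z≤z′+1 (A (suc y)) (A y) (lo (suc y) y<Y) (rises y y<Y) (hi y (ℕ.<⇒≤ y<Y))
        F≤ : F y ℤ.≤ F (suc y) ℤ.+ ℤ.1ℤ
        F≤ = z<z′+2⇒z≤z′+1 (A y) (A (suc y)) (lo y (ℕ.<⇒≤ y<Y)) (falls y y<Y) (hi (suc y) y<Y)
        ascends : F y ℤ.< F (suc y) → Moves F up y
        ascends h = ℤ.≤-antisym F′≤ (ℤ.≤-trans (ℤ.≤-reflexive (ℤ.+-comm (F y) ℤ.1ℤ)) (ℤ.i<j⇒suc[i]≤j h))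
        descends : F (suc y) ℤ.< F y → Moves F down y
        descends h = trans (ℤsolve 1 (λ a → ⊖ a ⊜ (⊖ (a ⊕ ℤcon ℤ.1ℤ)) ⊕ ℤcon ℤ.1ℤ) refl (F (suc y)))
          (cong (λ z → ℤ.- z ℤ.+ ℤ.1ℤ) (sym (ℤ.≤-antisym F≤ (ℤ.≤-trans (ℤ.≤-reflexive (ℤ.+-comm (F (suc y)) ℤ.1ℤ)) (ℤ.i<j⇒suc[i]≤j h)))))
        moved : ∀ d → Tri (F (suc y) ℤ.< F y) (F (suc y) ≡ F y) (F y ℤ.< F (suc y)) → Moves F d y ⊎ Moves F (opposite d) y
        moved _    (tri≈ _ e _) = ⊥-elim (¬e e)
        moved up   (tri< h _ _) = inj₂ (descends h)
        moved up   (tri> _ _ h) = inj₁ (ascends h)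
        moved down (tri< h _ _) = inj₁ (descends h)
        moved down (tri> _ _ h) = inj₂ (ascends h)

      advance-≤ : ∀ d y → y ℕ.< Y → d ◁ F (suc y) ℤ.≤ d ◁ F y ℤ.+ ℤ.1ℤ
      advance-≤ d y y<Y with stays-or-moves d y y<Y
      ... | inj₁ e        = ℤ.≤-trans (ℤ.≤-reflexive (cong (d ◁_) e)) (ℤ.i≤i+j (d ◁ F y) ℤ.1ℤ)
      ... | inj₂ (inj₁ e) = ℤ.≤-reflexive e
      ... | inj₂ (inj₂ e) = ℤ.≤-trans (ℤ.i≤i+j (d ◁ F (suc y)) ℤ.1ℤ) (ℤ.≤-trans (ℤ.≤-reflexive (retreat d e)) (ℤ.i≤i+j (d ◁ F y) ℤ.1ℤ))
        where
        retreat : ∀ d → Moves F (opposite d) y → d ◁ F (suc y) ℤ.+ ℤ.1ℤ ≡ d ◁ F y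
        retreat up   e = sym (down-moves {F} e)
        retreat down e = trans (cong (λ z → ℤ.- z ℤ.+ ℤ.1ℤ) e) (ℤsolve 1 (λ a → (⊖ (a ⊕ ℤcon ℤ.1ℤ)) ⊕ ℤcon ℤ.1ℤ ⊜ ⊖ a) refl (F y))

+1-cancel-≤ : ∀ {a b} → a ℤ.+ ℤ.1ℤ ℤ.≤ b ℤ.+ ℤ.1ℤ → a ℤ.≤ b
+1-cancel-≤ {a} {b} h = subst₂ ℤ._≤_ (cancel a) (cancel b) (ℤ.+-monoˡ-≤ (ℤ.- ℤ.1ℤ) h)
  where
  cancel : ∀ a → a ℤ.+ ℤ.1ℤ ℤ.+ ℤ.- ℤ.1ℤ ≡ a
  cancel = ℤsolve 1 (λ a → a ⊕ ℤcon ℤ.1ℤ ⊕ ℤcon (ℤ.- ℤ.1ℤ) ⊜ a) refl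

Climb : (ℕ → ℤ) → ℕ → ℕ → ℕ → ℤ → Set
Climb F Y k a v = Σ[ c ∈ (ℕ → ℕ) ] a ≤ c 0 × (∀ i → i ≤ k → c i ℕ.< Y × F (c i) ≡ v ℤ.+ ℤ.+ i × F (suc (c i)) ≡ F (c i) ℤ.+ ℤ.1ℤ)
                        × (∀ i → i ℕ.< k → c i ℕ.< c (suc i))

opaque

  -- Discrete intermediate values: `F` rises by at most one per step, so where it passes from ≤ v to
  -- > v it goes exactly from v to v + 1. The next crossing is looked for from there on, at level v
  -- + 1.
  climb : ∀ F Y → (∀ y → y ℕ.< Y → F (suc y) ℤ.≤ F y ℤ.+ ℤ.1ℤ) →
    ∀ k a v → a ≤ Y → F a ℤ.≤ v → v ℤ.+ ℤ.+ k ℤ.< F Y → Climb F Y k a v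
  climb F Y step k a v a≤Y Fa≤v v+k<FY
    with last-before (λ y → F y ℤ.≤? v) a≤Y Fa≤v (ℤ.<⇒≱ (ℤ.≤-<-trans (ℤ.i≤i+j v (ℤ.+ k)) v+k<FY))
  ... | c , a≤c , c<Y , Fc≤v , Fc′≰v = go k v+k<FY
    where
    v<Fc′ : v ℤ.+ ℤ.1ℤ ℤ.≤ F (suc c)
    v<Fc′ = ℤ.≤-trans (ℤ.≤-reflexive (ℤ.+-comm v ℤ.1ℤ)) (ℤ.i<j⇒suc[i]≤j (ℤ.≰⇒> Fc′≰v))
    Fc≡v : F c ≡ v
    Fc≡v = ℤ.≤-antisym Fc≤v (+1-cancel-≤ (ℤ.≤-trans v<Fc′ (step c c<Y)))
    Fc′≡v+1 : F (suc c) ≡ v ℤ.+ ℤ.1ℤ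
    Fc′≡v+1 = ℤ.≤-antisym (ℤ.≤-trans (step c c<Y) (ℤ.≤-reflexive (cong (ℤ._+ ℤ.1ℤ) Fc≡v))) v<Fc′
    here : F c ≡ v ℤ.+ ℤ.+ 0
    here = trans Fc≡v (sym (ℤ.+-identityʳ v))
    here-moves : F (suc c) ≡ F c ℤ.+ ℤ.1ℤ
    here-moves = trans Fc′≡v+1 (cong (ℤ._+ ℤ.1ℤ) (sym Fc≡v))
    prepend : (ℕ → ℕ) → ℕ → ℕ
    prepend c′ zero    = c
    prepend c′ (suc i) = c′ i
    go : ∀ k → v ℤ.+ ℤ.+ k ℤ.< F Y → Climb F Y k a v
    go zero _ = (λ _ → c) , a≤c , (λ { zero _ → c<Y , here , here-moves ; (suc _) () }) , (λ _ ())
    go (suc k) v+k<FY with climb F Y step k (suc c) (v ℤ.+ ℤ.1ℤ) c<Y (ℤ.≤-reflexive Fc′≡v+1)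
         (subst (ℤ._< F Y) (sym (ℤ.+-assoc v ℤ.1ℤ (ℤ.+ k))) v+k<FY)
    ... | c′ , c<c′ , at , increasing = prepend c′ , a≤c ,
          (λ { zero _ → c<Y , here , here-moves
             ; (suc i) (s≤s i≤k) → let p , q , r = at i i≤k in p , trans q (ℤ.+-assoc v ℤ.1ℤ (ℤ.+ i)) , r }) ,
          (λ { zero _ → c<c′ ; (suc i) (s≤s i<k) → increasing i i<k })

◀-- : ∀ d p q → d ◀ p - d ◀ q ≡ d ◀ (p - q)
◀-- up   p q = refl
◀-- down p q = solve 2 (λ p q → :- p :- (:- q) := :- (p :- q)) refl p q

◀≤∣∣ : ∀ d p → d ◀ p ≤ℚ ∣ p ∣
◀≤∣∣ up   = p≤∣p∣
◀≤∣∣ down = -p≤∣p∣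

Poly-◀ : ∀ {n F} d → Poly n F → Poly n (λ N x → d ◀ F N x)
Poly-◀ up   p = p
Poly-◀ {F = F} down p = Poly-ext (λ N x → trans (cong -_ (sym (ℚ.*-identityˡ (F N x)))) (ℚ.neg-distribˡ-* 1ℚ (F N x)))
  (Poly-scale (- 1ℚ) p)

lipschitz : ∀ {A : ℕ → ℚ} {Y η} → (∀ y → y ℕ.< Y → ∣ A (suc y) - A y ∣ ≤ℚ η) →
  ∀ k y → k ℕ.+ y ≤ Y → ∣ A (k ℕ.+ y) - A y ∣ ≤ℚ ι k * η
lipschitz {A} {η = η} steps zero y _ = ℚ.≤-reflexive (trans (cong ∣_∣ (ℚ.+-inverseʳ (A y)))
  (sym (trans (cong (_* η) ⟦0⟧) (ℚ.*-zeroˡ η))))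
lipschitz {A} {η = η} steps (suc k) y h = ℚ.≤-trans
  (∣-∣-trans {A (suc k ℕ.+ y)} {A y} (A (k ℕ.+ y)) (steps (k ℕ.+ y) h) (lipschitz {A} steps k y (ℕ.<⇒≤ h)))
  (ℚ.≤-reflexive (trans (solve 2 (λ η k → η :+ k :* η := (con 1ℚ :+ k) :* η) refl η (ι k)) (cong (_* η) (sym (ι-suc k)))))

increasing⇒< : ∀ {c : ℕ → ℕ} {M} → (∀ i → i ℕ.< M → c i ℕ.< c (suc i)) → ∀ {i j} → i ℕ.< j → j ≤ M → c i ℕ.< c j
increasing⇒< {c} inc {i} {suc j} (s≤s i≤j) j<M with ℕ.m≤n⇒m<n∨m≡n i≤j
... | inj₁ i<j  = ℕ.<-trans (increasing⇒< {c} inc i<j (ℕ.<⇒≤ j<M)) (inc j j<M)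
... | inj₂ refl = inc j j<M

increasing⇒≤ : ∀ {c : ℕ → ℕ} {M} → (∀ i → i ℕ.< M → c i ℕ.< c (suc i)) → ∀ {i j} → i ≤ j → j ≤ M → c i ≤ c j
increasing⇒≤ {c} inc i≤j j≤M with ℕ.m≤n⇒m<n∨m≡n i≤j
... | inj₁ i<j  = ℕ.<⇒≤ (increasing⇒< {c} inc i<j j≤M)
... | inj₂ refl = ℕ.≤-refl

unit≢multiple : ∀ {m} → 2 ≤ m → ∀ k → ℤ.1ℤ ≢ k ℤ.* ℤ.+ m
unit≢multiple {m} 2≤m k e = ℕ.<⇒≢ 2≤m (sym (ℕ.m*n≡1⇒n≡1 ℤ.∣ k ∣ m (trans (sym (ℤ.abs-* k (ℤ.+ m))) (cong ℤ.∣_∣ (sym e)))))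

-- Room for n + 1 superblocks of n + 1 subblocks of n + 1 crossings. The differences of A and B have
-- n coefficients, so one of n + 1 superblocks is quiet for A and one of its n + 1 subblocks is
-- quiet for B; n + 1 crossings then suffice to interpolate with n + 1 coefficients.
crossings : ℕ → ℕ
crossings n = suc n ℕ.* (suc n ℕ.* suc n)

module Core {n A B} (pA : Poly (suc n) A) (pB : Poly (suc n) B) (N : ℕ) {F G : ℕ → ℤ} {Y}
  (floorA : Floors (λ y → A N (ι y)) F Y) (floorB : Floors (λ y → B N (ι y)) G Y)
  {m} (2≤m : 2 ≤ m) (congruent : ∀ y → y ≤ Y → ∃[ z ] F y ≡ G y ℤ.+ z ℤ.* ℤ.+ m)
  {η} (0≤η : 0ℚ ≤ℚ η) (η+η≤½ : η + η ≤ℚ ℚ.½)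
  (stepA : ∀ y → y ℕ.< Y → ∣ A N (ι (suc y)) - A N (ι y) ∣ ≤ℚ η)
  (stepB : ∀ y → y ℕ.< Y → ∣ B N (ι (suc y)) - B N (ι y) ∣ ≤ℚ η)
  {r} (0≤r : 0ℚ ≤ℚ r) (Yη≤r : ι Y * (η + η) ≤ℚ r)
  (d : Direction) (far : d ◁ F 0 ℤ.+ ℤ.+ crossings n ℤ.< d ◁ F Y) where

  η≤1 : η ≤ℚ 1ℚ
  η≤1 = ℚ.≤-trans {η} {ℚ.½} (≤-by (ℚ.+-mono-≤ 0≤η η+η≤½) (solve 1 (λ η → con ℚ.½ :- η := (η :+ con ℚ.½) :- (con 0ℚ :+ (η :+ η))) refl η))
    (ℚ.≤ᵇ⇒≤ _)


  L = suc n ℕ.* suc n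
  M = crossings n

  climbing : Climb (λ y → d ◁ F y) Y M 0 (d ◁ F 0)
  climbing = climb (λ y → d ◁ F y) Y (advance-≤ floorA stepA η≤1 d) M 0 (d ◁ F 0) z≤n ℤ.≤-refl far

  c : ℕ → ℕ
  c = proj₁ climbing

  c<Y : ∀ {i} → i ≤ M → c i ℕ.< Y
  c<Y {i} i≤M = proj₁ (proj₁ (proj₂ (proj₂ climbing)) i i≤M)

  c-level : ∀ {i} → i ≤ M → d ◁ F (c i) ≡ d ◁ F 0 ℤ.+ ℤ.+ i
  c-level {i} i≤M = proj₁ (proj₂ (proj₁ (proj₂ (proj₂ climbing)) i i≤M))

  c-moves : ∀ {i} → i ≤ M → Moves F d (c i)
  c-moves {i} i≤M = proj₂ (proj₂ (proj₁ (proj₂ (proj₂ climbing)) i i≤M))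

  c-< : ∀ {i j} → i ℕ.< j → j ≤ M → c i ℕ.< c j
  c-< = increasing⇒< {c} (proj₂ (proj₂ (proj₂ climbing)))

  c-≤ : ∀ {i j} → i ≤ j → j ≤ M → c i ≤ c j
  c-≤ = increasing⇒≤ {c} (proj₂ (proj₂ (proj₂ climbing)))

  -- Between two crossings `d ◀ A` goes from within η of one integer to within η of a larger one, so
  -- it moves by at least 1 - 2η ≥ 1 / 2, at most η at a time.
  separated : ∀ {i j} → i ℕ.< j → j ≤ M → 1ℚ ≤ℚ (η + η) * ∣ ι (c j) - ι (c i) ∣
  separated {i} {j} i<j j≤M = ℚ.≤-trans half
    (*-monoˡ (0≤+ 0≤η 0≤η) (ι-dist-≥ {c i} {c j} {k} (ℕ.≤-reflexive ci+k≡cj)))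
    where
    k = c j ℕ.∸ c i
    i≤M = ℕ.≤-trans (ℕ.<⇒≤ i<j) j≤M
    ci≤cj = ℕ.<⇒≤ (c-< i<j j≤M)
    k+ci≡cj : k ℕ.+ c i ≡ c j
    k+ci≡cj = ℕ.m∸n+n≡m ci≤cj
    ci+k≡cj : c i ℕ.+ k ≡ c j
    ci+k≡cj = trans (ℕ.+-comm (c i) k) k+ci≡cj
    Ai = d ◀ A N (ι (c i))
    Aj = d ◀ A N (ι (c j))
    level : ∀ {i} → i ≤ M → ⟦ d ◁ F (c i) ℤ.+ θ d ⟧ ≡ ι i + ⟦ d ◁ F 0 ℤ.+ θ d ⟧
    level {i} i≤M = trans (cong (λ z → ⟦ z ℤ.+ θ d ⟧) (c-level i≤M))
      (trans (cong ⟦_⟧ (ℤsolve 3 (λ f i t → f ⊕ i ⊕ t ⊜ i ⊕ (f ⊕ t)) refl (d ◁ F 0) (ℤ.+ i) (θ d)))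
        (⟦⟧-+ (ℤ.+ i) (d ◁ F 0 ℤ.+ θ d)))
    close : ∀ {i} → i ≤ M → ∣ d ◀ A N (ι (c i)) - (ι i + ⟦ d ◁ F 0 ℤ.+ θ d ⟧) ∣ ≤ℚ η
    close {i} i≤M = subst (λ x → ∣ d ◀ A N (ι (c i)) - x ∣ ≤ℚ η) (level i≤M) (moves-near floorA stepA d (c i) (c<Y i≤M) (c-moves i≤M))
    moved : Aj - Ai ≤ℚ ι k * η
    moved = ℚ.≤-trans (ℚ.≤-reflexive (◀-- d (A N (ι (c j))) (A N (ι (c i)))))
      (ℚ.≤-trans (◀≤∣∣ d _) (subst (λ y → ∣ A N (ι y) - A N (ι (c i)) ∣ ≤ℚ ι k * η) k+ci≡cj
        (lipschitz {λ y → A N (ι y)} stepA k (c i) (ℕ.≤-trans (ℕ.≤-reflexive k+ci≡cj) (ℕ.<⇒≤ (c<Y j≤M))))))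
    1+i≤j : 1ℚ + ι i ≤ℚ ι j
    1+i≤j = ℚ.≤-trans (ℚ.≤-reflexive (sym (ι-suc i))) (ι-mono-≤ i<j)
    V = ⟦ d ◁ F 0 ℤ.+ θ d ⟧
    jump : 1ℚ ≤ℚ ι k * η + (η + η)
    jump = ≤-by (ℚ.+-mono-≤ (ℚ.+-mono-≤ moved 1+i≤j) (ℚ.+-mono-≤ (ℚ.≤-trans (-p≤∣p∣ _) (close j≤M)) (ℚ.≤-trans (p≤∣p∣ _) (close i≤M))))
      (solve 7 (λ k η ai aj i j v → (k :* η :+ (η :+ η)) :- con 1ℚ
        := (k :* η :+ j :+ (η :+ η)) :- ((aj :- ai) :+ (con 1ℚ :+ i) :+ (:- (aj :- (j :+ v)) :+ (ai :- (i :+ v))))) refl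
        (ι k) η Ai Aj (ι i) (ι j) V)
    half : 1ℚ ≤ℚ (η + η) * ι k
    half = ≤-by (ℚ.+-mono-≤ (ℚ.+-mono-≤ jump jump) (ℚ.+-mono-≤ η+η≤½ η+η≤½))
      (solve 2 (λ k η → (η :+ η) :* k :- con 1ℚ := ((k :* η :+ (η :+ η)) :+ (k :* η :+ (η :+ η)) :+ (con ℚ.½ :+ con ℚ.½)) :- (con 1ℚ :+ con 1ℚ :+ ((η :+ η) :+ (η :+ η)))) refl (ι k) η)

  signed-difference : ∀ {E : ℕ → ℚ → ℚ} {s} y → Signed s (E N (ι (suc y)) - E N (ι y)) → Signed s (E N (ι y + 1ℚ) - E N (ι y))
  signed-difference {E} {s} y = subst (λ x → Signed s (E N x - E N (ι y))) (trans (ι-suc y) (ℚ.+-comm 1ℚ (ι y)))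

  superblock : ∃[ i ] i ≤ n × (∀ y → c (i ℕ.* L) ≤ y → y ℕ.< c (suc i ℕ.* L) → ¬ Moves F (opposite d) y)
  superblock = oriented (quiet-block (Poly-difference 1ℚ pA) N (moves? F)
      (λ s y y<Y h → signed-difference {A} {s} y (moves-signed floorA s y y<Y h))
      (λ i → c (i ℕ.* L)) (λ i i≤n → ℕ.<⇒≤ (c<Y (ℕ.*-monoˡ-≤ L (s≤s i≤n)))))
    where
    oriented : (∃[ i ] i ≤ n × ∃[ s ] (∀ y → c (i ℕ.* L) ≤ y → y ℕ.< c (suc i ℕ.* L) → ¬ Moves F s y)) →
      ∃[ i ] i ≤ n × (∀ y → c (i ℕ.* L) ≤ y → y ℕ.< c (suc i ℕ.* L) → ¬ Moves F (opposite d) y)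
    oriented (i , i≤n , s , quiet) = i , i≤n , subst (λ s → ∀ y → c (i ℕ.* L) ≤ y → y ℕ.< c (suc i ℕ.* L) → ¬ Moves F s y) (s≡opposite s d s≢d) quiet
      where
      -- The block begins with a crossing in direction d, so the direction in which it is quiet is
      -- the other one.
      s≢d : s ≢ d
      s≢d refl = quiet (c (i ℕ.* L)) ℕ.≤-refl
        (c-< (ℕ.*-monoˡ-< L (ℕ.n<1+n i)) (ℕ.*-monoˡ-≤ L (s≤s i≤n)))
        (c-moves (ℕ.*-monoˡ-≤ L (ℕ.m≤n⇒m≤1+n i≤n)))
      s≡opposite : ∀ s d → s ≢ d → s ≡ opposite d
      s≡opposite up   up   h = ⊥-elim (h refl)
      s≡opposite up   down h = refl
      s≡opposite down up   h = refl
      s≡opposite down down h = ⊥-elim (h refl)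

  module Superblock i (i≤n : i ≤ n) (quietF : ∀ y → c (i ℕ.* L) ≤ y → y ℕ.< c (suc i ℕ.* L) → ¬ Moves F (opposite d) y) where

    inside : ∀ {j} → j ≤ suc n → i ℕ.* L ℕ.+ j ℕ.* suc n ≤ suc i ℕ.* L
    inside {j} j≤1+n = ℕ.≤-trans (ℕ.≤-reflexive (ℕ.+-comm (i ℕ.* L) (j ℕ.* suc n))) (ℕ.+-monoˡ-≤ (i ℕ.* L) (ℕ.*-monoˡ-≤ (suc n) j≤1+n))

    1+i-inside : suc i ℕ.* L ≤ M
    1+i-inside = ℕ.*-monoˡ-≤ L (s≤s i≤n)

    subblock : ∃[ j ] j ≤ n × ∃[ s ] (∀ y → c (i ℕ.* L ℕ.+ j ℕ.* suc n) ≤ y → y ℕ.< c (i ℕ.* L ℕ.+ suc j ℕ.* suc n) → ¬ Moves G s y)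
    subblock = quiet-block (Poly-difference 1ℚ pB) N (moves? G)
      (λ s y y<Y h → signed-difference {B} {s} y (moves-signed floorB s y y<Y h))
      (λ j → c (i ℕ.* L ℕ.+ j ℕ.* suc n)) (λ j j≤n → ℕ.<⇒≤ (c<Y (ℕ.≤-trans (inside (s≤s j≤n)) 1+i-inside)))

    module Subblock j (j≤n : j ≤ n) s
      (quietG : ∀ y → c (i ℕ.* L ℕ.+ j ℕ.* suc n) ≤ y → y ℕ.< c (i ℕ.* L ℕ.+ suc j ℕ.* suc n) → ¬ Moves G s y) where

      q  = i ℕ.* L ℕ.+ j ℕ.* suc n
      q′ = i ℕ.* L ℕ.+ suc j ℕ.* suc n
      e  = opposite s

      q′≤M : q′ ≤ M
      q′≤M = ℕ.≤-trans (inside (s≤s j≤n)) 1+i-inside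

      -- A unit move of one floor against a standstill of the other would make 1 a multiple of m.
      stay-and-move : ∀ d {x x′ y y′} z z′ → x ≡ y ℤ.+ z ℤ.* ℤ.+ m → x′ ≡ y′ ℤ.+ z′ ℤ.* ℤ.+ m →
        x′ ≡ x → ¬ (d ◁ y′ ≡ d ◁ y ℤ.+ ℤ.1ℤ)
      stay-and-move d {x} {x′} {y} {y′} z z′ e e′ same move = unit≢multiple 2≤m (d ◁ (z ℤ.- z′)) (unit d move)
        where
        difference : y′ ℤ.- y ≡ (z ℤ.- z′) ℤ.* ℤ.+ m
        difference = trans (ℤsolve 5 (λ y y′ z z′ m → y′ ⊝ y ⊜ (y′ ⊕ z′ ⊗ m) ⊝ (y ⊕ z′ ⊗ m)) refl y y′ z z′ (ℤ.+ m))
          (trans (cong (ℤ._- (y ℤ.+ z′ ℤ.* ℤ.+ m)) (trans (sym e′) (trans same e)))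
            (ℤsolve 4 (λ y z z′ m → (y ⊕ z ⊗ m) ⊝ (y ⊕ z′ ⊗ m) ⊜ (z ⊝ z′) ⊗ m) refl y z z′ (ℤ.+ m)))
        unit : ∀ d → d ◁ y′ ≡ d ◁ y ℤ.+ ℤ.1ℤ → ℤ.1ℤ ≡ (d ◁ (z ℤ.- z′)) ℤ.* ℤ.+ m
        unit up   h = trans (trans (ℤsolve 1 (λ y → ℤcon ℤ.1ℤ ⊜ (y ⊕ ℤcon ℤ.1ℤ) ⊝ y) refl y) (cong (ℤ._- y) (sym h))) difference
        unit down h = trans (trans (ℤsolve 1 (λ y → ℤcon ℤ.1ℤ ⊜ (⊖ y ⊕ ℤcon ℤ.1ℤ) ⊕ y) refl y) (cong (ℤ._+ y) (sym h)))
          (trans (ℤsolve 2 (λ y y′ → ⊖ y′ ⊕ y ⊜ ⊖ (y′ ⊝ y)) refl y y′) (trans (cong ℤ.-_ difference) (ℤ.neg-distribˡ-* (z ℤ.- z′) (ℤ.+ m))))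

      flip-congruence : ∀ {x y} z → x ≡ y ℤ.+ z ℤ.* ℤ.+ m → y ≡ x ℤ.+ (ℤ.- z) ℤ.* ℤ.+ m
      flip-congruence {x} {y} z e = trans (ℤsolve 3 (λ y z m → y ⊜ (y ⊕ z ⊗ m) ⊕ (⊖ z) ⊗ m) refl y z (ℤ.+ m)) (cong (ℤ._+ (ℤ.- z) ℤ.* ℤ.+ m) (sym e))

      together : ∀ y → c q ≤ y → y ℕ.< c q′ → (F (suc y) ≡ F y × G (suc y) ≡ G y) ⊎ (Moves F d y × Moves G e y)
      together y cq≤y y<cq′ = combine (stays-or-moves floorA stepA η≤1 d y y<Y) (stays-or-moves floorB stepB η≤1 s y y<Y)
        where
        y<Y = ℕ.<-trans y<cq′ (c<Y q′≤M)
        z = proj₁ (congruent y (ℕ.<⇒≤ y<Y))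
        z′ = proj₁ (congruent (suc y) y<Y)
        here = proj₂ (congruent y (ℕ.<⇒≤ y<Y))
        next = proj₂ (congruent (suc y) y<Y)
        quiet-F : ¬ Moves F (opposite d) y
        quiet-F = quietF y (ℕ.≤-trans (c-≤ (ℕ.m≤m+n (i ℕ.* L) (j ℕ.* suc n)) (ℕ.≤-trans (inside (ℕ.m≤n⇒m≤1+n j≤n)) 1+i-inside)) cq≤y)
          (ℕ.<-≤-trans y<cq′ (c-≤ (inside (s≤s j≤n)) 1+i-inside))
        combine : F (suc y) ≡ F y ⊎ Moves F d y ⊎ Moves F (opposite d) y → G (suc y) ≡ G y ⊎ Moves G s y ⊎ Moves G e y →
          (F (suc y) ≡ F y × G (suc y) ≡ G y) ⊎ (Moves F d y × Moves G e y)
        combine (inj₂ (inj₂ h)) _               = ⊥-elim (quiet-F h)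
        combine _ (inj₂ (inj₁ h))               = ⊥-elim (quietG y cq≤y y<cq′ h)
        combine (inj₁ h) (inj₁ k)               = inj₁ (h , k)
        combine (inj₁ h) (inj₂ (inj₂ k))        = ⊥-elim (stay-and-move e z z′ here next h k)
        combine (inj₂ (inj₁ h)) (inj₁ k)        = ⊥-elim (stay-and-move d (ℤ.- z) (ℤ.- z′) (flip-congruence z here) (flip-congruence z′ next) k h)
        combine (inj₂ (inj₁ h)) (inj₂ (inj₂ k)) = inj₂ (h , k)

      ψ : ℕ → ℤ
      ψ y = d ◁ F y ℤ.- e ◁ G y

      ψ-step : ∀ y → c q ≤ y → y ℕ.< c q′ → ψ (suc y) ≡ ψ y
      ψ-step y h k = by (together y h k)
        where
        by : (F (suc y) ≡ F y × G (suc y) ≡ G y) ⊎ (Moves F d y × Moves G e y) → ψ (suc y) ≡ ψ y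
        by (inj₁ (f , g)) = cong₂ (λ a b → d ◁ a ℤ.- e ◁ b) f g
        by (inj₂ (f , g)) = trans (cong₂ ℤ._-_ f g) (ℤsolve 2 (λ a b → (a ⊕ ℤcon ℤ.1ℤ) ⊝ (b ⊕ ℤcon ℤ.1ℤ) ⊜ a ⊝ b) refl (d ◁ F y) (e ◁ G y))

      ψ-constant : ∀ k → k ℕ.+ c q ≤ c q′ → ψ (k ℕ.+ c q) ≡ ψ (c q)
      ψ-constant zero    _ = refl
      ψ-constant (suc k) h = trans (ψ-step (k ℕ.+ c q) (ℕ.m≤n+m (c q) k) h) (ψ-constant k (ℕ.<⇒≤ h))

      -- At a crossing `d ◀ A` and `e ◀ B` are near the integers d ◁ F + θ d and e ◁ G + θ e. As F
      -- and G move together, the difference of these integers is the same at all crossings of the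
      -- subblock.
      γ : ℤ
      γ = ψ (c q) ℤ.+ (θ d ℤ.- θ e)

      module Node l (l<1+n : l ℕ.< suc n) where

        q+l<q′ : q ℕ.+ l ℕ.< q′
        q+l<q′ = ℕ.<-≤-trans (ℕ.+-monoʳ-< q l<1+n) (ℕ.≤-reflexive
          (trans (ℕ.+-assoc (i ℕ.* L) (j ℕ.* suc n) (suc n)) (cong (i ℕ.* L ℕ.+_) (ℕ.+-comm (j ℕ.* suc n) (suc n)))))

        q+l≤M : q ℕ.+ l ≤ M
        q+l≤M = ℕ.≤-trans (ℕ.<⇒≤ q+l<q′) q′≤M

        x : ℕ
        x = c (q ℕ.+ l)

        cq≤x : c q ≤ x
        cq≤x = c-≤ (ℕ.m≤m+n q l) q+l≤M

        x<cq′ : x ℕ.< c q′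
        x<cq′ = c-< q+l<q′ q′≤M

        ψx : ψ x ≡ ψ (c q)
        ψx = trans (cong ψ (sym eq)) (ψ-constant (x ℕ.∸ c q) (ℕ.≤-trans (ℕ.≤-reflexive eq) (ℕ.<⇒≤ x<cq′)))
          where eq = ℕ.m∸n+n≡m cq≤x

        both-move : Moves F d x × Moves G e x
        both-move = by (together x cq≤x x<cq′)
          where
          by : (F (suc x) ≡ F x × G (suc x) ≡ G x) ⊎ (Moves F d x × Moves G e x) → Moves F d x × Moves G e x
          by (inj₂ h) = h
          by (inj₁ (f , _)) = ⊥-elim (ℤ.i≢suc[i] {d ◁ F x} (trans (trans (cong (d ◁_) (sym f)) (c-moves q+l≤M)) (ℤ.+-comm (d ◁ F x) ℤ.1ℤ)))

        close : ∣ d ◀ A N (ι x) - e ◀ B N (ι x) - ⟦ γ ⟧ ∣ ≤ℚ η + η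
        close = ℚ.≤-trans (ℚ.≤-reflexive (cong ∣_∣ value))
          (∣-∣≤ {d ◀ A N (ι x) - ⟦ d ◁ F x ℤ.+ θ d ⟧} {e ◀ B N (ι x) - ⟦ e ◁ G x ℤ.+ θ e ⟧}
            (moves-near floorA stepA d x x<Y (proj₁ both-move)) (moves-near floorB stepB e x x<Y (proj₂ both-move)))
          where
          x<Y = c<Y q+l≤M
          integers : γ ≡ (d ◁ F x ℤ.+ θ d) ℤ.- (e ◁ G x ℤ.+ θ e)
          integers = trans (cong (ℤ._+ (θ d ℤ.- θ e)) (sym ψx))
            (ℤsolve 4 (λ f g s t → (f ⊝ g) ⊕ (s ⊝ t) ⊜ (f ⊕ s) ⊝ (g ⊕ t)) refl (d ◁ F x) (e ◁ G x) (θ d) (θ e))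
          value : d ◀ A N (ι x) - e ◀ B N (ι x) - ⟦ γ ⟧ ≡ (d ◀ A N (ι x) - ⟦ d ◁ F x ℤ.+ θ d ⟧) - (e ◀ B N (ι x) - ⟦ e ◁ G x ℤ.+ θ e ⟧)
          value = trans (cong (λ t → d ◀ A N (ι x) - e ◀ B N (ι x) - t) (trans (cong ⟦_⟧ integers) (⟦⟧-- (d ◁ F x ℤ.+ θ d) (e ◁ G x ℤ.+ θ e))))
            (solve 4 (λ a b s t → a :- b :- (s :- t) := (a :- s) :- (b :- t)) refl (d ◀ A N (ι x)) (e ◀ B N (ι x)) ⟦ d ◁ F x ℤ.+ θ d ⟧ ⟦ e ◁ G x ℤ.+ θ e ⟧)

      conclusion : ∣ d ◀ A N (ι 0) - e ◀ B N (ι 0) - ⟦ γ ⟧ ∣ ≤ℚ interpolationConstant (suc n) r * (η + η)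
      conclusion = interpolation {suc n} {λ N x → d ◀ A N x - e ◀ B N x - ⟦ γ ⟧}
        (Poly-- (Poly-- (Poly-◀ d pA) (Poly-◀ e pB)) (Poly-const (fromℚ ⟦ γ ⟧)))
        -- Extrapolation to 0 from n + 1 crossings that are at least 1 / (2η) apart and at most Y
        -- away from 0, so that the ratio is Y · 2η ≤ r.
        N (λ l → ι (c (q ℕ.+ l))) {η + η} {ι Y} {r} {η + η} {ι 0} (0≤+ 0≤η 0≤η) 0≤r (0≤+ 0≤η 0≤η) Yη≤r
        (λ l l′ l<l′ l′<1+n → separated (ℕ.+-monoʳ-< q l<l′) (Node.q+l≤M l′ l′<1+n))
        (λ l l<1+n → ι-dist-≤ z≤n (ℕ.<⇒≤ (c<Y (Node.q+l≤M l l<1+n))))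
        Node.close

  theorem : ∃[ e ] ∃[ γ ] ∣ d ◀ A N (ι 0) - e ◀ B N (ι 0) - ⟦ γ ⟧ ∣ ≤ℚ interpolationConstant (suc n) r * (η + η)
  theorem =
    let i , i≤n , quietF = superblock
        j , j≤n , s , quietG = Superblock.subblock i i≤n quietF
    in opposite s , Superblock.Subblock.γ i i≤n quietF j j≤n s quietG ,
       Superblock.Subblock.conclusion i i≤n quietF j j≤n s quietG

-- Constants for the first exit

gap : ℕ → ℕ
gap n = suc (crossings n)

ι-gap : ∀ n → ι (gap n) ≡ 1ℚ + ι (crossings n)
ι-gap n = ι-suc (crossings n)

opaque

  -- Passing from values to floors can lose almost one, which is why `gap` exceeds `crossings` by
  -- one. The direction is that of the displacement.
  exceeds : ∀ n {a b F₀ F₁} → ⟦ F₀ ⟧ ≤ℚ a → a <ℚ ⟦ F₀ ⟧ + 1ℚ → ⟦ F₁ ⟧ ≤ℚ b → b <ℚ ⟦ F₁ ⟧ + 1ℚ →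
    ι (gap n) <ℚ ∣ b - a ∣ → ∃[ d ] d ◁ F₀ ℤ.+ ℤ.+ crossings n ℤ.< d ◁ F₁
  exceeds n {a} {b} {F₀} {F₁} a≥ a< b≥ b< h with ℚ.∣p∣≡p∨∣p∣≡-p (b - a)
  ... | inj₁ e = up , ⟦⟧-cancel-< (ℚ.≤-<-trans (ℚ.≤-reflexive (⟦⟧-+ F₀ (ℤ.+ crossings n)))
      (<-by (ℚ.+-mono-<-≤ (ℚ.+-mono-< (ℚ.<-≤-trans h (ℚ.≤-reflexive e)) b<) a≥)
        (trans (solve 5 (λ f₀ f₁ c a b → f₁ :- (f₀ :+ c) := (b :- a :+ (f₁ :+ con 1ℚ) :+ a) :- ((con 1ℚ :+ c) :+ b :+ f₀)) refl ⟦ F₀ ⟧ ⟦ F₁ ⟧ (ι (crossings n)) a b)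
          (cong (λ x → (b - a + (⟦ F₁ ⟧ + 1ℚ) + a) - (x + b + ⟦ F₀ ⟧)) (sym (ι-gap n))))))
  ... | inj₂ e = down , ⟦⟧-cancel-< (ℚ.<-≤-trans (ℚ.≤-<-trans (ℚ.≤-reflexive (trans (⟦⟧-+ (ℤ.- F₀) (ℤ.+ crossings n)) (cong (_+ ι (crossings n)) (⟦⟧-neg F₀))))
      (<-by (ℚ.+-mono-<-≤ (ℚ.+-mono-< (ℚ.<-≤-trans h (ℚ.≤-reflexive e)) a<) b≥)
        (trans (solve 5 (λ f₀ f₁ c a b → :- f₁ :- (:- f₀ :+ c) := (:- (b :- a) :+ (f₀ :+ con 1ℚ) :+ b) :- ((con 1ℚ :+ c) :+ a :+ f₁)) refl ⟦ F₀ ⟧ ⟦ F₁ ⟧ (ι (crossings n)) a b)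
          (cong (λ x → (- (b - a) + (⟦ F₀ ⟧ + 1ℚ) + b) - (x + a + ⟦ F₁ ⟧)) (sym (ι-gap n))))))
      (ℚ.≤-reflexive (sym (⟦⟧-neg F₁))))

-- `C` bounds the drift before an exit at Y. With E = Y / `span` the step bound gives 2η = D / E, so
-- Y · 2η ≤ r for every Y, while η shrinks as Y grows. Hence `K` is fixed before `E₀`, which only
-- has to ensure 2η ≤ 1 / 2 and K · 2η ≤ ε. The 2n + 1 in `span` makes room for the nodes of
-- `step-bound`; `r₁` is twice `span` because E is rounded down.
module Run (n : ℕ) {ε : ℚ} (0<ε : 0ℚ <ℚ ε) where

  span = suc (2 ℕ.* n)
  r₁   = ι (span ℕ.+ span)
  C    = ι (gap n) + 1ℚ
  κ    = interpolationConstant n r₁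
  D    = κ * ((C + C) + (C + C))
  r    = r₁ * D
  K    = interpolationConstant (suc n) r

  0≤r₁ : 0ℚ ≤ℚ r₁
  0≤r₁ = 0≤ι (span ℕ.+ span)

  0≤C : 0ℚ ≤ℚ C
  0≤C = 0≤+ (0≤ι (gap n)) (ℚ.<⇒≤ (ℚ.positive⁻¹ 1ℚ))

  0≤D : 0ℚ ≤ℚ D
  0≤D = 0≤* (interpolationConstant-≥0 n 0≤r₁) (0≤+ (0≤+ 0≤C 0≤C) (0≤+ 0≤C 0≤C))

  0≤r : 0ℚ ≤ℚ r
  0≤r = 0≤* 0≤r₁ 0≤D

  0≤K : 0ℚ ≤ℚ K
  0≤K = interpolationConstant-≥0 (suc n) 0≤r

  opaque

    enough : ∃[ E₀ ] 1 ≤ E₀ × D ≤ℚ ι E₀ * ℚ.½ × K * D ≤ℚ ι E₀ * ε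
    enough =
      let a , 1≤a , h = small D (ℚ.positive⁻¹ ℚ.½) 0≤D
          b , _ , k   = small (K * D) 0<ε (0≤* 0≤K 0≤D)
      in a ℕ.+ b , ℕ.≤-trans 1≤a (ℕ.m≤m+n a b) ,
         ℚ.≤-trans h (*-monoʳ (ℚ.<⇒≤ (ℚ.positive⁻¹ ℚ.½)) (ι-mono-≤ (ℕ.m≤m+n a b))) ,
         ℚ.≤-trans k (*-monoʳ (ℚ.<⇒≤ 0<ε) (ι-mono-≤ (ℕ.m≤n+m b a)))

  E₀ = proj₁ enough
  Y₀ = E₀ ℕ.* span

  module _ {A B} (pA : Poly (suc n) A) (pB : Poly (suc n) B) (N : ℕ) {F G : ℕ → ℤ} {Y} (Y₀≤Y : Y₀ ≤ Y)
    (floorA : Floors (λ y → A N (ι y)) F Y) (floorB : Floors (λ y → B N (ι y)) G Y)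
    {m} (2≤m : 2 ≤ m) (congruent : ∀ y → y ≤ Y → ∃[ z ] F y ≡ G y ℤ.+ z ℤ.* ℤ.+ m)
    (boundA : ∀ y → y ℕ.< Y → ∣ A N (ι y) - A N (ι 0) ∣ ≤ℚ C)
    (boundB : ∀ y → y ℕ.< Y → ∣ B N (ι y) - B N (ι 0) ∣ ≤ℚ C)
    (exit : ι (gap n) <ℚ ∣ A N (ι Y) - A N (ι 0) ∣) where

    E = Y ℕ./ span

    E₀≤E : E₀ ≤ E
    E₀≤E = ℕ.≤-trans (ℕ.≤-reflexive (sym (ℕ.m*n/n≡m E₀ span))) (ℕ./-monoˡ-≤ span Y₀≤Y)

    1≤E : 1 ≤ E
    1≤E = ℕ.≤-trans (proj₁ (proj₂ enough)) E₀≤E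

    inverse = reciprocal (0<ι 1≤E)
    λ₁ = proj₁ inverse

    0≤λ : 0ℚ ≤ℚ λ₁
    0≤λ = ℚ.<⇒≤ (proj₁ (proj₂ inverse))

    Eλ≡1 : ι E * λ₁ ≡ 1ℚ
    Eλ≡1 = proj₂ (proj₂ inverse)

    2nE<Y : 2 ℕ.* n ℕ.* E ℕ.< Y
    2nE<Y = ℕ.<-≤-trans (ℕ.*-monoˡ-< E {{ℕ.>-nonZero 1≤E}} (ℕ.n<1+n (2 ℕ.* n)))
      (ℕ.≤-trans (ℕ.≤-reflexive (ℕ.*-comm span E)) (ℕ.m/n*n≤m Y span))

    Y≤2spanE : Y ≤ (span ℕ.+ span) ℕ.* E
    Y≤2spanE = ℕ.≤-trans (ℕ.≤-reflexive (ℕ.m≡m%n+[m/n]*n Y span))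
      (ℕ.≤-trans (ℕ.+-mono-≤ (ℕ.≤-trans (ℕ.<⇒≤ (ℕ.m%n<n Y span)) (ℕ.m≤m*n span E {{ℕ.>-nonZero 1≤E}})) (ℕ.≤-reflexive (ℕ.*-comm E span)))
        (ℕ.≤-reflexive (sym (ℕ.*-distribʳ-+ E span span))))

    Yλ≤r₁ : ι Y * λ₁ ≤ℚ r₁
    Yλ≤r₁ = ℚ.≤-trans (*-monoʳ 0≤λ (ι-mono-≤ Y≤2spanE))
      (ℚ.≤-reflexive (trans (cong (_* λ₁) (ι-* (span ℕ.+ span) E))
        (trans (ℚ.*-assoc r₁ (ι E) λ₁) (trans (cong (r₁ *_) Eλ≡1) (ℚ.*-identityʳ r₁)))))

    η = κ * (λ₁ * (C + C))

    η+η≡λD : η + η ≡ λ₁ * D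
    η+η≡λD = solve 3 (λ k l c → k :* (l :* c) :+ k :* (l :* c) := l :* (k :* (c :+ c))) refl κ λ₁ (C + C)

    scaled-≤ : ∀ {x y} → 0ℚ ≤ℚ y → x ≤ℚ ι E₀ * y → λ₁ * x ≤ℚ y
    scaled-≤ {x} {y} 0≤y h = ℚ.≤-trans (*-monoˡ 0≤λ (ℚ.≤-trans h (*-monoʳ 0≤y (ι-mono-≤ E₀≤E))))
      (ℚ.≤-reflexive (trans (solve 3 (λ l e y → l :* (e :* y) := (e :* l) :* y) refl λ₁ (ι E) y)
        (trans (cong (_* y) Eλ≡1) (ℚ.*-identityˡ y))))

    η+η≤½ : η + η ≤ℚ ℚ.½
    η+η≤½ = ℚ.≤-trans (ℚ.≤-reflexive η+η≡λD) (scaled-≤ (ℚ.<⇒≤ (ℚ.positive⁻¹ ℚ.½)) (proj₁ (proj₂ (proj₂ enough))))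

    Kη≤ε : K * (η + η) ≤ℚ ε
    Kη≤ε = ℚ.≤-trans (ℚ.≤-reflexive (trans (cong (K *_) η+η≡λD) (solve 3 (λ k l d → k :* (l :* d) := l :* (k :* d)) refl K λ₁ D)))
      (scaled-≤ (ℚ.<⇒≤ 0<ε) (proj₂ (proj₂ (proj₂ enough))))

    Yη≤r : ι Y * (η + η) ≤ℚ r
    Yη≤r = ℚ.≤-trans (ℚ.≤-reflexive (trans (cong (ι Y *_) η+η≡λD) (sym (ℚ.*-assoc (ι Y) λ₁ D)))) (*-monoʳ 0≤D Yλ≤r₁)

    0≤η : 0ℚ ≤ℚ η
    0≤η = 0≤* (interpolationConstant-≥0 n 0≤r₁) (0≤* 0≤λ (0≤+ 0≤C 0≤C))

    steps : ∀ {H} → Poly (suc n) H → (∀ y → y ℕ.< Y → ∣ H N (ι y) - H N (ι 0) ∣ ≤ℚ C) →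
      ∀ y → y ℕ.< Y → ∣ H N (ι (suc y)) - H N (ι y) ∣ ≤ℚ η
    steps {H} pH bound y y<Y = ℚ.≤-trans
      (ℚ.≤-reflexive (cong ∣_∣ (solve 3 (λ a b c → a :- b := a :- c :- (b :- c)) refl (H N (ι (suc y))) (H N (ι y)) (H N (ι 0)))))
      -- The drift is bounded only before Y, but the estimate also covers the step that leads into
      -- Y.
      (step-bound {n} {λ M x → H M x - H N (ι 0)} (Poly-- pH (Poly-const (fromℚ (H N (ι 0))))) N E Y
        0≤λ 0≤r₁ 0≤C Eλ≡1 Yλ≤r₁ 2nE<Y bound y y<Y)

    near-integer-combination : ∃[ d ] ∃[ e ] ∃[ γ ] ∣ d ◀ A N (ι 0) - e ◀ B N (ι 0) - ⟦ γ ⟧ ∣ ≤ℚ ε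
    near-integer-combination =
      let d , far = exceeds n (proj₁ (floorA 0 z≤n)) (proj₂ (floorA 0 z≤n)) (proj₁ (floorA Y ℕ.≤-refl)) (proj₂ (floorA Y ℕ.≤-refl)) exit
          e , γ , h = Core.theorem pA pB N {F} {G} {Y} floorA floorB 2≤m congruent 0≤η η+η≤½ (steps pA boundA) (steps pB boundB) 0≤r Yη≤r d far
      in d , e , γ , ℚ.≤-trans h Kη≤ε

-- Limits of rational sequences

Eventually : (ℕ → Set) → Set
Eventually P = ∃[ N₀ ] ∀ N → N₀ ≤ N → P N

eventually-map : ∀ {P Q : ℕ → Set} → (∀ N → P N → Q N) → Eventually P → Eventually Q
eventually-map f (N₀ , h) = N₀ , λ N N₀≤N → f N (h N N₀≤N)

eventually-× : ∀ {P Q : ℕ → Set} → Eventually P → Eventually Q → Eventually (λ N → P N × Q N)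
eventually-× (M , h) (N , k) = M ℕ.⊔ N , λ L M⊔N≤L → h L (ℕ.m⊔n≤o⇒m≤o M N M⊔N≤L) , k L (ℕ.m⊔n≤o⇒n≤o M N M⊔N≤L)

eventually-< : ∀ {P : ℕ → ℕ → Set} Y → (∀ y → y ℕ.< Y → Eventually (P y)) → Eventually (λ N → ∀ y → y ℕ.< Y → P y N)
eventually-< zero h = 0 , λ _ _ _ ()
eventually-< {P} (suc Y) h = eventually-map (λ { N (k , l) y y<1+Y → choose N k l y (ℕ.m≤n⇒m<n∨m≡n (ℕ.≤-pred y<1+Y)) })
    (eventually-× (eventually-< Y (λ y y<Y → h y (ℕ.m<n⇒m<1+n y<Y))) (h Y (ℕ.n<1+n Y)))
  where
  choose : ∀ N → (∀ y → y ℕ.< Y → P y N) → P Y N → ∀ y → y ℕ.< Y ⊎ y ≡ Y → P y N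
  choose N k l y (inj₁ y<Y) = k y y<Y
  choose N k l y (inj₂ refl) = l

eventually-Fin : ∀ {n} {P : Fin n → ℕ → Set} → (∀ i → Eventually (P i)) → Eventually (λ N → ∀ i → P i N)
eventually-Fin {zero} h = 0 , λ _ _ ()
eventually-Fin {suc n} {P} h = eventually-map (λ { N (k , l) Fin.zero → k ; N (k , l) (Fin.suc i) → l i })
  (eventually-× (h Fin.zero) (eventually-Fin (λ i → h (Fin.suc i))))

eventually-witness : ∀ {P : ℕ → Set} N₁ → Eventually P → ∃[ N ] N₁ ≤ N × P N
eventually-witness N₁ (N₀ , h) = N₁ ℕ.⊔ N₀ , ℕ.m≤m⊔n N₁ N₀ , h (N₁ ℕ.⊔ N₀) (ℕ.m≤n⊔m N₁ N₀)

infix 4 _⟶_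

record _⟶_ (r : ℕ → ℚ) (ρ : ℚ) : Set where
  constructor limit
  field
    eventually : ∀ ε → 0ℚ <ℚ ε → Eventually (λ N → ∣ r N - ρ ∣ ≤ℚ ε)

open _⟶_ public

⟶-const : ∀ ρ → (λ _ → ρ) ⟶ ρ
⟶-const ρ = limit λ ε 0<ε → 0 , λ _ _ → ℚ.≤-trans (ℚ.≤-reflexive (cong ∣_∣ (ℚ.+-inverseʳ ρ))) (ℚ.<⇒≤ 0<ε)

⟶-≗ : ∀ {r s ρ σ} → (∀ N → r N ≡ s N) → ρ ≡ σ → r ⟶ ρ → s ⟶ σ
⟶-≗ {ρ = ρ} e refl h = limit λ ε 0<ε → eventually-map (λ N → subst (λ x → ∣ x - ρ ∣ ≤ℚ ε) (e N)) (eventually h ε 0<ε)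

½*-pos : ∀ {ε} → 0ℚ <ℚ ε → 0ℚ <ℚ ℚ.½ * ε
½*-pos = 0<* (ℚ.positive⁻¹ ℚ.½)

½+½ : ∀ ε → ℚ.½ * ε + ℚ.½ * ε ≡ ε
½+½ = solve 1 (λ ε → con ℚ.½ :* ε :+ con ℚ.½ :* ε := ε) refl

⟶-+ : ∀ {r s ρ σ} → r ⟶ ρ → s ⟶ σ → (λ N → r N + s N) ⟶ ρ + σ
⟶-+ {r} {s} {ρ} {σ} h k = limit λ ε 0<ε → eventually-map
  (λ { N (p , q) → ℚ.≤-trans
    (ℚ.≤-reflexive (cong ∣_∣ (solve 4 (λ r s ρ σ → r :+ s :- (ρ :+ σ) := (r :- ρ) :+ (s :- σ)) refl (r N) (s N) ρ σ)))
    (ℚ.≤-trans (∣+∣≤ {r N - ρ} {s N - σ} p q) (ℚ.≤-reflexive (½+½ ε))) })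
  (eventually-× (eventually h (ℚ.½ * ε) (½*-pos 0<ε)) (eventually k (ℚ.½ * ε) (½*-pos 0<ε)))

⟶-scale : ∀ {r ρ} c → r ⟶ ρ → (λ N → c * r N) ⟶ c * ρ
⟶-scale {r} {ρ} c h = limit λ ε 0<ε →
  let n , 1≤n , ∣c∣≤n = archimedean ∣ c ∣
      i , 0<i , ni≡1 = reciprocal (0<ι 1≤n)
  in eventually-map (λ N p → ℚ.≤-trans
       (ℚ.≤-reflexive (cong ∣_∣ (solve 3 (λ c r ρ → c :* r :- c :* ρ := c :* (r :- ρ)) refl c (r N) ρ)))
       (ℚ.≤-trans (∣*∣≤ {c} {r N - ρ} ∣c∣≤n p)
         (ℚ.≤-reflexive (trans (sym (ℚ.*-assoc (ι n) i ε)) (trans (cong (_* ε) ni≡1) (ℚ.*-identityˡ ε))))))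
     (eventually h (i * ε) (0<* 0<i 0<ε))

⟶-neg : ∀ {r ρ} → r ⟶ ρ → (λ N → - r N) ⟶ - ρ
⟶-neg {r} {ρ} h = limit λ ε 0<ε → eventually-map (λ N p → ℚ.≤-trans
  (ℚ.≤-reflexive (trans (cong ∣_∣ (solve 2 (λ r ρ → :- r :- (:- ρ) := :- (r :- ρ)) refl (r N) ρ)) (ℚ.∣-p∣≡∣p∣ (r N - ρ)))) p) (eventually h ε 0<ε)

⟶-- : ∀ {r s ρ σ} → r ⟶ ρ → s ⟶ σ → (λ N → r N - s N) ⟶ ρ - σ
⟶-- h k = ⟶-+ h (⟶-neg k)

∣∣≤ε⇒≡0 : ∀ {p} → (∀ ε → 0ℚ <ℚ ε → ∣ p ∣ ≤ℚ ε) → p ≡ 0ℚ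
∣∣≤ε⇒≡0 {p} h = ℚ.∣p∣≡0⇒p≡0 p (ℚ.≤-antisym (ℚ.≮⇒≥ λ 0<∣p∣ →
  let ε , 0<ε , ε<∣p∣ = ℚ.<-dense 0<∣p∣ in ℚ.<-irrefl refl (ℚ.≤-<-trans (h ε 0<ε) ε<∣p∣)) (ℚ.0≤∣p∣ p))

⟶-unique : ∀ {r ρ σ} → r ⟶ ρ → r ⟶ σ → ρ ≡ σ
⟶-unique {r} {ρ} {σ} h k = trans (solve 2 (λ ρ σ → ρ := (ρ :- σ) :+ σ) refl ρ σ)
  (trans (cong (_+ σ) (∣∣≤ε⇒≡0 λ ε 0<ε →
    let N , h′ = eventually (⟶-+ (⟶-neg h) k) ε 0<ε
    in ℚ.≤-trans (ℚ.≤-reflexive (cong ∣_∣ (solve 3 (λ ρ σ r → ρ :- σ := (:- r :+ r) :- (:- ρ :+ σ)) refl ρ σ (r N)))) (h′ N ℕ.≤-refl)))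
    (ℚ.+-identityˡ σ))

cauchy-≗ : ∀ {r s : ℕ → ℚ} → (∀ N → r N ≡ s N) → IsCauchy r → IsCauchy s
cauchy-≗ e h ε 0<ε = let N , k = h ε 0<ε in N , λ m n p q → subst₂ (λ x y → ∣ x - y ∣ <ℚ ε) (e m) (e n) (k m n p q)

cauchy-+ : ∀ {r s} → IsCauchy r → IsCauchy s → IsCauchy (λ N → r N + s N)
cauchy-+ {r} {s} h k = cauchy (mkℝ r h +ᴿ mkℝ s k)

cauchy-scale : ∀ {r} c → IsCauchy r → IsCauchy (λ N → c * r N)
cauchy-scale {r} c h = cauchy (fromℚ c *ᴿ mkℝ r h)

cauchy-const : ∀ c → IsCauchy (λ _ → c)
cauchy-const c = cauchy (fromℚ c)

Poly-cauchy : ∀ {n F} → Poly n F → ∀ x → IsCauchy (λ N → F N x)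
Poly-cauchy {F = F} (nil f) x = cauchy-≗ {λ _ → 0ℚ} {λ N → F N x} (λ N → sym (f N x)) (cauchy-const 0ℚ)
Poly-cauchy {F = F} (cons {G = G} c pG f) x = cauchy-≗ {λ N → seq c N + x * G N x} {λ N → F N x} (λ N → sym (f N x))
  (cauchy-+ {seq c} {λ N → x * G N x} (cauchy c) (cauchy-scale {λ N → G N x} x (Poly-cauchy pG x)))

Poly-≤ : ∀ {m n F} → m ≤ n → Poly m F → Poly n F
Poly-≤ {n = zero} z≤n p = p
Poly-≤ {zero} {suc n} z≤n p = Poly-suc (Poly-≤ {zero} {n} z≤n p)
Poly-≤ (s≤s m≤n) (cons c pG f) = cons c (Poly-≤ m≤n pG) f

-- This is x ^ (i + 1), as only non-constant terms are approximated.
power : ℚ → ℕ → ℚ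
power x zero    = x
power x (suc i) = x * power x i

Poly-power : ∀ i c → Poly (suc (suc i)) (λ N x → seq c N * power x i)
Poly-power zero c = Poly-ext (λ N x → ℚ.*-comm (seq c N) x) (Poly-x* (Poly-const c))
Poly-power (suc i) c = Poly-ext (λ N x → solve 3 (λ c x p → c :* (x :* p) := x :* (c :* p)) refl (seq c N) x (power x i))
  (Poly-x* (Poly-power i c))

coefficient : ∀ {n F} → Poly n F → Fin n → ℝ
coefficient (cons c pG f) Fin.zero    = c
coefficient (cons c pG f) (Fin.suc j) = coefficient pG j

horner : ∀ n → (Fin n → ℤ) → ℕ → ℤ
horner zero    z y = ℤ.0ℤ
horner (suc n) z y = z Fin.zero ℤ.+ ℤ.+ y ℤ.* horner n (λ j → z (Fin.suc j)) y

hornerℚ : ∀ n → (Fin n → ℤ) → ℚ → ℚ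
hornerℚ zero    z x = 0ℚ
hornerℚ (suc n) z x = ⟦ z Fin.zero ⟧ + x * hornerℚ n (λ j → z (Fin.suc j)) x

hornerℚ-ι : ∀ n z y → hornerℚ n z (ι y) ≡ ⟦ horner n z y ⟧
hornerℚ-ι zero    z y = sym ⟦0⟧
hornerℚ-ι (suc n) z y = sym (trans (⟦⟧-+ (z Fin.zero) _) (cong (⟦ z Fin.zero ⟧ +_)
  (trans (⟦⟧-* (ℤ.+ y) _) (cong (ι y *_) (sym (hornerℚ-ι n (λ j → z (Fin.suc j)) y))))))

Poly-horner : ∀ n z → Poly n (λ _ x → hornerℚ n z x)
Poly-horner zero    z = nil λ _ _ → refl
Poly-horner (suc n) z = cons (fromℚ ⟦ z Fin.zero ⟧) (Poly-horner n (λ j → z (Fin.suc j))) λ _ _ → refl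

-- The sum 1 + y + ... + y ^ (n - 1), by which errors in the coefficients are amplified.
growth : ℕ → ℕ → ℕ
growth zero    y = 0
growth (suc n) y = suc (y ℕ.* growth n y)

growth-mono : ∀ n {x y} → x ≤ y → growth n x ≤ growth n y
growth-mono zero    x≤y = z≤n
growth-mono (suc n) x≤y = s≤s (ℕ.*-mono-≤ x≤y (growth-mono n x≤y))

-- Substituting k y for the argument multiplies the j-th coefficient by k ^ j; `i` keeps track of
-- the powers of k already absorbed while Horner's scheme is unfolded.
lift : ∀ {n G} (p : Poly n G) i k N m (z : Fin n → ℤ) {δ} →
  (∀ j → ∣ seq (coefficient p j) N * power k (i ℕ.+ toℕ j) - ⟦ z j ⟧ * m ∣ ≤ℚ δ) →
  ∀ y → ∣ power k i * G N (k * ι y) - hornerℚ n z (ι y) * m ∣ ≤ℚ δ * ι (growth n y)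
lift (nil {G} g) i k N m z {δ} h y = ℚ.≤-reflexive (trans
  (cong (λ t → ∣ power k i * t - 0ℚ * m ∣) (g N (k * ι y)))
  (trans (cong ∣_∣ (solve 2 (λ p m → p :* con 0ℚ :- con 0ℚ :* m := con 0ℚ) refl (power k i) m))
    (sym (trans (cong (δ *_) ⟦0⟧) (ℚ.*-zeroʳ δ)))))
lift {suc n} (cons {G = G} c pG f) i k N m z {δ} h y = ℚ.≤-trans
  (ℚ.≤-reflexive (cong ∣_∣ (trans (cong (λ t → power k i * t - (⟦ z Fin.zero ⟧ + ι y * T) * m) (f N (k * ι y)))
    (solve 8 (λ p c k y g z t m → p :* (c :+ (k :* y) :* g) :- (z :+ y :* t) :* m := (c :* p :- z :* m) :+ y :* ((k :* p) :* g :- t :* m)) refl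
      (power k i) (seq c N) k (ι y) (G N (k * ι y)) ⟦ z Fin.zero ⟧ T m))))
  (ℚ.≤-trans (∣+∣≤ {seq c N * power k i - ⟦ z Fin.zero ⟧ * m}
      (subst (λ t → ∣ seq c N * power k t - ⟦ z Fin.zero ⟧ * m ∣ ≤ℚ δ) (ℕ.+-identityʳ i) (h Fin.zero))
      (∣*∣≤ {ι y} {power k (suc i) * G N (k * ι y) - T * m} (ℚ.≤-reflexive (ℚ.0≤p⇒∣p∣≡p (0≤ι y)))
        (lift pG (suc i) k N m (λ j → z (Fin.suc j))
          (λ j → subst (λ t → ∣ seq (coefficient pG j) N * power k t - ⟦ z (Fin.suc j) ⟧ * m ∣ ≤ℚ δ) (ℕ.+-suc i (toℕ j)) (h (Fin.suc j))) y)))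
    (ℚ.≤-reflexive (trans (solve 3 (λ δ y g → δ :+ y :* (δ :* g) := δ :* (con 1ℚ :+ y :* g)) refl δ (ι y) (ι (growth n y)))
      (cong (δ *_) (trans (cong (1ℚ +_) (sym (ι-* y (growth n y)))) (sym (ι-suc (y ℕ.* growth n y))))))))
  where T = hornerℚ n (λ j → z (Fin.suc j)) (ι y)

power-mono : ∀ i {x y} → 0ℚ ≤ℚ x → x ≤ℚ y → 0ℚ ≤ℚ power x i × power x i ≤ℚ power y i
power-mono zero    0≤x x≤y = 0≤x , x≤y
power-mono (suc i) 0≤x x≤y = let 0≤p , p≤q = power-mono i 0≤x x≤y in
  0≤* 0≤x 0≤p , *-mono-≤ 0≤x (ℚ.≤-trans 0≤p p≤q) x≤y p≤q

power-0 : ∀ i → power 0ℚ i ≡ 0ℚ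
power-0 zero    = refl
power-0 (suc i) = ℚ.*-zeroˡ (power 0ℚ i)

divide-by : ∀ {ε} p → 0ℚ <ℚ ε → 0ℚ ≤ℚ p → ∃[ δ ] 0ℚ <ℚ δ × δ * p ≤ℚ ε
divide-by {ε} p 0<ε 0≤p =
  let r , 0<r , e = reciprocal {1ℚ + p} (ℚ.<-≤-trans (ℚ.positive⁻¹ 1ℚ) (≤-by 0≤p (solve 1 (λ p → con 1ℚ :+ p :- con 1ℚ := p :- con 0ℚ) refl p)))
  in ε * r , 0<* 0<ε 0<r ,
     ≤-by (0≤* (ℚ.<⇒≤ 0<ε) (ℚ.<⇒≤ 0<r))
       (trans (solve 3 (λ ε r p → ε :- (ε :* r) :* p := ε :* r :- con 0ℚ :+ ε :* (con 1ℚ :- (con 1ℚ :+ p) :* r)) refl ε r p)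
         (trans (cong (λ t → ε * r - 0ℚ + ε * (1ℚ - t)) e) (solve 2 (λ ε r → ε :* r :- con 0ℚ :+ ε :* (con 1ℚ :- con 1ℚ) := ε :* r :- con 0ℚ) refl ε r)))

opaque

  cauchy-times : ∀ {r : ℕ → ℚ} {ε} p → IsCauchy r → 0ℚ <ℚ ε → 0ℚ ≤ℚ p →
    Eventually (λ N₁ → ∀ N → N₁ ≤ N → ∣ r N - r N₁ ∣ * p ≤ℚ ε)
  cauchy-times {r} {ε} p h 0<ε 0≤p =
    let δ , 0<δ , δp≤ε = divide-by p 0<ε 0≤p
        N₀ , k = h δ 0<δ
    in N₀ , λ N₁ N₀≤N₁ N N₁≤N → ℚ.≤-trans (*-monoʳ 0≤p (ℚ.<⇒≤ (k N N₁ (ℕ.≤-trans N₀≤N₁ N₁≤N) N₀≤N₁))) δp≤ε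

  -- Order of the choices: first a bound `Bd` for the recurrence time, then an index N₁ after which
  -- the coefficients, even multiplied by their powers of `Bd`, move by at most δ / 2, and only then
  -- k ≤ `Bd` for the N₁-th approximations. Dividing by m turns closeness to multiples of m into
  -- closeness to integers.
  simultaneous : ∀ n s {m} → 1 ≤ m → ∀ {δ} → 0ℚ <ℚ δ → (c : Fin s → ℝ) (e : Fin s → ℕ) → (∀ i → e i ℕ.< n) →
    ∃[ k ] 1 ≤ k × Σ[ z ∈ (Fin s → ℤ) ] Eventually (λ N → ∀ i → ∣ seq (c i) N * power (ι k) (e i) - ⟦ z i ⟧ * ι m ∣ ≤ℚ δ)
  simultaneous n s {m} 1≤m {δ} 0<δ c e e<n =
    let N₁ , settled = eventually-Fin {P = λ i N₁ → ∀ N → N₁ ≤ N → ∣ seq (c i) N - seq (c i) N₁ ∣ * power (ι Bd) (e i) ≤ℚ ℚ.½ * δ}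
          (λ i → cauchy-times {seq (c i)} (power (ι Bd) (e i)) (cauchy (c i)) (½*-pos 0<δ) (proj₁ (power-mono (e i) (0≤ι Bd) ℚ.≤-refl)))
        k , 1≤k , k≤Bd , close = proj₂ recurrence-bound (f N₁) (f-poly N₁) (f-0 N₁)
    in k , 1≤k , (λ i → integer (close i)) , N₁ , λ N N₁≤N i → ℚ.≤-trans
      (∣-∣-trans {seq (c i) N * power (ι k) (e i)} {⟦ integer (close i) ⟧ * ι m} (seq (c i) N₁ * power (ι k) (e i))
        (ℚ.≤-trans (ℚ.≤-reflexive (trans (cong ∣_∣ (solve 3 (λ a b p → a :* p :- b :* p := (a :- b) :* p) refl (seq (c i) N) (seq (c i) N₁) (power (ι k) (e i))))
            (trans (ℚ.∣p*q∣≡∣p∣*∣q∣ (seq (c i) N - seq (c i) N₁) (power (ι k) (e i)))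
              (cong (∣ seq (c i) N - seq (c i) N₁ ∣ *_) (ℚ.0≤p⇒∣p∣≡p (proj₁ (power-mono (e i) (0≤ι k) ℚ.≤-refl)))))))
          (ℚ.≤-trans (*-monoˡ (ℚ.0≤∣p∣ (seq (c i) N - seq (c i) N₁)) (proj₂ (power-mono (e i) (0≤ι k) (ι-mono-≤ k≤Bd)))) (settled N₁ ℕ.≤-refl i N N₁≤N)))
        (ℚ.≤-trans (ℚ.≤-reflexive (unscale (seq (c i) N₁ * power (ι k) (e i)) ⟦ integer (close i) ⟧))
          (ℚ.≤-trans (*-monoˡ (0≤ι m) (distance (close i))) (ℚ.≤-reflexive m*δ″))))
      (ℚ.≤-reflexive (½+½ δ))
    where
    inverse : ∃[ r ] 0ℚ <ℚ r × ι m * r ≡ 1ℚ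
    inverse = reciprocal (0<ι 1≤m)
    i₁ : ℚ
    i₁ = proj₁ inverse
    mi≡1 : ι m * i₁ ≡ 1ℚ
    mi≡1 = proj₂ (proj₂ inverse)
    δ″ : ℚ
    δ″ = i₁ * (ℚ.½ * δ)
    m*δ″ : ι m * δ″ ≡ ℚ.½ * δ
    m*δ″ = trans (sym (ℚ.*-assoc (ι m) i₁ (ℚ.½ * δ))) (trans (cong (_* (ℚ.½ * δ)) mi≡1) (ℚ.*-identityˡ (ℚ.½ * δ)))
    recurrence-bound : ∃[ B ] ∀ (f : Fin s → ℚ → ℚ) → (∀ i → Poly (suc n) (λ _ → f i)) → (∀ i → f i 0ℚ ≡ 0ℚ) →
      ∃[ x ] 1 ≤ x × x ≤ B × ∀ i → NearInteger (f i (ι x)) δ″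
    recurrence-bound = recurrence n s (0<* (proj₁ (proj₂ inverse)) (½*-pos 0<δ))
    Bd : ℕ
    Bd = proj₁ recurrence-bound
    f : ℕ → Fin s → ℚ → ℚ
    f N i x = i₁ * (seq (c i) N * power x (e i))
    f-poly : ∀ N i → Poly (suc n) (λ _ → f N i)
    f-poly N i = Poly-scale i₁ (Poly-≤ (s≤s (e<n i)) (Poly-fix N (Poly-power (e i) (c i))))
    f-0 : ∀ N i → f N i 0ℚ ≡ 0ℚ
    f-0 N i = trans (cong (λ t → i₁ * (seq (c i) N * t)) (power-0 (e i))) (solve 2 (λ a b → a :* (b :* con 0ℚ) := con 0ℚ) refl i₁ (seq (c i) N))
    unscale : ∀ x z → ∣ x - z * ι m ∣ ≡ ι m * ∣ i₁ * x - z ∣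
    unscale x z = trans (cong ∣_∣ (trans (solve 2 (λ x t → x :- t := con 1ℚ :* x :- t) refl x (z * ι m))
        (trans (cong (λ t → t * x - z * ι m) (sym mi≡1)) (solve 4 (λ m i x z → (m :* i) :* x :- z :* m := m :* (i :* x :- z)) refl (ι m) i₁ x z))))
      (trans (ℚ.∣p*q∣≡∣p∣*∣q∣ (ι m) (i₁ * x - z)) (cong (_* ∣ i₁ * x - z ∣) (ℚ.0≤p⇒∣p∣≡p (0≤ι m))))

  -- P and Q may overlap; the exit is the first index below `y` at which `choice` answers P, and `y`
  -- itself otherwise.
  first-exit : ∀ {P Q : ℕ → Set} → (∀ y → P y ⊎ Q y) → ∀ y → P y → ∃[ Y ] P Y × (∀ x → x ℕ.< Y → Q x)
  first-exit {P} {Q} choice y py = stop (search y)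
    where
    search : ∀ k → (∃[ Y ] P Y × (∀ x → x ℕ.< Y → Q x)) ⊎ (∀ x → x ℕ.< k → Q x)
    search zero = inj₂ λ _ ()
    search (suc k) with search k | choice k
    ... | inj₁ found | _      = inj₁ found
    ... | inj₂ below | inj₁ p = inj₁ (k , p , below)
    ... | inj₂ below | inj₂ q = inj₂ λ x x<1+k → extend x (ℕ.m≤n⇒m<n∨m≡n (ℕ.≤-pred x<1+k))
      where
      extend : ∀ x → x ℕ.< k ⊎ x ≡ k → Q x
      extend x (inj₁ x<k) = below x x<k
      extend x (inj₂ refl) = q
    stop : (∃[ Y ] P Y × (∀ x → x ℕ.< Y → Q x)) ⊎ (∀ x → x ℕ.< y → Q x) → ∃[ Y ] P Y × (∀ x → x ℕ.< Y → Q x)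
    stop (inj₁ found) = found
    stop (inj₂ below) = y , py , below

  -- The order of Cauchy reals is not decidable, but with a slack of 1 an approximation accurate to
  -- 1 / 2 decides. The slack is the 1 in `Run.C`.
  large-or-bounded : ∀ {r : ℕ → ℚ} C → IsCauchy r → Eventually (λ N → C <ℚ ∣ r N ∣) ⊎ Eventually (λ N → ∣ r N ∣ ≤ℚ C + 1ℚ)
  large-or-bounded {r} C h with h ℚ.½ (ℚ.positive⁻¹ ℚ.½)
  ... | N₀ , k with ∣ r N₀ ∣ ℚ.≤? C + ℚ.½
  ... | yes small = inj₂ (N₀ , λ N N₀≤N → ℚ.≤-trans (ℚ.≤-reflexive (cong ∣_∣ (solve 2 (λ a b → a := (a :- b) :+ b) refl (r N) (r N₀))))
          (ℚ.≤-trans (∣+∣≤ {r N - r N₀} {r N₀} (ℚ.<⇒≤ (k N N₀ N₀≤N ℕ.≤-refl)) small)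
            (ℚ.≤-reflexive (solve 1 (λ C → con ℚ.½ :+ (C :+ con ℚ.½) := C :+ con 1ℚ) refl C))))
  ... | no large = inj₁ (N₀ , λ N N₀≤N → <-by (ℚ.<-≤-trans (ℚ.≰⇒> large)
          (ℚ.≤-trans (ℚ.≤-reflexive (cong ∣_∣ (solve 2 (λ a b → a := (a :- b) :+ b) refl (r N₀) (r N))))
            (∣+∣≤ {r N₀ - r N} {r N} (ℚ.<⇒≤ (k N₀ N ℕ.≤-refl N₀≤N)) ℚ.≤-refl)))
        (solve 2 (λ C a → a :- C := (con ℚ.½ :+ a) :- (C :+ con ℚ.½)) refl C ∣ r N ∣))

smaller : ∀ {p q} → 0ℚ <ℚ p → 0ℚ <ℚ q → ∃[ η ] 0ℚ <ℚ η × η ≤ℚ p × η ≤ℚ q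
smaller {p} {q} 0<p 0<q with ℚ.≤-total p q
... | inj₁ p≤q = p , 0<p , ℚ.≤-refl , p≤q
... | inj₂ q≤p = q , 0<q , q≤p , ℚ.≤-refl

-- The limit lies in [z, z + 1), while the approximations may not: the closed end is stated up to
-- every η, the open end with a fixed margin.
record FloorLimit (r : ℕ → ℚ) (z : ℤ) : Set where
  field
    below : ∀ η → 0ℚ <ℚ η → Eventually (λ N → ⟦ z ⟧ ≤ℚ r N + η)
    above : ∃[ η ] 0ℚ <ℚ η × Eventually (λ N → r N + η <ℚ ⟦ z ⟧ + 1ℚ)

open FloorLimit public

-- A small upward shift turns the N-th approximations, for large N, into numbers with exactly the floors of the limits.
Shiftable : (ℕ → ℚ → Set) → Set
Shiftable P = ∃[ η₀ ] 0ℚ <ℚ η₀ × (∀ η → 0ℚ <ℚ η → η ≤ℚ η₀ → Eventually (λ N → P N η))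

shiftable-× : ∀ {P Q : ℕ → ℚ → Set} → Shiftable P → Shiftable Q → Shiftable (λ N η → P N η × Q N η)
shiftable-× (η , 0<η , h) (ζ , 0<ζ , k) =
  let ξ , 0<ξ , ξ≤η , ξ≤ζ = smaller 0<η 0<ζ
  in ξ , 0<ξ , λ x 0<x x≤ξ → eventually-× (h x 0<x (ℚ.≤-trans x≤ξ ξ≤η)) (k x 0<x (ℚ.≤-trans x≤ξ ξ≤ζ))

FloorAt : (ℕ → ℚ) → ℤ → ℕ → ℚ → Set
FloorAt r z N η = ⟦ z ⟧ ≤ℚ r N + η × r N + η <ℚ ⟦ z ⟧ + 1ℚ

floor-shiftable : ∀ {r z} → FloorLimit r z → Shiftable (FloorAt r z)
floor-shiftable {r} h = let η₀ , 0<η₀ , upper = above h in η₀ , 0<η₀ , λ η 0<η η≤η₀ →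
  eventually-× (below h η 0<η) (eventually-map (λ N k → ℚ.≤-<-trans (ℚ.+-monoʳ-≤ (r N) η≤η₀) k) upper)

shiftable-< : ∀ Y {P : ℕ → ℕ → ℚ → Set} → (∀ y → Shiftable (P y)) → Shiftable (λ N η → ∀ y → y ℕ.< Y → P y N η)
shiftable-< zero h = 1ℚ , ℚ.positive⁻¹ 1ℚ , λ _ _ _ → 0 , λ _ _ _ ()
shiftable-< (suc Y) {P} h =
  let η , 0<η , k = shiftable-× (shiftable-< Y {P} h) (h Y)
  in η , 0<η , λ ζ 0<ζ ζ≤η → eventually-map
       (λ { N (p , q) y y<1+Y → choose N ζ p q y (ℕ.m≤n⇒m<n∨m≡n (ℕ.≤-pred y<1+Y)) }) (k ζ 0<ζ ζ≤η)
  where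
  choose : ∀ N η → (∀ y → y ℕ.< Y → P y N η) → P Y N η → ∀ y → y ℕ.< Y ⊎ y ≡ Y → P y N η
  choose N η p q y (inj₁ y<Y) = p y y<Y
  choose N η p q y (inj₂ refl) = q

-- Drift of a dilated polynomial and its first exit

module Drift (n m k : ℕ) where

  -- The subtracted polynomial has multiples of m as values at the integers (`offset`), so floors
  -- change by multiples of m only; z is chosen to cancel most of F (k x) - F 0.
  drift : (Fin n → ℤ) → (ℕ → ℚ → ℚ) → ℕ → ℚ → ℚ
  drift z F N x = F N (ι k * x) - F N 0ℚ - (x * hornerℚ n z x) * ι m

  offset : (Fin n → ℤ) → ℕ → ℤ
  offset z y = (ℤ.+ y ℤ.* horner n z y) ℤ.* ℤ.+ m

  offset-ℚ : ∀ z y → (ι y * hornerℚ n z (ι y)) * ι m ≡ ⟦ offset z y ⟧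
  offset-ℚ z y = sym (trans (⟦⟧-* (ℤ.+ y ℤ.* horner n z y) (ℤ.+ m))
    (cong (_* ι m) (trans (⟦⟧-* (ℤ.+ y) (horner n z y)) (cong (ι y *_) (sym (hornerℚ-ι n z y))))))

  drift-ι : ∀ z F N y → drift z F N (ι y) ≡ F N (ι (k ℕ.* y)) - F N 0ℚ - ⟦ offset z y ⟧
  drift-ι z F N y = cong₂ (λ s t → F N s - F N 0ℚ - t) (sym (ι-* k y)) (offset-ℚ z y)

  drift-0 : ∀ z F N → drift z F N (ι 0) ≡ 0ℚ
  drift-0 z F N = trans (cong (drift z F N) ⟦0⟧) (trans (cong (λ t → F N t - F N 0ℚ - (0ℚ * hornerℚ n z 0ℚ) * ι m) (ℚ.*-zeroʳ (ι k)))
    (solve 3 (λ a h m → a :- a :- (con 0ℚ :* h) :* m := con 0ℚ) refl (F N 0ℚ) (hornerℚ n z 0ℚ) (ι m)))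

  Poly-drift : ∀ z {F} → Poly (suc n) F → Poly (suc n) (drift z F)
  Poly-drift z {F} p = Poly-ext
    (λ N x → cong₂ (λ s t → F N s - F N 0ℚ - t) (sym (ℚ.+-identityˡ (ι k * x))) (ℚ.*-comm (x * hornerℚ n z x) (ι m)))
    (Poly-- (Poly-- (Poly-affine 0ℚ (ι k) p) (Poly-const (mkℝ (λ N → F N 0ℚ) (Poly-cauchy p 0ℚ))))
      (Poly-scale (ι m) (Poly-x* (Poly-horner n z))))

opaque

  -- One k has to serve both A and B, so their 2n non-constant coefficients are approximated as one
  -- family. The tolerance makes the errors, amplified by y · growth n y, at most 1 up to Y₀.
  slow-drift : ∀ {n A B m} → Poly (suc n) A → Poly (suc n) B → 1 ≤ m → ∀ Y₀ →
    ∃[ k ] 1 ≤ k × Σ[ z ∈ (Fin n → ℤ) ] Σ[ w ∈ (Fin n → ℤ) ] Eventually (λ N → ∀ y → y ≤ Y₀ →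
      ∣ Drift.drift n m k z A N (ι y) ∣ ≤ℚ 1ℚ × ∣ Drift.drift n m k w B N (ι y) ∣ ≤ℚ 1ℚ)
  slow-drift {n} {A} {B} {m} pA pB 1≤m Y₀ with Poly-divide pA 0ℚ | Poly-divide pB 0ℚ
  ... | G , pG , dividesA | H , pH , dividesB =
    let δ , 0<δ , small-δ = divide-by (ι (Y₀ ℕ.* growth n Y₀)) (ℚ.positive⁻¹ 1ℚ) (0≤ι (Y₀ ℕ.* growth n Y₀))
        k , 1≤k , z , N₁ , close = simultaneous n (n ℕ.+ n) 1≤m 0<δ (λ i → coefs (Fin.splitAt n i)) (λ i → exponent (Fin.splitAt n i))
          (λ i → exponent<n (Fin.splitAt n i))
    in k , 1≤k , (λ j → z (j Fin.↑ˡ n)) , (λ j → z (n Fin.↑ʳ j)) , N₁ , λ N N₁≤N y y≤Y₀ →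
       bound {δ} {A} {G} k N (ℚ.<⇒≤ 0<δ) small-δ pG (dividesA N) (λ j → z (j Fin.↑ˡ n))
         (λ j → subst (λ s → ∣ seq (coefs s) N * power (ι k) (exponent s) - ⟦ z (j Fin.↑ˡ n) ⟧ * ι m ∣ ≤ℚ δ) (Fin.splitAt-↑ˡ n j n) (close N N₁≤N (j Fin.↑ˡ n))) y y≤Y₀ ,
       bound {δ} {B} {H} k N (ℚ.<⇒≤ 0<δ) small-δ pH (dividesB N) (λ j → z (n Fin.↑ʳ j))
         (λ j → subst (λ s → ∣ seq (coefs s) N * power (ι k) (exponent s) - ⟦ z (n Fin.↑ʳ j) ⟧ * ι m ∣ ≤ℚ δ) (Fin.splitAt-↑ʳ n n j) (close N N₁≤N (n Fin.↑ʳ j))) y y≤Y₀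
    where
    coefs : Fin n ⊎ Fin n → ℝ
    coefs (inj₁ j) = coefficient pG j
    coefs (inj₂ j) = coefficient pH j
    exponent : Fin n ⊎ Fin n → ℕ
    exponent (inj₁ j) = toℕ j
    exponent (inj₂ j) = toℕ j
    exponent<n : ∀ s → exponent s ℕ.< n
    exponent<n (inj₁ j) = Fin.toℕ<n j
    exponent<n (inj₂ j) = Fin.toℕ<n j
    bound : ∀ {δ F G} k N → 0ℚ ≤ℚ δ → δ * ι (Y₀ ℕ.* growth n Y₀) ≤ℚ 1ℚ → (pG : Poly n G) → (∀ x → F N x ≡ F N 0ℚ + (x - 0ℚ) * G N x) →
      ∀ z → (∀ j → ∣ seq (coefficient pG j) N * power (ι k) (toℕ j) - ⟦ z j ⟧ * ι m ∣ ≤ℚ δ) →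
      ∀ y → y ≤ Y₀ → ∣ Drift.drift n m k z F N (ι y) ∣ ≤ℚ 1ℚ
    bound {δ} {F} {G} k N 0≤δ small-δ pG divides z close y y≤Y₀ = ℚ.≤-trans (ℚ.≤-reflexive (cong ∣_∣ value))
      (ℚ.≤-trans (∣*∣≤ {ι y} {power (ι k) 0 * G N (ι k * ι y) - hornerℚ n z (ι y) * ι m} (ℚ.≤-reflexive (ℚ.0≤p⇒∣p∣≡p (0≤ι y)))
          (lift pG 0 (ι k) N (ι m) z close y))
        (ℚ.≤-trans (ℚ.≤-reflexive (trans (solve 3 (λ y δ g → y :* (δ :* g) := δ :* (y :* g)) refl (ι y) δ (ι (growth n y)))
            (cong (δ *_) (sym (ι-* y (growth n y))))))
          (ℚ.≤-trans (*-monoˡ 0≤δ (ι-mono-≤ (ℕ.*-mono-≤ y≤Y₀ (growth-mono n y≤Y₀)))) small-δ)))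
      where
      value : Drift.drift n m k z F N (ι y) ≡ ι y * (power (ι k) 0 * G N (ι k * ι y) - hornerℚ n z (ι y) * ι m)
      value = trans (cong (λ t → t - F N 0ℚ - (ι y * hornerℚ n z (ι y)) * ι m) (divides (ι k * ι y)))
        (solve 6 (λ k y f g h m → f :+ (k :* y :- con 0ℚ) :* g :- f :- (y :* h) :* m := y :* (k :* g :- h :* m)) refl
          (ι k) (ι y) (F N 0ℚ) (G N (ι k * ι y)) (hornerℚ n z (ι y)) (ι m))

  -- A bound on all of ℕ allows `step-bound` on arbitrarily long ranges: with spacing E a step is at
  -- most a constant over E. The indices N for which this holds depend on E, so it is the limit that
  -- vanishes.
  bounded⇒vanishing : ∀ {n D C} → Poly (suc n) D → 0ℚ ≤ℚ C → (∀ N → D N (ι 0) ≡ 0ℚ) →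
    (∀ y → Eventually (λ N → ∣ D N (ι y) ∣ ≤ℚ C)) → ∀ y → (λ N → D N (ι y)) ⟶ 0ℚ
  bounded⇒vanishing p 0≤C D0 bounded zero = ⟶-≗ (λ N → sym (D0 N)) refl (⟶-const 0ℚ)
  bounded⇒vanishing {n} {D} {C} p 0≤C D0 bounded (suc y) = ⟶-≗
    (λ N → solve 2 (λ a b → a :+ (b :- a) := b) refl (D N (ι y)) (D N (ι (suc y)))) refl
    (⟶-+ (bounded⇒vanishing p 0≤C D0 bounded y) step)
    where
    span : ℕ
    r κ : ℚ
    span = suc (2 ℕ.* n)
    r = ι span
    κ = interpolationConstant n r
    step : (λ N → D N (ι (suc y)) - D N (ι y)) ⟶ 0ℚ
    step = limit λ ε 0<ε →
      let e , _ , κ≤ = small (κ * (C + C)) 0<ε (0≤* (interpolationConstant-≥0 n (0≤ι span)) (0≤+ 0≤C 0≤C))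
          E = e ℕ.+ suc y
          1≤E = ℕ.≤-trans (s≤s z≤n) (ℕ.m≤n+m (suc y) e)
          l , 0<l , El≡1 = reciprocal (0<ι 1≤E)
          Y = span ℕ.* E
          y<Y = ℕ.≤-trans (ℕ.m≤n+m (suc y) e) (ℕ.m≤n*m E span)
      in eventually-map
        (λ N bound → ℚ.≤-trans (ℚ.≤-reflexive (cong ∣_∣ (ℚ.+-identityʳ (D N (ι (suc y)) - D N (ι y)))))
          (ℚ.≤-trans (step-bound p N E Y (ℚ.<⇒≤ 0<l) (0≤ι span) 0≤C El≡1
              (ℚ.≤-reflexive (trans (cong (_* l) (ι-* span E)) (trans (ℚ.*-assoc r (ι E) l) (trans (cong (r *_) El≡1) (ℚ.*-identityʳ r)))))
              (ℕ.*-monoˡ-< E {{ℕ.>-nonZero 1≤E}} (ℕ.n<1+n (2 ℕ.* n))) bound y y<Y)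
            (ℚ.≤-trans (ℚ.≤-reflexive (solve 3 (λ κ l c → κ :* (l :* c) := l :* (κ :* c)) refl κ l (C + C)))
              (ℚ.≤-trans (*-monoˡ (ℚ.<⇒≤ 0<l) (ℚ.≤-trans κ≤ (*-monoʳ (ℚ.<⇒≤ 0<ε) (ι-mono-≤ (ℕ.m≤m+n e (suc y))))))
                (ℚ.≤-reflexive (trans (solve 3 (λ l E ε → l :* (E :* ε) := (E :* l) :* ε) refl l (ι E) ε) (trans (cong (_* ε) El≡1) (ℚ.*-identityˡ ε))))))))
        (eventually-< Y (λ y′ _ → bounded y′))

Degenerate : (ℕ → ℚ → ℚ) → Set
Degenerate A = ∃[ k ] 1 ≤ k × Σ[ W ∈ (ℕ → ℤ) ] (∀ y → (λ N → A N (ι (k ℕ.* y)) - A N 0ℚ) ⟶ ⟦ W y ⟧)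

NearCombination : (ℕ → ℚ → ℚ) → (ℕ → ℚ → ℚ) → ℚ → ℕ → Set
NearCombination A B ε N₁ = ∃[ N ] N₁ ≤ N × ∃[ d ] ∃[ e ] ∃[ γ ] ∣ d ◀ A N 0ℚ - e ◀ B N 0ℚ - ⟦ γ ⟧ ∣ ≤ℚ ε

near-swap : ∀ {A B ε N₁} → NearCombination A B ε N₁ → NearCombination B A ε N₁
near-swap {A} {B} {ε} (N , N₁≤N , d , e , γ , h) = N , N₁≤N , e , d , ℤ.- γ , ℚ.≤-trans
  (ℚ.≤-reflexive (trans (cong ∣_∣ (trans (cong (λ t → e ◀ B N 0ℚ - d ◀ A N 0ℚ - t) (⟦⟧-neg γ))
      (solve 3 (λ a b g → b :- a :- (:- g) := :- (a :- b :- g)) refl (d ◀ A N 0ℚ) (e ◀ B N 0ℚ) ⟦ γ ⟧)))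
    (ℚ.∣-p∣≡∣p∣ (d ◀ A N 0ℚ - e ◀ B N 0ℚ - ⟦ γ ⟧)))) h

◀-+ : ∀ d p q → d ◀ (p + q) ≡ d ◀ p + d ◀ q
◀-+ up   p q = refl
◀-+ down p q = ℚ.neg-distrib-+ p q

∣◀∣ : ∀ d p → ∣ d ◀ p ∣ ≡ ∣ p ∣
∣◀∣ up   p = refl
∣◀∣ down p = ℚ.∣-p∣≡∣p∣ p

module Exit {n A B} (pA : Poly (suc n) A) (pB : Poly (suc n) B) {m} (2≤m : 2 ≤ m) {a b : ℕ → ℤ}
  (floorA : ∀ y → FloorLimit (λ N → A N (ι y)) (a y)) (floorB : ∀ y → FloorLimit (λ N → B N (ι y)) (b y))
  (congruent : ∀ y → ∃[ z ] a y ≡ b y ℤ.+ z ℤ.* ℤ.+ m) {ε : ℚ} (0<ε : 0ℚ <ℚ ε)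
  (k : ℕ) (z w : Fin n → ℤ) where

  open Drift n m k
  open Run n (½*-pos 0<ε) using (C; Y₀; near-integer-combination)

  module At {N Y η} (0<η : 0ℚ <ℚ η) (2η≤½ε : η + η ≤ℚ ℚ.½ * ε)
    (exit : ι (gap n) <ℚ ∣ drift z A N (ι Y) ∣)
    (bounded : ∀ y → y ℕ.< Y → ∣ drift z A N (ι y) ∣ ≤ℚ C × ∣ drift w B N (ι y) ∣ ≤ℚ C)
    (slow : ∀ y → y ≤ Y₀ → ∣ drift z A N (ι y) ∣ ≤ℚ 1ℚ × ∣ drift w B N (ι y) ∣ ≤ℚ 1ℚ)
    (floors : ∀ y → y ℕ.< suc Y → FloorAt (λ N → A N (ι (k ℕ.* y))) (a (k ℕ.* y)) N η × FloorAt (λ N → B N (ι (k ℕ.* y))) (b (k ℕ.* y)) N η) where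

    -- Up to Y₀ the drift is at most 1, whereas an exit takes more than `gap n`.
    Y₀≤Y : Y₀ ≤ Y
    Y₀≤Y = ℕ.≮⇒≥ λ Y<Y₀ → ℚ.<-irrefl refl (ℚ.<-≤-trans exit (ℚ.≤-trans (proj₁ (slow Y (ℕ.<⇒≤ Y<Y₀)))
      (ℚ.≤-trans (ℚ.≤-reflexive (sym ⟦1⟧)) (ι-mono-≤ {1} {gap n} (s≤s z≤n)))))

    shifted : (ℕ → ℚ → ℚ) → (Fin n → ℤ) → ℕ → ℚ → ℚ
    shifted F z M x = drift z F M x + (F N 0ℚ + η)

    Poly-shifted : ∀ {F} z → Poly (suc n) F → Poly (suc n) (shifted F z)
    Poly-shifted {F} z p = Poly-+ (Poly-drift z p) (Poly-const (fromℚ (F N 0ℚ + η)))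

    shifted-ι : ∀ F z y → shifted F z N (ι y) ≡ (F N (ι (k ℕ.* y)) + η) - ⟦ offset z y ⟧
    shifted-ι F z y = trans (cong (_+ (F N 0ℚ + η)) (drift-ι z F N y))
      (solve 4 (λ f f₀ o η → f :- f₀ :- o :+ (f₀ :+ η) := f :+ η :- o) refl (F N (ι (k ℕ.* y))) (F N 0ℚ) ⟦ offset z y ⟧ η)

    shifted-0 : ∀ F z → shifted F z N (ι 0) ≡ F N 0ℚ + η
    shifted-0 F z = trans (cong (_+ (F N 0ℚ + η)) (drift-0 z F N)) (ℚ.+-identityˡ (F N 0ℚ + η))

    shifted-floors : ∀ F z (f : ℕ → ℤ) → (∀ y → y ℕ.< suc Y → FloorAt (λ N → F N (ι (k ℕ.* y))) (f (k ℕ.* y)) N η) →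
      Floors (λ y → shifted F z N (ι y)) (λ y → f (k ℕ.* y) ℤ.- offset z y) Y
    shifted-floors F z f h y y≤Y = subst₂ (λ s t → s ≤ℚ t × t <ℚ s + 1ℚ)
      (sym (⟦⟧-- (f (k ℕ.* y)) (offset z y))) (sym (shifted-ι F z y))
      (ℚ.+-monoˡ-≤ (- ⟦ offset z y ⟧) (proj₁ (h y (s≤s y≤Y))) ,
       <-by (proj₂ (h y (s≤s y≤Y))) (solve 3 (λ f s o → (f :- o :+ con 1ℚ) :- (s :- o) := f :+ con 1ℚ :- s) refl ⟦ f (k ℕ.* y) ⟧ (F N (ι (k ℕ.* y)) + η) ⟦ offset z y ⟧))

    shifted-drift : ∀ F z y → shifted F z N (ι y) - shifted F z N (ι 0) ≡ drift z F N (ι y)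
    shifted-drift F z y = trans (cong (λ t → shifted F z N (ι y) - t) (shifted-0 F z))
      (solve 2 (λ d c → d :+ c :- c := d) refl (drift z F N (ι y)) (F N 0ℚ + η))

    shifted-congruent : ∀ y → y ≤ Y → ∃[ t ] a (k ℕ.* y) ℤ.- offset z y ≡ (b (k ℕ.* y) ℤ.- offset w y) ℤ.+ t ℤ.* ℤ.+ m
    shifted-congruent y _ =
      let t , e = congruent (k ℕ.* y)
          u = ℤ.+ y ℤ.* horner n z y
          v = ℤ.+ y ℤ.* horner n w y
      in t ℤ.+ (v ℤ.- u) , trans (cong (ℤ._- offset z y) e)
           (ℤsolve 5 (λ b t u v m → (b ⊕ t ⊗ m) ⊝ u ⊗ m ⊜ (b ⊝ v ⊗ m) ⊕ (t ⊕ (v ⊝ u)) ⊗ m) refl (b (k ℕ.* y)) t u v (ℤ.+ m))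

    combination : ∃[ d ] ∃[ e ] ∃[ γ ] ∣ d ◀ A N 0ℚ - e ◀ B N 0ℚ - ⟦ γ ⟧ ∣ ≤ℚ ε
    combination =
      let d , e , γ , h = near-integer-combination (Poly-shifted z pA) (Poly-shifted w pB) N
            {λ y → a (k ℕ.* y) ℤ.- offset z y} {λ y → b (k ℕ.* y) ℤ.- offset w y} {Y} Y₀≤Y
            (shifted-floors A z a (λ y y<1+Y → proj₁ (floors y y<1+Y))) (shifted-floors B w b (λ y y<1+Y → proj₂ (floors y y<1+Y)))
            2≤m shifted-congruent
            (λ y y<Y → subst (λ t → ∣ t ∣ ≤ℚ C) (sym (shifted-drift A z y)) (proj₁ (bounded y y<Y)))
            (λ y y<Y → subst (λ t → ∣ t ∣ ≤ℚ C) (sym (shifted-drift B w y)) (proj₂ (bounded y y<Y)))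
            (subst (λ t → ι (gap n) <ℚ ∣ t ∣) (sym (shifted-drift A z Y)) exit)
      in d , e , γ , unshift d e γ h
      where
      ∣η∣ : ∀ d → ∣ d ◀ η ∣ ≤ℚ η
      ∣η∣ d = ℚ.≤-reflexive (trans (∣◀∣ d η) (ℚ.0≤p⇒∣p∣≡p (ℚ.<⇒≤ 0<η)))
      unshift : ∀ d e γ → ∣ d ◀ shifted A z N (ι 0) - e ◀ shifted B w N (ι 0) - ⟦ γ ⟧ ∣ ≤ℚ ℚ.½ * ε →
        ∣ d ◀ A N 0ℚ - e ◀ B N 0ℚ - ⟦ γ ⟧ ∣ ≤ℚ ε
      unshift d e γ h = ℚ.≤-trans (ℚ.≤-reflexive (cong ∣_∣ (solve 5 (λ a b g s t → a :- b :- g := (a :+ s :- (b :+ t) :- g) :- (s :- t)) refl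
          (d ◀ A N 0ℚ) (e ◀ B N 0ℚ) ⟦ γ ⟧ (d ◀ η) (e ◀ η))))
        (ℚ.≤-trans (∣-∣≤ {d ◀ A N 0ℚ + d ◀ η - (e ◀ B N 0ℚ + e ◀ η) - ⟦ γ ⟧} {d ◀ η - e ◀ η}
            (subst₂ (λ s t → ∣ s - t - ⟦ γ ⟧ ∣ ≤ℚ ℚ.½ * ε)
              (trans (cong (d ◀_) (shifted-0 A z)) (◀-+ d (A N 0ℚ) η)) (trans (cong (e ◀_) (shifted-0 B w)) (◀-+ e (B N 0ℚ) η)) h)
            (∣-∣≤ {d ◀ η} {e ◀ η} (∣η∣ d) (∣η∣ e)))
          (ℚ.≤-trans (ℚ.+-monoʳ-≤ (ℚ.½ * ε) 2η≤½ε) (ℚ.≤-reflexive (½+½ ε))))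

  exit-combination : ∀ {Y} → Eventually (λ N → ι (gap n) <ℚ ∣ drift z A N (ι Y) ∣) →
    (∀ y → y ℕ.< Y → Eventually (λ N → ∣ drift z A N (ι y) ∣ ≤ℚ C × ∣ drift w B N (ι y) ∣ ≤ℚ C)) →
    Eventually (λ N → ∀ y → y ≤ Y₀ → ∣ drift z A N (ι y) ∣ ≤ℚ 1ℚ × ∣ drift w B N (ι y) ∣ ≤ℚ 1ℚ) →
    ∀ N₁ → NearCombination A B ε N₁
  exit-combination {Y} exit bounded slow N₁ =
    let η₀ , 0<η₀ , floors = shiftable-< (suc Y) {λ y N η → FloorAt (λ N → A N (ι (k ℕ.* y))) (a (k ℕ.* y)) N η × FloorAt (λ N → B N (ι (k ℕ.* y))) (b (k ℕ.* y)) N η}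
          (λ y → shiftable-× (floor-shiftable (floorA (k ℕ.* y))) (floor-shiftable (floorB (k ℕ.* y))))
        η , 0<η , η≤η₀ , η≤¼ε = smaller 0<η₀ (½*-pos (½*-pos 0<ε))
        N , N₁≤N , e , f , g , h = eventually-witness N₁ (eventually-× exit (eventually-× (eventually-< Y bounded) (eventually-× slow (floors η 0<η η≤η₀))))
    in N , N₁≤N , At.combination 0<η (ℚ.≤-trans (ℚ.+-mono-≤ η≤¼ε η≤¼ε) (ℚ.≤-reflexive (½+½ (ℚ.½ * ε)))) e f g h

¬¬-decide : ∀ {P Q : Set} → (P → Q) → (¬ P → Q) → ¬ ¬ Q
¬¬-decide f g ¬q = ¬q (g λ p → ¬q (f p))

opaque

  -- Either both drifts stay bounded forever or one of them leaves; this distinction is not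
  -- decidable, whence the double negation. Before the first exit both are bounded, and the one that
  -- leaves takes the leading role, with `near-swap` restoring the order.
  dichotomy : ∀ {n A B} → Poly (suc n) A → Poly (suc n) B → ∀ {m} → 2 ≤ m → ∀ {a b : ℕ → ℤ} →
    (∀ y → FloorLimit (λ N → A N (ι y)) (a y)) → (∀ y → FloorLimit (λ N → B N (ι y)) (b y)) →
    (∀ y → ∃[ z ] a y ≡ b y ℤ.+ z ℤ.* ℤ.+ m) → ∀ {ε} → 0ℚ <ℚ ε → ∀ N₁ →
    ¬ ¬ (Degenerate A ⊎ NearCombination A B ε N₁)
  dichotomy {n} {A} {B} pA pB {m} 2≤m {a} {b} floorA floorB congruent {ε} 0<ε N₁ =
    ¬¬-decide {∃[ y ] Large y} (λ { (y , large) → inj₂ (leave (first-exit choice y large)) }) (λ never → inj₁ (stay never))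
    where
    congruent′ : ∀ y → ∃[ z ] b y ≡ a y ℤ.+ z ℤ.* ℤ.+ m
    congruent′ y = let z , e = congruent y in ℤ.- z ,
      trans (ℤsolve 3 (λ y z m → y ⊜ (y ⊕ z ⊗ m) ⊕ (⊖ z) ⊗ m) refl (b y) z (ℤ.+ m)) (cong (ℤ._+ (ℤ.- z) ℤ.* ℤ.+ m) (sym e))
    C : ℚ
    C = Run.C n (½*-pos 0<ε)
    slowness : ∃[ k ] 1 ≤ k × Σ[ z ∈ (Fin n → ℤ) ] Σ[ w ∈ (Fin n → ℤ) ] Eventually (λ N → ∀ y → y ≤ Run.Y₀ n (½*-pos 0<ε) →
      ∣ Drift.drift n m k z A N (ι y) ∣ ≤ℚ 1ℚ × ∣ Drift.drift n m k w B N (ι y) ∣ ≤ℚ 1ℚ)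
    slowness = slow-drift pA pB (ℕ.≤-trans (s≤s z≤n) 2≤m) (Run.Y₀ n (½*-pos 0<ε))
    k : ℕ
    k = proj₁ slowness
    z w : Fin n → ℤ
    z = proj₁ (proj₂ (proj₂ slowness))
    w = proj₁ (proj₂ (proj₂ (proj₂ slowness)))
    slow : Eventually (λ N → ∀ y → y ≤ Run.Y₀ n (½*-pos 0<ε) →
      ∣ Drift.drift n m k z A N (ι y) ∣ ≤ℚ 1ℚ × ∣ Drift.drift n m k w B N (ι y) ∣ ≤ℚ 1ℚ)
    slow = proj₂ (proj₂ (proj₂ (proj₂ slowness)))
    open Drift n m k
    LargeA LargeB Large Bounded : ℕ → Set
    LargeA y = Eventually (λ N → ι (gap n) <ℚ ∣ drift z A N (ι y) ∣)
    LargeB y = Eventually (λ N → ι (gap n) <ℚ ∣ drift w B N (ι y) ∣)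
    Large y = LargeA y ⊎ LargeB y
    Bounded y = Eventually (λ N → ∣ drift z A N (ι y) ∣ ≤ℚ C × ∣ drift w B N (ι y) ∣ ≤ℚ C)
    choice : ∀ y → Large y ⊎ Bounded y
    choice y = choose (large-or-bounded {λ N → drift z A N (ι y)} (ι (gap n)) (Poly-cauchy (Poly-drift z pA) (ι y)))
                      (large-or-bounded {λ N → drift w B N (ι y)} (ι (gap n)) (Poly-cauchy (Poly-drift w pB) (ι y)))
      where
      choose : LargeA y ⊎ Eventually (λ N → ∣ drift z A N (ι y) ∣ ≤ℚ C) → LargeB y ⊎ Eventually (λ N → ∣ drift w B N (ι y) ∣ ≤ℚ C) → Large y ⊎ Bounded y
      choose (inj₁ h) _        = inj₁ (inj₁ h)
      choose (inj₂ _) (inj₁ h) = inj₁ (inj₂ h)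
      choose (inj₂ h) (inj₂ l) = inj₂ (eventually-× h l)
    leave : (∃[ Y ] Large Y × (∀ y → y ℕ.< Y → Bounded y)) → NearCombination A B ε N₁
    leave (Y , inj₁ h , bounded) = Exit.exit-combination pA pB 2≤m floorA floorB congruent 0<ε k z w {Y} h bounded slow N₁
    leave (Y , inj₂ h , bounded) = near-swap {B} {A} (Exit.exit-combination pB pA 2≤m floorB floorA congruent′ 0<ε k w z {Y} h
      (λ y y<Y → eventually-map (λ N (p , q) → q , p) (bounded y y<Y))
      (eventually-map (λ N s y y≤Y₀ → proj₂ (s y y≤Y₀) , proj₁ (s y y≤Y₀)) slow) N₁)
    stay : ¬ (∃[ y ] Large y) → Degenerate A
    stay never = k , proj₁ (proj₂ slowness) , offset z , λ y → ⟶-≗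
      (λ N → trans (cong (_+ ⟦ offset z y ⟧) (drift-ι z A N y)) (solve 2 (λ d o → d :- o :+ o := d) refl (A N (ι (k ℕ.* y)) - A N 0ℚ) ⟦ offset z y ⟧))
      (ℚ.+-identityˡ ⟦ offset z y ⟧)
      (⟶-+ (bounded⇒vanishing (Poly-drift z pA) (Run.0≤C n (½*-pos 0<ε)) (drift-0 z A) bounded y) (⟶-const ⟦ offset z y ⟧))
      where
      bounded : ∀ y → Eventually (λ N → ∣ drift z A N (ι y) ∣ ≤ℚ C)
      bounded y = settle (choice y)
        where
        settle : Large y ⊎ Bounded y → Eventually (λ N → ∣ drift z A N (ι y) ∣ ≤ℚ C)
        settle (inj₁ large) = ⊥-elim (never (y , large))
        settle (inj₂ h)     = eventually-map (λ N → proj₁) h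

-- From approximate to exact integrality

integers-close : ∀ {γ γ′} → ∣ ⟦ γ ⟧ - ⟦ γ′ ⟧ ∣ <ℚ 1ℚ → γ ≡ γ′
integers-close {γ} {γ′} h = ℤ.≤-antisym (≤-of h) (≤-of (ℚ.≤-<-trans (ℚ.≤-reflexive (∣-∣-comm ⟦ γ′ ⟧ ⟦ γ ⟧)) h))
  where
  ≤-of : ∀ {a b} → ∣ ⟦ a ⟧ - ⟦ b ⟧ ∣ <ℚ 1ℚ → a ℤ.≤ b
  ≤-of {a} {b} h = +1-cancel-≤ (ℤ.≤-trans (ℤ.≤-reflexive (ℤ.+-comm a ℤ.1ℤ)) (ℤ.i<j⇒suc[i]≤j (⟦⟧-cancel-<
    (ℚ.<-≤-trans (<-by (ℚ.≤-<-trans (p≤∣p∣ (⟦ a ⟧ - ⟦ b ⟧)) h)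
      (solve 2 (λ a b → b :+ con 1ℚ :- a := con 1ℚ :- (a :- b)) refl ⟦ a ⟧ ⟦ b ⟧)) (ℚ.≤-reflexive (sym (⟦⟧-suc b)))))))

FarFromIntegers : (ℕ → ℚ) → Set
FarFromIntegers r = ∃[ ε ] 0ℚ <ℚ ε × ∃[ N₁ ] ∀ N → N₁ ≤ N → ∀ γ → ¬ (∣ r N - ⟦ γ ⟧ ∣ ≤ℚ ε)

⅛ : ℚ
⅛ = ℚ.½ * (ℚ.½ * ℚ.½)

opaque

  -- A sequence that is not eventually kept away from the integers returns to within any ε of some
  -- integer. Once it has settled to within 1 / 8, these integers are less than 1 apart, hence
  -- equal, and their common value is the limit.
  integer-limit : ∀ {r : ℕ → ℚ} → IsCauchy r → ¬ ¬ ((∃[ γ ] r ⟶ ⟦ γ ⟧) ⊎ FarFromIntegers r)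
  integer-limit {r} cr neither =
    let N₀ , settled = cr ⅛ 0<⅛
    in returns ⅛ 0<⅛ N₀ λ { (M , N₀≤M , γ , h) → neither (inj₁ (γ , limit λ ε 0<ε →
      let ε′ , 0<ε′ , ε′≤½ε , ε′≤⅛ = smaller (½*-pos 0<ε) 0<⅛
          N₁ , close = cr ε′ 0<ε′
      in N₀ ℕ.⊔ N₁ , λ N N₀⊔N₁≤N → decidable-stable (∣ r N - ⟦ γ ⟧ ∣ ℚ.≤? ε) λ not-close →
         returns ε′ 0<ε′ (N₀ ℕ.⊔ N₁) λ { (L , N₀⊔N₁≤L , γ′ , h′) →
           let γ≡γ′ = integers-close {γ} {γ′} (ℚ.≤-<-trans
                 (∣-∣-trans {⟦ γ ⟧} {⟦ γ′ ⟧} (r L)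
                   (∣-∣-trans {⟦ γ ⟧} {r L} (r M) (ℚ.≤-trans (ℚ.≤-reflexive (∣-∣-comm ⟦ γ ⟧ (r M))) h)
                     (ℚ.<⇒≤ (settled M L N₀≤M (ℕ.m⊔n≤o⇒m≤o N₀ N₁ N₀⊔N₁≤L))))
                   (ℚ.≤-trans h′ ε′≤⅛)) ⅜<1)
           in not-close (ℚ.≤-trans (∣-∣-trans {r N} {⟦ γ ⟧} (r L)
                (ℚ.<⇒≤ (close N L (ℕ.m⊔n≤o⇒n≤o N₀ N₁ N₀⊔N₁≤N) (ℕ.m⊔n≤o⇒n≤o N₀ N₁ N₀⊔N₁≤L)))
                (subst (λ γ → ∣ r L - ⟦ γ ⟧ ∣ ≤ℚ ε′) (sym γ≡γ′) h′))
              (ℚ.≤-trans (ℚ.+-mono-≤ ε′≤½ε ε′≤½ε) (ℚ.≤-reflexive (½+½ ε)))) })) }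
    where
    0<⅛ : 0ℚ <ℚ ⅛
    0<⅛ = ½*-pos (½*-pos (ℚ.positive⁻¹ ℚ.½))
    ⅜<1 : ⅛ + ⅛ + ⅛ <ℚ 1ℚ
    ⅜<1 = <-by {⅛ + ⅛ + ⅛} {1ℚ} (ℚ.+-mono-< (ℚ.+-mono-< 0<⅛ 0<⅛) (ℚ.+-mono-< (ℚ.+-mono-< 0<⅛ 0<⅛) 0<⅛)) refl
    returns : ∀ ε → 0ℚ <ℚ ε → ∀ N₁ → ¬ ¬ (∃[ N ] N₁ ≤ N × ∃[ γ ] ∣ r N - ⟦ γ ⟧ ∣ ≤ℚ ε)
    returns ε 0<ε N₁ none = neither (inj₂ (ε , 0<ε , N₁ , λ N N₁≤N γ h → none (N , N₁≤N , γ , h)))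

  oriented-near : ∀ {A B ε N₁} → NearCombination A B ε N₁ → ∃[ N ] N₁ ≤ N × ∃[ e ] ∃[ γ ] ∣ A N 0ℚ - e ◀ B N 0ℚ - ⟦ γ ⟧ ∣ ≤ℚ ε
  oriented-near (N , N₁≤N , up , e , γ , h) = N , N₁≤N , e , γ , h
  oriented-near {A} {B} (N , N₁≤N , down , e , γ , h) = N , N₁≤N , opposite e , ℤ.- γ , ℚ.≤-trans
    (ℚ.≤-reflexive (trans (cong₂ (λ s t → ∣ A N 0ℚ - s - t ∣) (opposite-◀ e (B N 0ℚ)) (⟦⟧-neg γ))
      (trans (cong ∣_∣ (solve 3 (λ a b g → a :- (:- b) :- (:- g) := :- (:- a :- b :- g)) refl (A N 0ℚ) (e ◀ B N 0ℚ) ⟦ γ ⟧))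
        (ℚ.∣-p∣≡∣p∣ (- A N 0ℚ - e ◀ B N 0ℚ - ⟦ γ ⟧))))) h
    where
    opposite-◀ : ∀ e q → opposite e ◀ q ≡ - (e ◀ q)
    opposite-◀ up   q = refl
    opposite-◀ down q = solve 1 (λ q → q := :- (:- q)) refl q

  -- The sign obtained from `dichotomy` may change with the accuracy. If neither sign gave an
  -- integer limit, both combinations would eventually keep a common distance η from the integers,
  -- which `dichotomy` at accuracy η refutes unless A is degenerate.
  integer-combination : ∀ {n A B} → Poly (suc n) A → Poly (suc n) B → ∀ {m} → 2 ≤ m → ∀ {a b : ℕ → ℤ} →
    (∀ y → FloorLimit (λ N → A N (ι y)) (a y)) → (∀ y → FloorLimit (λ N → B N (ι y)) (b y)) →
    (∀ y → ∃[ z ] a y ≡ b y ℤ.+ z ℤ.* ℤ.+ m) →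
    ¬ ¬ (Degenerate A ⊎ ∃[ e ] ∃[ γ ] (λ N → A N 0ℚ - e ◀ B N 0ℚ) ⟶ ⟦ γ ⟧)
  integer-combination {A = A} {B} pA pB 2≤m floorA floorB congruent neither =
    integer-limit (cauchy-of up) λ where
      (inj₁ (γ , h)) → neither (inj₂ (up , γ , h))
      (inj₂ (ε , 0<ε , N₁ , far)) → integer-limit (cauchy-of down) λ where
        (inj₁ (γ , h)) → neither (inj₂ (down , γ , h))
        (inj₂ (ε′ , 0<ε′ , N₂ , far′)) →
          let η , 0<η , η≤ε , η≤ε′ = smaller 0<ε 0<ε′
          in dichotomy pA pB 2≤m floorA floorB congruent 0<η (N₁ ℕ.⊔ N₂) λ where
            (inj₁ degenerate) → neither (inj₁ degenerate)
            (inj₂ combined) → contradict far far′ η≤ε η≤ε′ (oriented-near {A} {B} combined)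
    where
    combination : Direction → ℕ → ℚ
    combination e N = A N 0ℚ - e ◀ B N 0ℚ
    cauchy-of : ∀ e → IsCauchy (combination e)
    cauchy-of e = Poly-cauchy (Poly-- pA (Poly-◀ e pB)) 0ℚ
    contradict : ∀ {ε ε′ η N₁ N₂} → (∀ N → N₁ ≤ N → ∀ γ → ¬ (∣ combination up N - ⟦ γ ⟧ ∣ ≤ℚ ε)) →
      (∀ N → N₂ ≤ N → ∀ γ → ¬ (∣ combination down N - ⟦ γ ⟧ ∣ ≤ℚ ε′)) → η ≤ℚ ε → η ≤ℚ ε′ →
      ¬ (∃[ N ] N₁ ℕ.⊔ N₂ ≤ N × ∃[ e ] ∃[ γ ] ∣ combination e N - ⟦ γ ⟧ ∣ ≤ℚ η)
    contradict {N₁ = N₁} {N₂} far far′ η≤ε η≤ε′ (N , h , up , γ , k) = far N (ℕ.m⊔n≤o⇒m≤o N₁ N₂ h) γ (ℚ.≤-trans k η≤ε)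
    contradict {N₁ = N₁} {N₂} far far′ η≤ε η≤ε′ (N , h , down , γ , k) = far′ N (ℕ.m⊔n≤o⇒n≤o N₁ N₂ h) γ (ℚ.≤-trans k η≤ε′)

-- Polynomials with rational increments

-- The limit is a rational number, so for a Cauchy sequence this says that the real number it
-- represents is rational.
HasLimit : (ℕ → ℚ) → Set
HasLimit r = ∃[ ρ ] r ⟶ ρ

nonzero-inverse : ∀ {p} → p ≢ 0ℚ → ∃[ r ] p * r ≡ 1ℚ
nonzero-inverse {p} p≢0 = (1/ p) {{ℚ.≢-nonZero p≢0}} , ℚ.*-inverseʳ p {{ℚ.≢-nonZero p≢0}}

-- Interpolation in exact form: divided differences of rational values at rational nodes are
-- rational.
rational-everywhere : ∀ {n F} → Poly n F → (a : ℕ → ℚ) → (∀ i j → i ℕ.< j → j ℕ.< n → a j ≢ a i) →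
  (∀ i → i ℕ.< n → HasLimit (λ N → F N (a i))) → ∀ x → HasLimit (λ N → F N x)
rational-everywhere (nil f) a distinct limits x = 0ℚ , ⟶-≗ (λ N → sym (f N x)) refl (⟶-const 0ℚ)
rational-everywhere {suc n} {F} p@(cons _ _ _) a distinct limits x =
  let G , pG , divides = Poly-divide p (a 0)
      α , Fa⟶α = limits 0 (s≤s z≤n)
      β , Gx⟶β = rational-everywhere pG (λ i → a (suc i)) (λ i j i<j j<n → distinct (suc i) (suc j) (s≤s i<j) (s≤s j<n))
        (λ i i<n → quotient-limit (distinct 0 (suc i) (s≤s z≤n) (s≤s i<n)) (λ N → divides N (a (suc i))) (limits (suc i) (s≤s i<n)) (limits 0 (s≤s z≤n))) x
  in α + (x - a 0) * β , ⟶-≗ (λ N → sym (divides N x)) refl (⟶-+ Fa⟶α (⟶-scale (x - a 0) Gx⟶β))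
  where
  quotient-limit : ∀ {f g h b c} → b ≢ c → (∀ N → f N ≡ g N + (b - c) * h N) → HasLimit f → HasLimit g → HasLimit h
  quotient-limit {f} {g} {h} {b} {c} b≢c e (φ , f⟶φ) (ψ , g⟶ψ) =
    let r , dr≡1 = nonzero-inverse {b - c} λ d≡0 → b≢c (trans (solve 2 (λ b c → b := (b :- c) :+ c) refl b c) (trans (cong (_+ c) d≡0) (ℚ.+-identityˡ c)))
    in r * (φ - ψ) , ⟶-≗ (λ N → trans (cong (λ t → r * (t - g N)) (e N))
         (trans (solve 4 (λ r g d h → r :* (g :+ d :* h :- g) := (d :* r) :* h) refl r (g N) (b - c) (h N))
           (trans (cong (_* h N) dr≡1) (ℚ.*-identityˡ (h N))))) refl (⟶-scale r (⟶-- f⟶φ g⟶ψ))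

⟶-◀ : ∀ d {r ρ} → r ⟶ ρ → (λ N → d ◀ r N) ⟶ d ◀ ρ
⟶-◀ up   h = h
⟶-◀ down h = ⟶-neg h

◀-involutive : ∀ d q → d ◀ (d ◀ q) ≡ q
◀-involutive up   q = refl
◀-involutive down q = solve 1 (λ q → :- (:- q) := q) refl q

ι-injective : ∀ {a b} → ι a ≡ ι b → a ≡ b
ι-injective e = ℤ.+-injective (⟦⟧-injective e)

RationalIncrements : (ℕ → ℚ → ℚ) → Set
RationalIncrements P = ∀ x → HasLimit (λ N → P N x - P N 0ℚ)

-- With τ = ±1, rationality of P z - τ P (z + h) for all z gives that of P z - P (z + 2 h).
rational-translates : ∀ {n P} → Poly (suc n) P → ∀ h → 1 ≤ h → ∀ e (z : ℕ → ℚ) →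
  (∀ i j → i ℕ.< j → j ℕ.< suc n → z j ≢ z i) →
  (∀ i → i ℕ.< suc n → HasLimit (λ N → P N (z i) - e ◀ P N (z i + ι h))) → RationalIncrements P
rational-translates {n} {P} p h 1≤h e z distinct limits =
  rational-everywhere (Poly-- p (Poly-const (mkℝ (λ N → P N 0ℚ) (Poly-cauchy p 0ℚ)))) (λ j → ι j * H) distinct′ (λ j _ → multiples j)
  where
  H : ℚ
  H = ι h + ι h
  first : ∀ x → HasLimit (λ N → P N x - e ◀ P N (x + ι h))
  first = rational-everywhere (Poly-- p (Poly-◀ e (Poly-shift (ι h) p))) z distinct limits
  second : ∀ x → HasLimit (λ N → P N x - P N (x + H))
  second x =
    let α , h₁ = first x
        β , h₂ = first (x + ι h)
    in α + e ◀ β , ⟶-≗ (λ N → trans (cong (λ t → P N x - e ◀ P N (x + ι h) + t)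
           (trans (sym (◀-- e (P N (x + ι h)) (e ◀ P N (x + ι h + ι h)))) (cong (λ s → e ◀ P N (x + ι h) - s) (◀-involutive e (P N (x + ι h + ι h))))))
         (trans (solve 3 (λ a b c → a :- b :+ (b :- c) := a :- c) refl (P N x) (e ◀ P N (x + ι h)) (P N (x + ι h + ι h)))
           (cong (λ t → P N x - P N t) (ℚ.+-assoc x (ι h) (ι h))))) refl (⟶-+ h₁ (⟶-◀ e h₂))
  multiples : ∀ j → HasLimit (λ N → P N (ι j * H) - P N 0ℚ)
  multiples zero = 0ℚ , ⟶-≗ (λ N → sym (trans (cong (λ t → P N t - P N 0ℚ) (trans (cong (_* H) ⟦0⟧) (ℚ.*-zeroˡ H))) (ℚ.+-inverseʳ (P N 0ℚ)))) refl (⟶-const 0ℚ)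
  multiples (suc j) =
    let α , h₁ = multiples j
        β , h₂ = second (ι j * H)
    in α - β , ⟶-≗ (λ N → trans (solve 3 (λ a b c → a :- b :- (a :- c) := c :- b) refl (P N (ι j * H)) (P N 0ℚ) (P N (ι j * H + H)))
         (cong (λ t → P N t - P N 0ℚ) (trans (solve 2 (λ j H → j :* H :+ H := (con 1ℚ :+ j) :* H) refl (ι j) H) (cong (_* H) (sym (ι-suc j)))))) refl (⟶-- h₁ h₂)
  distinct′ : ∀ i j → i ℕ.< j → j ℕ.< suc n → ι j * H ≢ ι i * H
  distinct′ i j i<j _ eq = ℕ.<⇒≢ i<j (sym (ℕ.*-cancelʳ-≡ j i (h ℕ.+ h) {{ℕ.>-nonZero (ℕ.≤-trans 1≤h (ℕ.m≤m+n h h))}}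
    (ι-injective (trans (scaled j) (trans eq (sym (scaled i)))))))
    where
    scaled : ∀ j → ι (j ℕ.* (h ℕ.+ h)) ≡ ι j * H
    scaled j = trans (ι-* j (h ℕ.+ h)) (cong (ι j *_) (ι-+ h h))

degenerate⇒rational : ∀ {n P} → Poly (suc n) P → ∀ Z K → 1 ≤ K →
  Degenerate (λ N x → P N (ι Z + ι K * x)) → RationalIncrements P
degenerate⇒rational {n} {P} p Z K 1≤K (k , 1≤k , W , limits) x =
  let α , h₁ = everywhere x
      β , h₂ = everywhere 0ℚ
  in α - β , ⟶-≗ (λ N → solve 3 (λ a b c → a :- c :- (b :- c) := a :- b) refl (P N x) (P N 0ℚ) (P N (ι Z))) refl (⟶-- h₁ h₂)
  where
  node : ℕ → ℚ
  node y = ι Z + ι K * ι (k ℕ.* y)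
  node-ι : ∀ y → node y ≡ ι (Z ℕ.+ K ℕ.* (k ℕ.* y))
  node-ι y = sym (trans (ι-+ Z (K ℕ.* (k ℕ.* y))) (cong (ι Z +_) (ι-* K (k ℕ.* y))))
  distinct : ∀ i j → i ℕ.< j → j ℕ.< suc n → node j ≢ node i
  distinct i j i<j _ eq = ℕ.<⇒≢ i<j (sym (ℕ.*-cancelˡ-≡ j i k {{ℕ.>-nonZero 1≤k}} (ℕ.*-cancelˡ-≡ (k ℕ.* j) (k ℕ.* i) K {{ℕ.>-nonZero 1≤K}}
    (ℕ.+-cancelˡ-≡ Z (K ℕ.* (k ℕ.* j)) (K ℕ.* (k ℕ.* i)) (ι-injective (trans (sym (node-ι j)) (trans eq (node-ι i))))))))
  everywhere : ∀ x → HasLimit (λ N → P N x - P N (ι Z))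
  everywhere = rational-everywhere (Poly-- p (Poly-const (mkℝ (λ N → P N (ι Z)) (Poly-cauchy p (ι Z))))) node distinct
    (λ y _ → ⟦ W y ⟧ , ⟶-≗ (λ N → cong (λ t → P N (node y) - P N t) (trans (cong (ι Z +_) (ℚ.*-zeroʳ (ι K))) (ℚ.+-identityʳ (ι Z)))) refl (limits y))

-- The n-th difference is zero, a discrete form of having degree below n.
Vanishing : ℕ → (ℕ → ℚ) → Set
Vanishing zero    V = ∀ z → V z ≡ 0ℚ
Vanishing (suc n) V = Vanishing n (λ z → V (suc z) - V z)

limit-vanishing : ∀ {n F} V → Poly n F → (∀ z → (λ N → F N (ι z)) ⟶ V z) → Vanishing n V
limit-vanishing V (nil f) limits z = ⟶-unique (limits z) (⟶-≗ (λ N → sym (f N (ι z))) refl (⟶-const 0ℚ))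
limit-vanishing {F = F} V p@(cons _ _ _) limits = limit-vanishing (λ z → V (suc z) - V z) (Poly-difference 1ℚ p)
  λ z → ⟶-≗ (λ N → cong (λ t → F N t - F N (ι z)) (trans (ι-suc z) (ℚ.+-comm 1ℚ (ι z)))) refl (⟶-- (limits (suc z)) (limits z))

PeriodicModulo : ℕ → ℕ → (ℕ → ℚ) → Set
PeriodicModulo M T V = ∀ z → ∃[ k ] V (z ℕ.+ T) - V z ≡ ⟦ k ⟧ * ι M

-- If T is a period of the differences of V modulo M, then U z = V (z + T) - V z is constant
-- modulo M, so V (z + j T) - V z is j U 0 modulo M; take for j a multiple of M and of the denominator of U 0.
vanishing⇒periodic : ∀ n V → Vanishing n V → ∀ M → 1 ≤ M → ∃[ T ] 1 ≤ T × PeriodicModulo M T V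
vanishing⇒periodic zero V vanishing M 1≤M = 1 , s≤s z≤n , λ z → ℤ.0ℤ ,
  trans (cong₂ _-_ (vanishing (z ℕ.+ 1)) (vanishing z)) (sym (trans (cong (_* ι M) ⟦0⟧) (ℚ.*-zeroˡ (ι M))))
vanishing⇒periodic (suc n) V vanishing M 1≤M =
  let T , 1≤T , periodic = vanishing⇒periodic n (λ z → V (suc z) - V z) vanishing M 1≤M
      D , 1≤D , u , UD≡u = denominator (V T - V 0)
  in D ℕ.* M ℕ.* T , ℕ.*-mono-≤ (ℕ.*-mono-≤ 1≤D 1≤M) 1≤T , λ z →
     let k , e = multiple T periodic (D ℕ.* M) z
     in k ℤ.+ u , trans e (trans (cong (λ t → ⟦ k ⟧ * ι M + t) (trans (cong (_* (V T - V 0)) (ι-* D M))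
          (trans (solve 3 (λ d m v → (d :* m) :* v := (v :* d) :* m) refl (ι D) (ι M) (V T - V 0)) (cong (_* ι M) UD≡u))))
        (trans (solve 3 (λ k u m → k :* m :+ u :* m := (k :+ u) :* m) refl ⟦ k ⟧ ⟦ u ⟧ (ι M)) (cong (_* ι M) (sym (⟦⟧-+ k u)))))
  where
  module _ T (periodic : PeriodicModulo M T (λ z → V (suc z) - V z)) where
    constant : ∀ z → ∃[ k ] V (z ℕ.+ T) - V z ≡ ⟦ k ⟧ * ι M + (V T - V 0)
    constant zero = ℤ.0ℤ , sym (trans (cong (λ t → t * ι M + (V T - V 0)) ⟦0⟧) (solve 2 (λ m v → con 0ℚ :* m :+ v := v) refl (ι M) (V T - V 0)))
    constant (suc z) =
      let k , e = constant z
          l , f = periodic z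
      in l ℤ.+ k , trans (solve 4 (λ a b c d → a :- b := (a :- c :- (b :- d)) :+ (c :- d)) refl (V (suc z ℕ.+ T)) (V (suc z)) (V (z ℕ.+ T)) (V z))
           (trans (cong₂ _+_ f e) (trans (solve 4 (λ l k m v → l :* m :+ (k :* m :+ v) := (l :+ k) :* m :+ v) refl ⟦ l ⟧ ⟦ k ⟧ (ι M) (V T - V 0))
             (cong (λ t → t * ι M + (V T - V 0)) (sym (⟦⟧-+ l k)))))
    multiple : ∀ j z → ∃[ k ] V (z ℕ.+ j ℕ.* T) - V z ≡ ⟦ k ⟧ * ι M + ι j * (V T - V 0)
    multiple zero z = ℤ.0ℤ , trans (cong (λ t → V t - V z) (ℕ.+-identityʳ z)) (trans (ℚ.+-inverseʳ (V z))
      (sym (trans (cong₂ (λ s t → s * ι M + t * (V T - V 0)) ⟦0⟧ ⟦0⟧) (solve 2 (λ m v → con 0ℚ :* m :+ con 0ℚ :* v := con 0ℚ) refl (ι M) (V T - V 0)))))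
    multiple (suc j) z =
      let k , e = multiple j (z ℕ.+ T)
          l , f = constant z
      in k ℤ.+ l , trans (cong (λ t → V t - V z) (sym (ℕ.+-assoc z T (j ℕ.* T))))
           (trans (solve 3 (λ a b c → a :- c := (a :- b) :+ (b :- c)) refl (V (z ℕ.+ T ℕ.+ j ℕ.* T)) (V (z ℕ.+ T)) (V z))
             (trans (cong₂ _+_ e f) (trans (solve 5 (λ k l m j v → (k :* m :+ j :* v) :+ (l :* m :+ v) := (k :+ l) :* m :+ (con 1ℚ :+ j) :* v) refl ⟦ k ⟧ ⟦ l ⟧ (ι M) (ι j) (V T - V 0))
               (cong₂ (λ s t → s * ι M + t * (V T - V 0)) (sym (⟦⟧-+ k l)) (sym (ι-suc j))))))

-- The margin η by which r stays below x + 1 absorbs two errors of η / 2, one from `below` and one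
-- from the limit.
floor-≤ : ∀ {r s x y d} → FloorLimit r x → FloorLimit s y → (λ N → s N - r N) ⟶ ⟦ d ⟧ → y ℤ.≤ x ℤ.+ d
floor-≤ {r} {s} {x} {y} {d} fr fs s-r⟶d =
  let η , 0<η , upper = above fr
      ε = ℚ.½ * η
      N , _ , r+η<x+1 , y≤s+ε , close = eventually-witness 0 (eventually-× upper (eventually-× (below fs ε (½*-pos 0<η)) (eventually s-r⟶d ε (½*-pos 0<η))))
  in +1-cancel-≤ (ℤ.≤-trans (ℤ.≤-reflexive (ℤ.+-comm y ℤ.1ℤ)) (ℤ.i<j⇒suc[i]≤j (⟦⟧-cancel-<
       (<-by (ℚ.+-mono-<-≤ r+η<x+1 (ℚ.+-mono-≤ y≤s+ε (ℚ.≤-trans (p≤∣p∣ (s N - r N - ⟦ d ⟧)) close)))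
         (trans (cong (_- ⟦ y ⟧) (trans (⟦⟧-suc (x ℤ.+ d)) (cong (_+ 1ℚ) (⟦⟧-+ x d))))
           (solve 6 (λ x y d r s η → x :+ d :+ con 1ℚ :- y := (x :+ con 1ℚ :+ (s :+ con ℚ.½ :* η :+ con ℚ.½ :* η)) :- (r :+ η :+ (y :+ (s :- r :- d)))) refl
             ⟦ x ⟧ ⟦ y ⟧ ⟦ d ⟧ (r N) (s N) η))))))

floor-shift : ∀ {r s x y d} → FloorLimit r x → FloorLimit s y → (λ N → s N - r N) ⟶ ⟦ d ⟧ → y ≡ x ℤ.+ d
floor-shift {r} {s} {x} {y} {d} fr fs h = ℤ.≤-antisym (floor-≤ fr fs h)
  (ℤ.≤-trans (ℤ.+-monoˡ-≤ d (floor-≤ fs fr (⟶-≗ (λ N → solve 2 (λ r s → :- (s :- r) := r :- s) refl (r N) (s N)) (sym (⟦⟧-neg d)) (⟶-neg h))))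
    (ℤ.≤-reflexive (ℤsolve 2 (λ y d → y ⊕ (⊖ d) ⊕ d ⊜ y) refl y d)))

-- P z itself may be irrational, but P z - P 0 is rational and a polynomial in z, hence periodic
-- modulo m. So P (z + T) and P z differ by a multiple of m, and their floors differ by the same
-- multiple.
rational⇒periodic : ∀ {n P} → Poly (suc n) P → ∀ {a : ℕ → ℤ} → (∀ z → FloorLimit (λ N → P N (ι z)) (a z)) →
  RationalIncrements P → ∀ m → 1 ≤ m → ∃[ T ] 1 ≤ T × ∀ z → ∃[ k ] a (z ℕ.+ T) ≡ a z ℤ.+ k ℤ.* ℤ.+ m
rational⇒periodic {n} {P} p floors rational m 1≤m =
  let T , 1≤T , periodic = vanishing⇒periodic (suc n) V
        (limit-vanishing V (Poly-- p (Poly-const (mkℝ (λ N → P N 0ℚ) (Poly-cauchy p 0ℚ)))) (λ z → proj₂ (rational (ι z)))) m 1≤m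
  in T , 1≤T , λ z →
     let k , e = periodic z
     in k , floor-shift (floors z) (floors (z ℕ.+ T))
          (⟶-≗ (λ N → solve 3 (λ a b c → a :- c :- (b :- c) := a :- b) refl (P N (ι (z ℕ.+ T))) (P N (ι z)) (P N 0ℚ))
            (trans e (sym (⟦⟧-* k (ℤ.+ m)))) (⟶-- (proj₂ (rational (ι (z ℕ.+ T)))) (proj₂ (rational (ι z)))))
  where
  V : ℕ → ℚ
  V z = proj₁ (rational (ι z))

-- One sign for many progressions

¬¬-sequence : ∀ {Q : ℕ → Set} M → (∀ i → ¬ ¬ Q i) → ¬ ¬ (∀ i → i ℕ.< M → Q i)
¬¬-sequence zero h k = k λ _ ()
¬¬-sequence {Q} (suc M) h k = ¬¬-sequence M h λ all → h M λ q → k λ i i<1+M → choose all q i (ℕ.m≤n⇒m<n∨m≡n (ℕ.≤-pred i<1+M))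
  where
  choose : (∀ i → i ℕ.< M → Q i) → Q M → ∀ i → i ℕ.< M ⊎ i ≡ M → Q i
  choose all q i (inj₁ i<M) = all i i<M
  choose all q i (inj₂ refl) = q

Selection : (ℕ → Set) → ℕ → ℕ → Set
Selection P s a = Σ[ c ∈ (ℕ → ℕ) ] (∀ j → j ℕ.< a → s ≤ c j × P (c j)) × (∀ i j → i ℕ.< j → j ℕ.< a → c i ℕ.< c j)

selection-none : ∀ {P : ℕ → Set} s → Selection P s 0
selection-none s = (λ _ → s) , (λ _ ()) , (λ _ _ _ ())

selection-≤ : ∀ {P : ℕ → Set} {s t a} → s ≤ t → Selection P t a → Selection P s a
selection-≤ s≤t (c , h , inc) = c , (λ j j<a → let t≤c , p = h j j<a in ℕ.≤-trans s≤t t≤c , p) , inc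

selection-cons : ∀ {P : ℕ → Set} {s a} → P s → Selection P (suc s) a → Selection P s (suc a)
selection-cons {P} {s} {a} ps (c , h , inc) = c′ , h′ , inc′
  where
  c′ : ℕ → ℕ
  c′ zero    = s
  c′ (suc j) = c j
  h′ : ∀ j → j ℕ.< suc a → s ≤ c′ j × P (c′ j)
  h′ zero    _         = ℕ.≤-refl , ps
  h′ (suc j) (s≤s j<a) = let s<c , p = h j j<a in ℕ.<⇒≤ s<c , p
  inc′ : ∀ i j → i ℕ.< j → j ℕ.< suc a → c′ i ℕ.< c′ j
  inc′ zero    (suc j) _         (s≤s j<a) = proj₁ (h j j<a)
  inc′ (suc i) (suc j) (s≤s i<j) (s≤s j<a) = inc i j i<j j<a

select : ∀ {P Q : ℕ → Set} a b s → (∀ i → i ℕ.< s ℕ.+ (a ℕ.+ b) → P i ⊎ Q i) → Selection P s a ⊎ Selection Q s b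
select {P} zero b s h = inj₁ (selection-none {P} s)
select {Q = Q} (suc a) zero s h = inj₂ (selection-none {Q} s)
select {P} {Q} (suc a) (suc b) s h with h s (ℕ.m<m+n s (s≤s z≤n))
... | inj₁ p = extend (select a (suc b) (suc s) λ i i< → h i (ℕ.<-≤-trans i< (ℕ.≤-reflexive (sym (ℕ.+-suc s (a ℕ.+ suc b))))))
  where
  extend : Selection P (suc s) a ⊎ Selection Q (suc s) (suc b) → Selection P s (suc a) ⊎ Selection Q s (suc b)
  extend (inj₁ c) = inj₁ (selection-cons {P} p c)
  extend (inj₂ c) = inj₂ (selection-≤ {Q} (ℕ.n≤1+n s) c)
... | inj₂ q = extend (select (suc a) b (suc s) λ i i< → h i (ℕ.<-≤-trans i< (ℕ.≤-reflexive
        (trans (sym (ℕ.+-suc s (suc a ℕ.+ b))) (cong (s ℕ.+_) (sym (ℕ.+-suc (suc a) b)))))))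
  where
  extend : Selection P (suc s) (suc a) ⊎ Selection Q (suc s) b → Selection P s (suc a) ⊎ Selection Q s (suc b)
  extend (inj₁ c) = inj₁ (selection-≤ {P} (ℕ.n≤1+n s) c)
  extend (inj₂ c) = inj₂ (selection-cons {Q} q c)

FloorLimit-≗ : ∀ {r s z} → (∀ N → r N ≡ s N) → FloorLimit r z → FloorLimit s z
FloorLimit-≗ {z = z} e h = record
  { below = λ η 0<η → eventually-map (λ N → subst (λ t → ⟦ z ⟧ ≤ℚ t + η) (e N)) (below h η 0<η)
  ; above = let η , 0<η , upper = above h in η , 0<η , eventually-map (λ N → subst (λ t → t + η <ℚ ⟦ z ⟧ + 1ℚ) (e N)) upper
  }

module Progressions {n P} (p : Poly (suc n) P) {m} (2≤m : 2 ≤ m) {a : ℕ → ℤ} (floors : ∀ z → FloorLimit (λ N → P N (ι z)) (a z))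
  {K u h} (1≤K : 1 ≤ K) (1≤h : 1 ≤ h) (congruent : ∀ x → ∃[ z ] a (K ℕ.* x ℕ.+ u) ≡ a (K ℕ.* x ℕ.+ u ℕ.+ h) ℤ.+ z ℤ.* ℤ.+ m) where

  base : ℕ → ℕ
  base x = K ℕ.* x ℕ.+ u

  base-+ : ∀ v x y → (K ℕ.* x ℕ.+ v) ℕ.+ K ℕ.* y ≡ K ℕ.* (x ℕ.+ y) ℕ.+ v
  base-+ v x y = trans (ℕ.+-assoc (K ℕ.* x) v (K ℕ.* y)) (trans (cong (K ℕ.* x ℕ.+_) (ℕ.+-comm v (K ℕ.* y)))
    (trans (sym (ℕ.+-assoc (K ℕ.* x) (K ℕ.* y) v)) (cong (ℕ._+ v) (sym (ℕ.*-distribˡ-+ K x y)))))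

  along : ℕ → ℕ → ℚ → ℚ
  along Z N x = P N (ι Z + ι K * x)

  along-ι : ∀ Z y N → along Z N (ι y) ≡ P N (ι (Z ℕ.+ K ℕ.* y))
  along-ι Z y N = cong (P N) (trans (cong (ι Z +_) (sym (ι-* K y))) (sym (ι-+ Z (K ℕ.* y))))

  along-floors : ∀ Z y → FloorLimit (λ N → along Z N (ι y)) (a (Z ℕ.+ K ℕ.* y))
  along-floors Z y = FloorLimit-≗ (λ N → sym (along-ι Z y N)) (floors (Z ℕ.+ K ℕ.* y))

  along-congruent : ∀ x y → ∃[ z ] a (base x ℕ.+ K ℕ.* y) ≡ a (base x ℕ.+ h ℕ.+ K ℕ.* y) ℤ.+ z ℤ.* ℤ.+ m
  along-congruent x y = let z , e = congruent (x ℕ.+ y) in z , trans (cong a (base-+ u x y)) (trans e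
    (cong (λ t → a t ℤ.+ z ℤ.* ℤ.+ m) (trans (cong (ℕ._+ h) (sym (base-+ u x y)))
      (trans (ℕ.+-assoc (base x) (K ℕ.* y) h) (trans (cong (base x ℕ.+_) (ℕ.+-comm (K ℕ.* y) h)) (sym (ℕ.+-assoc (base x) h (K ℕ.* y))))))))

  Combines : Direction → ℕ → Set
  Combines e x = HasLimit (λ N → P N (ι (base x)) - e ◀ P N (ι (base x) + ι h))

  at : ∀ x → ¬ ¬ (RationalIncrements P ⊎ (Combines up x ⊎ Combines down x))
  at x k = integer-combination (Poly-affine (ι (base x)) (ι K) p) (Poly-affine (ι (base x ℕ.+ h)) (ι K) p) 2≤m
    (along-floors (base x)) (along-floors (base x ℕ.+ h)) (along-congruent x) λ where
      (inj₁ degenerate) → k (inj₁ (degenerate⇒rational p (base x) K 1≤K degenerate))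
      (inj₂ (up   , γ , l)) → k (inj₂ (inj₁ (combines up γ l)))
      (inj₂ (down , γ , l)) → k (inj₂ (inj₂ (combines down γ l)))
    where
    start : ∀ Z → ι Z + ι K * 0ℚ ≡ ι Z
    start Z = trans (cong (ι Z +_) (ℚ.*-zeroʳ (ι K))) (ℚ.+-identityʳ (ι Z))
    combines : ∀ e γ → (λ N → along (base x) N 0ℚ - e ◀ along (base x ℕ.+ h) N 0ℚ) ⟶ ⟦ γ ⟧ → Combines e x
    combines e γ l = ⟦ γ ⟧ , ⟶-≗ (λ N → cong₂ (λ s t → P N s - e ◀ P N t) (start (base x)) (trans (start (base x ℕ.+ h)) (ι-+ (base x) h))) refl l

  rational-if-combines : ∀ e → Selection (Combines e) 0 (suc n) → RationalIncrements P
  rational-if-combines e (c , combines , increasing) = rational-translates p h 1≤h e (λ j → ι (base (c j)))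
    (λ i j i<j j<1+n eq → ℕ.<⇒≢ (increasing i j i<j j<1+n) (sym (ℕ.*-cancelˡ-≡ (c j) (c i) K {{ℕ.>-nonZero 1≤K}}
      (ℕ.+-cancelʳ-≡ u (K ℕ.* c j) (K ℕ.* c i) (ι-injective eq)))))
    (λ j j<1+n → proj₂ (combines j j<1+n))

  rational : ¬ ¬ RationalIncrements P
  -- Double negations can be pulled out of finitely many instances, so 2 (n + 1) values of x are
  -- taken: one of the two signs then occurs at n + 1 of them, as many as the nodes required.
  rational k = ¬¬-sequence (suc n ℕ.+ suc n) at λ all →
    conclude (select (suc n) (suc n) 0 λ i i<2n → exclude (all i i<2n))
    where
    exclude : ∀ {i} → RationalIncrements P ⊎ (Combines up i ⊎ Combines down i) → Combines up i ⊎ Combines down i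
    exclude (inj₁ r) = ⊥-elim (k r)
    exclude (inj₂ c) = c
    conclude : Selection (Combines up) 0 (suc n) ⊎ Selection (Combines down) 0 (suc n) → ⊥
    conclude (inj₁ s) = k (rational-if-combines up s)
    conclude (inj₂ s) = k (rational-if-combines down s)

  periodic : ¬ ¬ (∃[ T ] 1 ≤ T × ∀ z → ∃[ k ] a (z ℕ.+ T) ≡ a z ℤ.+ k ℤ.* ℤ.+ m)
  periodic k = rational λ r → k (rational⇒periodic p floors r m (ℕ.≤-trans (s≤s z≤n) 2≤m))

-- Automata

digit-unique : ∀ {k} (c c′ : Fin k) x x′ → toℕ c ℕ.+ x ℕ.* k ≡ toℕ c′ ℕ.+ x′ ℕ.* k → c ≡ c′ × x ≡ x′
digit-unique {suc k-1} c c′ x x′ e = c≡c′ , ℕ.*-cancelʳ-≡ x x′ k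
  (ℕ.+-cancelˡ-≡ (toℕ c) (x ℕ.* k) (x′ ℕ.* k) (trans e (cong (λ t → toℕ t ℕ.+ x′ ℕ.* k) (sym c≡c′))))
  where
  k = suc k-1
  remainder : ∀ (c : Fin k) x → (toℕ c ℕ.+ x ℕ.* k) ℕ.% k ≡ toℕ c
  remainder c x = trans (ℕ.[m+kn]%n≡m%n (toℕ c) x k) (ℕ.m<n⇒m%n≡m (Fin.toℕ<n c))
  c≡c′ : c ≡ c′
  c≡c′ = Fin.toℕ-injective (trans (sym (remainder c x)) (trans (cong (ℕ._% k) e) (remainder c′ x′)))

module _ {k N} (δ : Fin N → Fin k → Fin N) (start : Fin N) where

  -- The reading of a number whose digits are given least significant digit first; the
  -- additional state zero is kept as long as only leading zeros have been read.
  unstarted : Fin (suc N) → Fin N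
  unstarted Fin.zero    = start
  unstarted (Fin.suc s) = s

  step₀ : Fin (suc N) → Fin k → Fin (suc N)
  step₀ Fin.zero    d@Fin.zero    = Fin.zero
  step₀ Fin.zero    d@(Fin.suc _) = Fin.suc (δ start d)
  step₀ (Fin.suc s) d             = Fin.suc (δ s d)

  run-suc : ∀ s w → foldl step₀ (Fin.suc s) w ≡ Fin.suc (foldl δ s w)
  run-suc s []      = refl
  run-suc s (d ∷ w) = run-suc (δ s d) w

  run-dropWhile : ∀ w → unstarted (foldl step₀ Fin.zero w) ≡ foldl δ start (dropWhile (λ d → toℕ d ℕ.≟ 0) w)
  run-dropWhile [] = refl
  run-dropWhile (Fin.zero ∷ w)        = run-dropWhile w
  run-dropWhile (d@(Fin.suc _) ∷ w) = cong unstarted (run-suc (δ start d) w)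

  readDigits : List (Fin k) → Fin (suc N)
  readDigits = foldr (flip step₀) Fin.zero

  step₀-0 : ∀ d → toℕ d ≡ 0 → step₀ Fin.zero d ≡ Fin.zero
  step₀-0 Fin.zero e = refl

  readDigits-0 : ∀ l → fromDigits l ≡ 0 → readDigits l ≡ Fin.zero
  readDigits-0 [] _ = refl
  readDigits-0 (d ∷ l) e = trans (cong (λ s → step₀ s d) (readDigits-0 l l≡0)) (step₀-0 d (ℕ.m+n≡0⇒m≡0 (toℕ d) e))
    where
    l≡0 : fromDigits l ≡ 0
    l≡0 with fromDigits l | ℕ.m+n≡0⇒n≡0 (toℕ d) e
    ... | zero  | _ = refl
    ... | suc v | f = ⊥-elim (no-digit d (ℕ.m+n≡0⇒m≡0 k f))
      where
      no-digit : ∀ {k} → Fin k → k ≢ 0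
      no-digit Fin.zero ()
      no-digit (Fin.suc _) ()

  readDigits-cong : ∀ l l′ → fromDigits l ≡ fromDigits l′ → readDigits l ≡ readDigits l′
  readDigits-cong [] l′ e = sym (readDigits-0 l′ (sym e))
  readDigits-cong (d ∷ l) [] e = readDigits-0 (d ∷ l) e
  readDigits-cong (d ∷ l) (d′ ∷ l′) e =
    let d≡d′ , l≡l′ = digit-unique d d′ (fromDigits l) (fromDigits l′) e
    in cong₂ step₀ (readDigits-cong l l′ l≡l′) d≡d′

digitsOf : ∀ k → 2 ≤ k → ℕ → List (Fin k)
digitsOf k 2≤k n = proj₁ (toDigits k {base≥2 = fromWitness 2≤k} n)

fromDigits-digitsOf : ∀ k 2≤k n → fromDigits (digitsOf k 2≤k n) ≡ n
fromDigits-digitsOf k 2≤k n = proj₂ (toDigits k {base≥2 = fromWitness 2≤k} n)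

-- A machine for which leading zeros are harmless: `moves` includes the digit 0 at x = 0. Thus σ (k
-- ^ t x + v) is determined by σ x and the t digits of v even for x = 0, which the given automaton
-- may violate.
record Reading (k : ℕ) {Ω : Set} (a : ℕ → Ω) : Set where
  field
    size  : ℕ
    δ     : Fin size → Fin k → Fin size
    out   : Fin size → Ω
    σ     : ℕ → Fin size
    reads : ∀ n → a n ≡ out (σ n)
    moves : ∀ x c → σ (toℕ c ℕ.+ x ℕ.* k) ≡ δ (σ x) c

automatic⇒reading : ∀ {Ω : Set} {a : ℕ → Ω} k 2≤k → IsAutomaticIn k 2≤k a → Reading k a
automatic⇒reading {a = a} k 2≤k (𝒜 , computes) = record
  { size  = suc (Automaton.numStates 𝒜)
  ; δ     = step₀ (Automaton.step 𝒜) (Automaton.start 𝒜)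
  ; out   = λ s → Automaton.output 𝒜 (unstarted (Automaton.step 𝒜) (Automaton.start 𝒜) s)
  ; σ     = σ
  ; reads = λ n → trans (computes n) (cong (Automaton.output 𝒜) (sym (trans
      (cong (unstarted (Automaton.step 𝒜) (Automaton.start 𝒜)) (sym (reverse-foldl (step₀ (Automaton.step 𝒜) (Automaton.start 𝒜)) Fin.zero (digitsOf k 2≤k n))))
      (run-dropWhile (Automaton.step 𝒜) (Automaton.start 𝒜) (reverse (digitsOf k 2≤k n))))))
  ; moves = λ x c → readDigits-cong (Automaton.step 𝒜) (Automaton.start 𝒜) (digitsOf k 2≤k (toℕ c ℕ.+ x ℕ.* k)) (c ∷ digitsOf k 2≤k x)
      (trans (fromDigits-digitsOf k 2≤k (toℕ c ℕ.+ x ℕ.* k)) (cong (λ t → toℕ c ℕ.+ t ℕ.* k) (sym (fromDigits-digitsOf k 2≤k x))))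
  }
  where
  σ : ℕ → Fin (suc (Automaton.numStates 𝒜))
  σ n = readDigits (Automaton.step 𝒜) (Automaton.start 𝒜) (digitsOf k 2≤k n)

+-*-periodic : ∀ {Ω : Set} {a : ℕ → Ω} {T} → (∀ n → a (n ℕ.+ T) ≡ a n) → ∀ q n → a (n ℕ.+ q ℕ.* T) ≡ a n
+-*-periodic {a = a} p zero n = cong a (ℕ.+-identityʳ n)
+-*-periodic {a = a} {T} p (suc q) n = trans (cong a (sym (ℕ.+-assoc n T (q ℕ.* T)))) (trans (+-*-periodic p q (n ℕ.+ T)) (p n))

-- Horner's scheme modulo T in base 2, with residues as states. A leading 0 keeps the residue 0, so
-- dropping zeros makes no difference.
periodic⇒automatic : ∀ {Ω : Set} {a : ℕ → Ω} → IsPeriodic a → IsAutomatic a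
periodic⇒automatic {Ω} {a} (T , 1≤T , periodic) = 2 , ℕ.≤-refl , 𝒜 , λ n → trans (reduced n) (cong (λ s → a (toℕ s)) (sym (computes n)))
  where
  instance
    T-nonZero : NonZero T
    T-nonZero = ℕ.>-nonZero 1≤T
  residueOf : ℕ → Fin T
  residueOf n = fromℕ< (ℕ.m%n<n n T)
  toℕ-residue : ∀ n → toℕ (residueOf n) ≡ n ℕ.% T
  toℕ-residue n = Fin.toℕ-fromℕ< (ℕ.m%n<n n T)
  next : Fin T → Fin 2 → Fin T
  next s c = residueOf (toℕ c ℕ.+ toℕ s ℕ.* 2)
  𝒜 : Automaton 2 Ω
  𝒜 = record { numStates = T ; start = residueOf 0 ; step = next ; output = λ s → a (toℕ s) }
  next-residue : ∀ n c → next (residueOf n) c ≡ residueOf (toℕ c ℕ.+ n ℕ.* 2)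
  next-residue n c = Fin.toℕ-injective (trans (toℕ-residue _) (trans (cong (λ t → (toℕ c ℕ.+ t ℕ.* 2) ℕ.% T) (toℕ-residue n))
    (trans (trans (ℕ.%-distribˡ-+ (toℕ c) (n ℕ.% T ℕ.* 2) T)
      (trans (cong (λ t → (toℕ c ℕ.% T ℕ.+ t) ℕ.% T) (trans (ℕ.%-distribˡ-* (n ℕ.% T) 2 T)
        (trans (cong (λ t → (t ℕ.* (2 ℕ.% T)) ℕ.% T) (ℕ.m%n%n≡m%n n T)) (sym (ℕ.%-distribˡ-* n 2 T)))))
        (sym (ℕ.%-distribˡ-+ (toℕ c) (n ℕ.* 2) T)))) (sym (toℕ-residue _)))))
  skip-zeros : ∀ w → foldl next (residueOf 0) (dropWhile (λ d → toℕ d ℕ.≟ 0) w) ≡ foldl next (residueOf 0) w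
  skip-zeros [] = refl
  skip-zeros (Fin.zero ∷ w)  = trans (skip-zeros w) (cong (λ s → foldl next s w) (sym (next-residue 0 Fin.zero)))
  skip-zeros (Fin.suc _ ∷ w) = refl
  value : ∀ l → foldr (flip next) (residueOf 0) l ≡ residueOf (fromDigits l)
  value []      = refl
  value (d ∷ l) = trans (cong (λ s → next s d) (value l)) (next-residue (fromDigits l) d)
  computes : ∀ n → foldl next (residueOf 0) (representation 2 ℕ.≤-refl n) ≡ residueOf n
  computes n = trans (skip-zeros (reverse (digitsOf 2 ℕ.≤-refl n))) (trans (reverse-foldl next (residueOf 0) (digitsOf 2 ℕ.≤-refl n))
    (trans (value (digitsOf 2 ℕ.≤-refl n)) (cong residueOf (fromDigits-digitsOf 2 ℕ.≤-refl n))))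
  reduced : ∀ n → a n ≡ a (toℕ (residueOf n))
  reduced n = trans (cong a (ℕ.m≡m%n+[m/n]*n n T)) (trans (+-*-periodic {a = a} periodic (n ℕ./ T) (n ℕ.% T)) (cong a (sym (toℕ-residue n))))

n<b^n : ∀ {b} → 2 ≤ b → ∀ n → n ℕ.< b ℕ.^ n
n<b^n 2≤b zero = s≤s z≤n
n<b^n {b} 2≤b (suc n) = ℕ.≤-trans (ℕ.+-mono-≤ (ℕ.≤-trans (s≤s z≤n) (n<b^n 2≤b n)) (n<b^n 2≤b n))
  (ℕ.≤-trans (ℕ.≤-reflexive (cong (b ℕ.^ n ℕ.+_) (sym (ℕ.+-identityʳ (b ℕ.^ n))))) (ℕ.*-monoˡ-≤ (b ℕ.^ n) 2≤b))

-- Shifts and periods of a sequence read by an automaton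

module Read {k} (2≤k : 2 ≤ k) {Ω : Set} {a : ℕ → Ω} (ρ : Reading k a) where

  open Reading ρ

  instance
    k-nonZero : NonZero k
    k-nonZero = ℕ.>-nonZero (ℕ.≤-trans (s≤s z≤n) 2≤k)

  high low : ℕ → ℕ → ℕ
  high t v = (v ℕ./ k ℕ.^ t) {{ℕ.m^n≢0 k t}}
  low t v  = (v ℕ.% k ℕ.^ t) {{ℕ.m^n≢0 k t}}

  low< : ∀ t v → low t v ℕ.< k ℕ.^ t
  low< t v = ℕ.m%n<n v (k ℕ.^ t) {{ℕ.m^n≢0 k t}}

  high< : ∀ t {v} → v ℕ.< k ℕ.^ suc t → high t v ℕ.< k
  high< t {v} = ℕ.m<n*o⇒m/o<n {v} {k} {k ℕ.^ t} {{ℕ.m^n≢0 k t}}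

  high-low : ∀ t v → v ≡ high t v ℕ.* k ℕ.^ t ℕ.+ low t v
  high-low t v = trans (ℕ.m≡m%n+[m/n]*n v (k ℕ.^ t) {{ℕ.m^n≢0 k t}}) (ℕ.+-comm (low t v) (high t v ℕ.* k ℕ.^ t))

  digit : ℕ → Fin k
  digit v = fromℕ< (ℕ.m%n<n v k)

  -- Reads v as a word of exactly t digits, leading zeros included; the last digit is peeled off
  -- first and read last.
  readWord : ℕ → ℕ → Fin size → Fin size
  readWord zero    v s = s
  readWord (suc t) v s = δ (readWord t (v ℕ./ k) s) (digit v)

  v/k<k^t : ∀ t {v} → v ℕ.< k ℕ.^ suc t → v ℕ./ k ℕ.< k ℕ.^ t
  v/k<k^t t {v} v< = ℕ.m<n*o⇒m/o<n (subst (v ℕ.<_) (ℕ.*-comm k (k ℕ.^ t)) v<)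

  σ-word : ∀ t v x → v ℕ.< k ℕ.^ t → σ (k ℕ.^ t ℕ.* x ℕ.+ v) ≡ readWord t v (σ x)
  σ-word zero zero x _ = cong σ (trans (ℕ.+-identityʳ (1 ℕ.* x)) (ℕ.*-identityˡ x))
  σ-word zero (suc v) x (s≤s ())
  σ-word (suc t) v x v< = trans (cong σ split)
    (trans (moves (k ℕ.^ t ℕ.* x ℕ.+ v ℕ./ k) (digit v)) (cong (λ s → δ s (digit v)) (σ-word t (v ℕ./ k) x (v/k<k^t t v<))))
    where
    split : k ℕ.^ suc t ℕ.* x ℕ.+ v ≡ toℕ (digit v) ℕ.+ (k ℕ.^ t ℕ.* x ℕ.+ v ℕ./ k) ℕ.* k
    split = trans (cong (k ℕ.^ suc t ℕ.* x ℕ.+_) (ℕ.m≡m%n+[m/n]*n v k))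
      (trans (ℕsolve 5 (λ k p x r q → (k :+* p) :+* x :++ (r :++ q :+* k) :≡ r :++ (p :+* x :++ q) :+* k) refl k (k ℕ.^ t) x (v ℕ.% k) (v ℕ./ k))
        (cong (ℕ._+ (k ℕ.^ t ℕ.* x ℕ.+ v ℕ./ k) ℕ.* k) (sym (Fin.toℕ-fromℕ< (ℕ.m%n<n v k)))))

  -- Obtained from two different words of the same length that act in the same way on the states.
  shifted-progression : ∃[ K ] ∃[ u ] ∃[ h ] 1 ≤ K × 1 ≤ h × (∀ x → a (K ℕ.* x ℕ.+ u) ≡ a (K ℕ.* x ℕ.+ u ℕ.+ h))
  shifted-progression =
    let u , w , u<w , same = Fin.pigeonhole (n<b^n 2≤k t) action
    in k ℕ.^ t , toℕ u , toℕ w ℕ.∸ toℕ u , ℕ.m^n>0 k t , ℕ.m<n⇒0<n∸m u<w , λ x →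
       trans (reads (k ℕ.^ t ℕ.* x ℕ.+ toℕ u)) (trans (cong out (trans (σ-word t (toℕ u) x (Fin.toℕ<n u))
         (trans (trans (sym (Fin.finToFun-funToFin (readWord t (toℕ u)) (σ x)))
             (trans (cong (λ c → Fin.finToFun c (σ x)) same) (Fin.finToFun-funToFin (readWord t (toℕ w)) (σ x))))
           (trans (sym (σ-word t (toℕ w) x (Fin.toℕ<n w)))
             (cong σ (trans (cong (k ℕ.^ t ℕ.* x ℕ.+_) (sym (ℕ.m+[n∸m]≡n (ℕ.<⇒≤ u<w)))) (sym (ℕ.+-assoc (k ℕ.^ t ℕ.* x) (toℕ u) (toℕ w ℕ.∸ toℕ u)))))))))
         (sym (reads (k ℕ.^ t ℕ.* x ℕ.+ toℕ u ℕ.+ (toℕ w ℕ.∸ toℕ u)))))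
    where
    -- There are size ^ size self-maps of the states, and the k ^ t > t words of length t outnumber
    -- them.
    t = size ℕ.^ size
    action : Fin (k ℕ.^ t) → Fin (size ℕ.^ size)
    action v = Fin.funToFin (readWord t (toℕ v))

  -- Indistinguishability by words of length exactly t: for the states of x and y it means that the
  -- blocks of length k ^ t numbered x and y agree. Fixing the length makes each relation determine
  -- the next one.
  Equivalent : ℕ → Fin size → Fin size → Set
  Equivalent zero    s s′ = out s ≡ out s′
  Equivalent (suc t) s s′ = ∀ c → Equivalent t (δ s c) (δ s′ c)

  first-digit : ∀ t x c v → k ℕ.^ suc t ℕ.* x ℕ.+ (c ℕ.* k ℕ.^ t ℕ.+ v) ≡ k ℕ.^ t ℕ.* (c ℕ.+ x ℕ.* k) ℕ.+ v
  first-digit t x c v = ℕsolve 5 (λ k p x c v → (k :+* p) :+* x :++ (c :+* p :++ v) :≡ p :+* (c :++ x :+* k) :++ v) refl k (k ℕ.^ t) x c v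

  equivalent⇒equal : ∀ t x y → Equivalent t (σ x) (σ y) → ∀ v → v ℕ.< k ℕ.^ t → a (k ℕ.^ t ℕ.* x ℕ.+ v) ≡ a (k ℕ.^ t ℕ.* y ℕ.+ v)
  equivalent⇒equal zero x y h zero _ = trans (trans (cong a (trans (ℕ.+-identityʳ (1 ℕ.* x)) (ℕ.*-identityˡ x))) (reads x))
    (trans h (trans (sym (reads y)) (cong a (sym (trans (ℕ.+-identityʳ (1 ℕ.* y)) (ℕ.*-identityˡ y))))))
  equivalent⇒equal zero x y h (suc v) (s≤s ())
  equivalent⇒equal (suc t) x y h v v< = trans (cong a (at x)) (trans
    (equivalent⇒equal t (toℕ c ℕ.+ x ℕ.* k) (toℕ c ℕ.+ y ℕ.* k) (subst₂ (Equivalent t) (sym (moves x c)) (sym (moves y c)) (h c))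
      (low t v) (low< t v)) (cong a (sym (at y))))
    where
    c : Fin k
    c = fromℕ< (high< t v<)
    at : ∀ x → k ℕ.^ suc t ℕ.* x ℕ.+ v ≡ k ℕ.^ t ℕ.* (toℕ c ℕ.+ x ℕ.* k) ℕ.+ low t v
    at x = trans (cong (k ℕ.^ suc t ℕ.* x ℕ.+_) (trans (high-low t v)
        (cong (λ q → q ℕ.* k ℕ.^ t ℕ.+ low t v) (sym (Fin.toℕ-fromℕ< (high< t v<))))))
      (first-digit t x (toℕ c) (low t v))

  equal⇒equivalent : ∀ t x y → (∀ v → v ℕ.< k ℕ.^ t → a (k ℕ.^ t ℕ.* x ℕ.+ v) ≡ a (k ℕ.^ t ℕ.* y ℕ.+ v)) → Equivalent t (σ x) (σ y)
  equal⇒equivalent zero x y h = trans (sym (reads x)) (trans (trans (cong a (sym (trans (ℕ.+-identityʳ (1 ℕ.* x)) (ℕ.*-identityˡ x))))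
    (trans (h 0 (s≤s z≤n)) (cong a (trans (ℕ.+-identityʳ (1 ℕ.* y)) (ℕ.*-identityˡ y))))) (reads y))
  equal⇒equivalent (suc t) x y h c = subst₂ (Equivalent t) (moves x c) (moves y c)
    (equal⇒equivalent t (toℕ c ℕ.+ x ℕ.* k) (toℕ c ℕ.+ y ℕ.* k) λ v v< → trans (cong a (sym (first-digit t x (toℕ c) v)))
      (trans (h (toℕ c ℕ.* k ℕ.^ t ℕ.+ v) (ℕ.<-≤-trans (ℕ.+-monoʳ-< (toℕ c ℕ.* k ℕ.^ t) v<)
          (ℕ.≤-trans (ℕ.≤-reflexive (ℕ.+-comm (toℕ c ℕ.* k ℕ.^ t) (k ℕ.^ t))) (ℕ.*-monoˡ-≤ (k ℕ.^ t) (Fin.toℕ<n c)))))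
        (cong a (first-digit t y (toℕ c) v))))

  Period : ℕ → Set
  Period T = ∀ n → a (n ℕ.+ T) ≡ a n

  -- The blocks of length k ^ t numbered x + M and x agree for every x, which amounts to k ^ t M
  -- being a period.
  Shift : ℕ → ℕ → Set
  Shift M t = ∀ x → Equivalent t (σ (x ℕ.+ M)) (σ x)

  shift⇒period : ∀ M t → Shift M t → Period (k ℕ.^ t ℕ.* M)
  shift⇒period M t shift n = trans (cong a (trans (cong (ℕ._+ k ℕ.^ t ℕ.* M) n≡)
      (ℕsolve 4 (λ p q v M → p :+* q :++ v :++ p :+* M :≡ p :+* (q :++ M) :++ v) refl (k ℕ.^ t) (high t n) (low t n) M)))
    (trans (equivalent⇒equal t (high t n ℕ.+ M) (high t n) (shift (high t n)) (low t n) (low< t n)) (cong a (sym n≡)))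
    where
    n≡ : n ≡ k ℕ.^ t ℕ.* high t n ℕ.+ low t n
    n≡ = trans (high-low t n) (cong (ℕ._+ low t n) (ℕ.*-comm (high t n) (k ℕ.^ t)))

  period⇒shift : ∀ M t → Period (k ℕ.^ t ℕ.* M) → Shift M t
  period⇒shift M t period x = equal⇒equivalent t (x ℕ.+ M) x λ v _ →
    trans (cong a (ℕsolve 4 (λ p q v M → p :+* (q :++ M) :++ v :≡ p :+* q :++ v :++ p :+* M) refl (k ℕ.^ t) x v M)) (period (k ℕ.^ t ℕ.* x ℕ.+ v))

  period-* : ∀ {T} q → Period T → Period (q ℕ.* T)
  period-* q p n = +-*-periodic {a = a} p q n

  -- The numbers x , x + M read into the same state, so a is invariant under k ^ t * M on
  -- a block of length k ^ t; if that exceeds a period of a then the invariance is global.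
  invariant-shift : ∃[ M ] 1 ≤ M × (∀ {T} → 1 ≤ T → Period T → ∀ t → T ≤ k ℕ.^ t → Period (k ℕ.^ t ℕ.* M))
  invariant-shift =
    let i , j , i<j , same = Fin.pigeonhole (ℕ.n<1+n size) (λ (i : Fin (suc size)) → σ (toℕ i))
    in toℕ j ℕ.∸ toℕ i , ℕ.m<n⇒0<n∸m i<j , λ {T} 1≤T p t T≤ n →
       global (toℕ i) (toℕ j ℕ.∸ toℕ i) (trans (cong σ (ℕ.m+[n∸m]≡n (ℕ.<⇒≤ i<j))) (sym same)) {T} 1≤T p t T≤ n
    where
    global : ∀ i M → σ (i ℕ.+ M) ≡ σ i → ∀ {T} → 1 ≤ T → Period T → ∀ t → T ≤ k ℕ.^ t → Period (k ℕ.^ t ℕ.* M)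
    global i M same {T@(suc T-1)} _ p t T≤ n = trans (sym (+-*-periodic {a = a} p q (n ℕ.+ k ℕ.^ t ℕ.* M)))
      (trans (cong a moved) (trans (+-*-periodic {a = a} p Q (k ℕ.^ t ℕ.* (i ℕ.+ M) ℕ.+ r))
        (trans same-block (trans (sym (+-*-periodic {a = a} p Q (k ℕ.^ t ℕ.* i ℕ.+ r))) (trans (cong a (sym start)) (+-*-periodic {a = a} p q n))))))
      where
      q = k ℕ.^ t ℕ.* i
      -- `n` is moved forward by q periods, past the beginning q of the block. Its position relative
      -- to the block is then n + q T - q = n + q (T - 1), which is reduced modulo T to r < k ^ t.
      r = (n ℕ.+ q ℕ.* T-1) ℕ.% T
      Q = (n ℕ.+ q ℕ.* T-1) ℕ./ T
      r< : r ℕ.< k ℕ.^ t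
      r< = ℕ.<-≤-trans (ℕ.m%n<n (n ℕ.+ q ℕ.* T-1) T) T≤
      start : n ℕ.+ q ℕ.* T ≡ (q ℕ.+ r) ℕ.+ Q ℕ.* T
      start = trans (ℕsolve 3 (λ n q T → n :++ q :+* (ℕcon 1 :++ T) :≡ q :++ (n :++ q :+* T)) refl n q T-1)
        (trans (cong (q ℕ.+_) (ℕ.m≡m%n+[m/n]*n (n ℕ.+ q ℕ.* T-1) T)) (sym (ℕ.+-assoc q r (Q ℕ.* T))))
      moved : n ℕ.+ k ℕ.^ t ℕ.* M ℕ.+ q ℕ.* T ≡ (k ℕ.^ t ℕ.* (i ℕ.+ M) ℕ.+ r) ℕ.+ Q ℕ.* T
      moved = trans (ℕsolve 3 (λ n m s → n :++ m :++ s :≡ n :++ s :++ m) refl n (k ℕ.^ t ℕ.* M) (q ℕ.* T))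
        (trans (cong (ℕ._+ k ℕ.^ t ℕ.* M) start)
          (ℕsolve 5 (λ p i r s M → p :+* i :++ r :++ s :++ p :+* M :≡ p :+* (i :++ M) :++ r :++ s) refl (k ℕ.^ t) i r (Q ℕ.* T) M))
      same-block : a (k ℕ.^ t ℕ.* (i ℕ.+ M) ℕ.+ r) ≡ a (k ℕ.^ t ℕ.* i ℕ.+ r)
      same-block = trans (reads _) (trans (cong out (trans (σ-word t r (i ℕ.+ M) r<) (trans (cong (readWord t r) same) (sym (σ-word t r i r<))))) (sym (reads _)))

  module _ (_≟Ω_ : ∀ (x y : Ω) → Dec (x ≡ y)) where

    equivalent? : ∀ t s s′ → Dec (Equivalent t s s′)
    equivalent? zero    s s′ = out s ≟Ω out s′
    equivalent? (suc t) s s′ = Fin.all? (λ c → equivalent? t (δ s c) (δ s′ c))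

    bit : ∀ {P : Set} → Dec P → Fin 2
    bit (yes _) = Fin.zero
    bit (no _)  = Fin.suc Fin.zero

    bit-≡ : ∀ {P Q : Set} (p : Dec P) (q : Dec Q) → bit p ≡ bit q → P → Q
    bit-≡ _       (yes q) _ _ = q
    bit-≡ (no ¬p) (no _)  _ p = ⊥-elim (¬p p)

    relations : ℕ
    relations = (2 ℕ.^ size) ℕ.^ size

    code : ℕ → Fin relations
    code t = Fin.funToFin (λ s → Fin.funToFin (λ s′ → bit (equivalent? t s s′)))

    code-≡ : ∀ t t′ → code t ≡ code t′ → ∀ s s′ → Equivalent t s s′ → Equivalent t′ s s′
    code-≡ t t′ e s s′ = bit-≡ (equivalent? t s s′) (equivalent? t′ s s′)
      (trans (sym (Fin.finToFun-funToFin (λ s′ → bit (equivalent? t s s′)) s′))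
        (trans (cong (λ f → Fin.finToFun f s′) (trans (sym (Fin.finToFun-funToFin (λ s → Fin.funToFin (λ s′ → bit (equivalent? t s s′))) s))
            (trans (cong (λ c → Fin.finToFun c s) e) (Fin.finToFun-funToFin (λ s → Fin.funToFin (λ s′ → bit (equivalent? t′ s s′))) s))))
          (Fin.finToFun-funToFin (λ s′ → bit (equivalent? t′ s s′)) s′)))

    -- Equivalent t determines Equivalent (suc t), so this sequence of relations is eventually periodic.
    equivalent-+ : ∀ t t′ → (∀ s s′ → Equivalent t s s′ → Equivalent t′ s s′) → ∀ l s s′ → Equivalent (l ℕ.+ t) s s′ → Equivalent (l ℕ.+ t′) s s′
    equivalent-+ t t′ h zero    s s′ = h s s′
    equivalent-+ t t′ h (suc l) s s′ e c = equivalent-+ t t′ h l (δ s c) (δ s′ c) (e c)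

    -- If there is any period, `Shift M t` holds for all large t. The relations `Equivalent t` form
    -- an orbit in a finite set, so those at some i < j ≤ `relations` coincide, and from a large t
    -- of the form q (j - i) + i the shift descends to i. So k ^ i M is a period, and k ^
    -- `relations` M is a multiple of it that does not depend on the assumed period. As equality of
    -- outputs is decidable, that period may be given under a double negation.
    bounded-period : ∃[ T ] 1 ≤ T × (¬ ¬ (∃[ T′ ] 1 ≤ T′ × Period T′) → Period T)
    bounded-period =
      let M , 1≤M , eventually-period = invariant-shift
      in k ℕ.^ relations ℕ.* M , ℕ.*-mono-≤ (ℕ.m^n>0 k relations) 1≤M , λ ¬¬period n →
         decidable-stable (a (n ℕ.+ k ℕ.^ relations ℕ.* M) ≟Ω a n) λ ≢ → ¬¬period λ { (T′ , 1≤T′ , p) →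
           ≢ (from-period M (λ t T≤ → period⇒shift M t (eventually-period 1≤T′ p t T≤)) n) }
      where
      from-period : ∀ M {T} → (∀ t → T ≤ k ℕ.^ t → Shift M t) → Period (k ℕ.^ relations ℕ.* M)
      from-period M {T} eventual =
        let i , j , i<j , same = Fin.pigeonhole (ℕ.n<1+n relations) (λ (i : Fin (suc relations)) → code (toℕ i))
            d = toℕ j ℕ.∸ toℕ i
            j≡ : d ℕ.+ toℕ i ≡ toℕ j
            j≡ = ℕ.m∸n+n≡m (ℕ.<⇒≤ i<j)
            back : ∀ q s s′ → Equivalent (q ℕ.* d ℕ.+ toℕ i) s s′ → Equivalent (toℕ i) s s′
            back = λ q → descend (toℕ i) d (λ s s′ e → code-≡ (toℕ j) (toℕ i) (sym same) s s′ (subst (λ t → Equivalent t s s′) j≡ e)) q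
            far = T ℕ.* d ℕ.+ toℕ i
            T≤ : T ≤ k ℕ.^ far
            T≤ = ℕ.≤-trans (ℕ.m≤m*n T d {{ℕ.>-nonZero (ℕ.m<n⇒0<n∸m i<j)}}) (ℕ.≤-trans (ℕ.m≤m+n (T ℕ.* d) (toℕ i)) (ℕ.<⇒≤ (n<b^n 2≤k far)))
            period : Period (k ℕ.^ toℕ i ℕ.* M)
            period = shift⇒period M (toℕ i) (λ x → back T (σ (x ℕ.+ M)) (σ x) (eventual far T≤ x))
            i≤ : toℕ i ≤ relations
            i≤ = ℕ.≤-pred (Fin.toℕ<n i)
        in subst Period (trans (sym (ℕ.*-assoc (k ℕ.^ (relations ℕ.∸ toℕ i)) (k ℕ.^ toℕ i) M))
             (cong (ℕ._* M) (trans (sym (ℕ.^-distribˡ-+-* k (relations ℕ.∸ toℕ i) (toℕ i))) (cong (k ℕ.^_) (ℕ.m∸n+n≡m i≤)))))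
             (period-* (k ℕ.^ (relations ℕ.∸ toℕ i)) period)
        where
        descend : ∀ i d → (∀ s s′ → Equivalent (d ℕ.+ i) s s′ → Equivalent i s s′) → ∀ q s s′ → Equivalent (q ℕ.* d ℕ.+ i) s s′ → Equivalent i s s′
        descend i d h zero s s′ e = e
        descend i d h (suc q) s s′ e = descend i d h q s s′ (equivalent-+ (d ℕ.+ i) i h (q ℕ.* d) s s′
          (subst (λ t → Equivalent t s s′) (trans (cong (ℕ._+ i) (ℕ.+-comm d (q ℕ.* d))) (ℕ.+-assoc (q ℕ.* d) d i)) e))

-- The given polynomial and its floors

eval-Poly : ∀ p → Poly (length p) (λ N x → seq (eval p (fromℚ x)) N)
eval-Poly []      = nil λ _ _ → refl
eval-Poly (c ∷ p) = cons c (eval-Poly p) λ _ _ → refl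

-- Although `≤ᴿ` is only a negation, it suffices: a late approximation with r N + η < z would keep
-- all terms from N₀ on η / 2 below z, against z ≤ᴿ x. The margin of `<ᴿ` is halved to make the
-- upper inequality strict.
isFloor⇒floorLimit : ∀ x z → IsFloor x z → FloorLimit (seq x) z
isFloor⇒floorLimit x z (z≤x , ε , 0<ε , N₁ , x<z+1) = record
  { below = λ η 0<η →
      let N₀ , close = cauchy x (ℚ.½ * η) (½*-pos 0<η)
      in N₀ , λ N N₀≤N → ℚ.≮⇒≥ λ r+η<z → z≤x (ℚ.½ * η , ½*-pos 0<η , N₀ , λ n N₀≤n →
           ℚ.≤-trans (≤-by (ℚ.+-mono-≤ (ℚ.≤-trans (p≤∣p∣ (seq x n - seq x N)) (ℚ.<⇒≤ (close n N N₀≤n N₀≤N))) (ℚ.<⇒≤ r+η<z))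
             (solve 4 (λ a b η z → z :- (a :+ con ℚ.½ :* η) := (con ℚ.½ :* η :+ z) :- ((a :- b) :+ (b :+ η))) refl (seq x n) (seq x N) η ⟦ z ⟧))
             (ℚ.≤-reflexive (sym (⟦⟧-def z))))
  ; above = ℚ.½ * ε , ½*-pos 0<ε , N₁ , λ N N₁≤N →
      <-by (ℚ.+-mono-≤-< (ℚ.≤-trans (x<z+1 N N₁≤N) (ℚ.≤-reflexive (trans (⟦⟧-def (z ℤ.+ ℤ.1ℤ)) (⟦⟧-suc z)))) (½*-pos 0<ε))
        (solve 3 (λ r ε z → z :+ con 1ℚ :- (r :+ con ℚ.½ :* ε) := (z :+ con 1ℚ :+ con ℚ.½ :* ε) :- (r :+ ε :+ con 0ℚ)) refl (seq x N) ε ⟦ z ⟧)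
  }

%ℕ-cong : ∀ {a b} m .{{_ : NonZero m}} k → a ≡ b ℤ.+ k ℤ.* ℤ.+ m → a ℤ.%ℕ m ≡ b ℤ.%ℕ m
%ℕ-cong {a} {b} m k e = ℤ.+-injective (ℤ.i-j≡0⇒i≡j (ℤ.+ r) (ℤ.+ s) (trans difference (cong (ℤ._* ℤ.+ m) q≡0)))
  where
  r = a ℤ.%ℕ m
  s = b ℤ.%ℕ m
  q = b ℤ./ℕ m ℤ.+ k ℤ.- a ℤ./ℕ m
  difference : ℤ.+ r ℤ.- ℤ.+ s ≡ q ℤ.* ℤ.+ m
  difference = trans (ℤsolve 4 (λ r s A m → r ⊝ s ⊜ (r ⊕ A ⊗ m) ⊝ s ⊝ A ⊗ m) refl (ℤ.+ r) (ℤ.+ s) (a ℤ./ℕ m) (ℤ.+ m))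
    (trans (cong (λ t → t ℤ.- ℤ.+ s ℤ.- (a ℤ./ℕ m) ℤ.* ℤ.+ m)
        (trans (sym (ℤ.a≡a%ℕn+[a/ℕn]*n a m)) (trans e (cong (ℤ._+ k ℤ.* ℤ.+ m) (ℤ.a≡a%ℕn+[a/ℕn]*n b m)))))
      (ℤsolve 5 (λ s A B k m → s ⊕ B ⊗ m ⊕ k ⊗ m ⊝ s ⊝ A ⊗ m ⊜ (B ⊕ k ⊝ A) ⊗ m) refl (ℤ.+ s) (a ℤ./ℕ m) (b ℤ./ℕ m) k (ℤ.+ m)))
  ∣q∣m<m : ℤ.∣ q ∣ ℕ.* m ℕ.< 1 ℕ.* m
  ∣q∣m<m = ℕ.≤-<-trans (ℕ.≤-reflexive (trans (sym (ℤ.abs-* q (ℤ.+ m))) (cong ℤ.∣_∣ (trans (sym difference) (ℤ.m-n≡m⊖n r s)))))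
    (ℕ.≤-<-trans (ℤ.∣m⊝n∣≤m⊔n r s) (ℕ.<-≤-trans (ℕ.⊔-pres-<m (ℤ.n%ℕd<d a m) (ℤ.n%ℕd<d b m)) (ℕ.≤-reflexive (sym (ℕ.*-identityˡ m)))))
  q≡0 : q ≡ ℤ.0ℤ
  q≡0 = ℤ.∣i∣≡0⇒i≡0 (ℕ.n<1⇒n≡0 (ℕ.*-cancelʳ-< m ℤ.∣ q ∣ 1 ∣q∣m<m))

toℕ-residue : ∀ z m .{{_ : NonZero m}} → toℕ (residue z m) ≡ z ℤ.%ℕ m
toℕ-residue z m = Fin.toℕ-fromℕ< (ℤ.n%ℕd<d z m)

automatic⇒periodic : (p : Polynomial) (m : ℕ) .{{_ : NonZero m}} → 2 ≤ m →
  (⌊p⌋ : ℕ → ℤ) → (∀ n → IsFloor (eval p (fromℕ n)) (⌊p⌋ n)) →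
  IsAutomatic (λ n → residue (⌊p⌋ n) m) → IsPeriodic (λ n → residue (⌊p⌋ n) m)
automatic⇒periodic p m 2≤m ⌊p⌋ isFloor (k , 2≤k , automatic) =
  let K , u , h , 1≤K , 1≤h , same = Read.shifted-progression 2≤k ρ
      T , 1≤T , period = Read.bounded-period 2≤k ρ Fin._≟_
  -- A zero coefficient is added, since n + 1 coefficients are required and the list may be empty.
  in T , 1≤T , period λ none → Progressions.periodic (Poly-suc (eval-Poly p)) 2≤m {⌊p⌋} floors 1≤K 1≤h (congruent K u h same)
       λ { (T′ , 1≤T′ , p) → none (T′ , 1≤T′ , λ n → Fin.toℕ-injective (trans (toℕ-residue (⌊p⌋ (n ℕ.+ T′)) m)
           (trans (%ℕ-cong {⌊p⌋ (n ℕ.+ T′)} {⌊p⌋ n} m (proj₁ (p n)) (proj₂ (p n))) (sym (toℕ-residue (⌊p⌋ n) m))))) }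
  where
  ρ : Reading k (λ n → residue (⌊p⌋ n) m)
  ρ = automatic⇒reading k 2≤k automatic
  floors : ∀ z → FloorLimit (λ N → seq (eval p (fromℚ (ι z))) N) (⌊p⌋ z)
  floors z = subst (λ x → FloorLimit (seq (eval p (fromℚ x))) (⌊p⌋ z)) (⟦⟧-def (ℤ.+ z))
    (isFloor⇒floorLimit (eval p (fromℕ z)) (⌊p⌋ z) (isFloor z))
  congruent : ∀ K u h → (∀ x → residue (⌊p⌋ (K ℕ.* x ℕ.+ u)) m ≡ residue (⌊p⌋ (K ℕ.* x ℕ.+ u ℕ.+ h)) m) →
    ∀ x → ∃[ z ] ⌊p⌋ (K ℕ.* x ℕ.+ u) ≡ ⌊p⌋ (K ℕ.* x ℕ.+ u ℕ.+ h) ℤ.+ z ℤ.* ℤ.+ m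
  congruent K u h same x = %ℕ-≡ {⌊p⌋ (K ℕ.* x ℕ.+ u)} {⌊p⌋ (K ℕ.* x ℕ.+ u ℕ.+ h)} m
    (trans (sym (toℕ-residue (⌊p⌋ (K ℕ.* x ℕ.+ u)) m)) (trans (cong toℕ (same x)) (toℕ-residue (⌊p⌋ (K ℕ.* x ℕ.+ u ℕ.+ h)) m)))

corollary2p3 : (p : Polynomial) (m : ℕ) .{{_ : NonZero m}} → 2 ≤ m →
    (⌊p⌋ : ℕ → ℤ) → (∀ n → IsFloor (eval p (fromℕ n)) (⌊p⌋ n)) →
    IsAutomatic (λ n → residue (⌊p⌋ n) m) ⇔ IsPeriodic (λ n → residue (⌊p⌋ n) m)
corollary2p3 p m 2≤m ⌊p⌋ isFloor = mk⇔ (automatic⇒periodic p m 2≤m ⌊p⌋ isFloor) periodic⇒automatic
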